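{- Let $p<q$ be square-free integers $\ge 2$ with $p\equiv q\equiv 1\pmod 4$, put $r=pq/\gcd(p,q)^2$ and assume $p<q<r$. Let $K=\mathbb{Q}(\sqrt p,\sqrt q)$ (where either $\gcd(p,q)\equiv 1\pmod 4$ or $\gcd(p,q)\equiv 3\pmod 4$). Let $m,t,\kappa$ be positive integers and let $$I_4=\left[\frac{m\kappa}{t}+2\frac{\sqrt m}{\sqrt t},\ \frac{m\kappa}{t-1}-2\frac{\sqrt m}{\sqrt{t-1}}\right]\quad(t>1),$$ where the right endpoint is replaced by $\infty$ when $t=1$. If $m\le\min\{\frac{r}{16(\kappa\sqrt r+1)},\,p,\,q\}$ and $\sqrt p,\sqrt q\in I_4$, then not all elements of $m\mathcal{O}_K^+$ are sums of squares of elements of $\mathcal{O}_K$. Moreover, the interval $I_4$ is non-empty for $m\ge\frac{t(t-1)\left(2t-1+2\sqrt{t(t-1)}\right)}{\kappa^2}$.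
   Context: $\mathcal{O}_K$ is the ring of integers of $K$, $\mathcal{O}_K^+$ is the set of its totally positive elements (all four real embeddings positive), and $m\mathcal{O}_K^+=\{m\alpha:\alpha\in\mathcal{O}_K^+\}$. A sum of squares in $\mathcal{O}_K$ is a finite sum $\sum_i\alpha_i^2$ with $\alpha_i\in\mathcal{O}_K$.
   Formalization: The lower bound on m in the last sentence carries an extra factor 4: m ≥ 4t(t-1)(2t-1+2√(t(t-1)))/κ². As printed it fails: for κ=1, t=2, m=12 the bound (about 11.66) holds but I_4 is empty. -}

module Defs where

open import Data.Integer.Base as ℤ using (ℤ; +_)
import Data.Integer.Properties as ℤ
open import Data.List.Base using (List; []; _∷_)
open import Data.List.Relation.Unary.All using (All)
open import Data.Nat.Base as ℕ using (ℕ; zero; suc; z≤n; s≤s)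
open import Data.Nat.Divisibility using (_∣_)
import Data.Nat.Properties as ℕ
import Data.Nat.Solver as ℕ
open import Data.Product.Base using (∃-syntax; _×_; _,_)
open import Data.Rational.Base as ℚ using (ℚ; mkℚ; 0ℚ; 1ℚ; ½; ∣_∣)
import Data.Rational.Properties as ℚ
import Data.Rational.Solver as ℚ
import Data.Rational.Unnormalised.Base as ℚᵘ
import Data.Rational.Unnormalised.Properties as ℚᵘ
open import Data.Sign.Base as Sign using (Sign)
open import Data.Sum.Base using (inj₁; inj₂)
open import Level using (0ℓ)
open import Relation.Binary.PropositionalEquality
open import Relation.Nullary using (yes; no; contradiction)
open import Relation.Unary using (Pred)

------------------------------------------------------------------------
-- Square-free numbers

SquareFree : ℕ → Set
SquareFree n = ∀ d → d ℕ.* d ∣ n → d ≡ 1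

------------------------------------------------------------------------
-- Rational preliminaries

x+[y-x] : ∀ x y → x ℚ.+ (y ℚ.- x) ≡ y
x+[y-x] = solve 2 (λ x y → x :+ (y :- x) := y) refl
  where open ℚ.+-*-Solver

half+half : ∀ x → ½ ℚ.* x ℚ.+ ½ ℚ.* x ≡ x
half+half x = begin
  ½ ℚ.* x ℚ.+ ½ ℚ.* x  ≡⟨ ℚ.*-distribʳ-+ x ½ ½ ⟨
  1ℚ ℚ.* x             ≡⟨ ℚ.*-identityˡ x ⟩
  x                    ∎
  where open ≡-Reasoning

*-pos : ∀ {x y} → 0ℚ ℚ.< x → 0ℚ ℚ.< y → 0ℚ ℚ.< x ℚ.* y
*-pos {x} {y} 0<x 0<y = ℚ.positive⁻¹ _ {{ℚ.pos*pos⇒pos x {{ℚ.positive 0<x}} y {{ℚ.positive 0<y}}}}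

+-pos : ∀ {x y} → 0ℚ ℚ.< x → 0ℚ ℚ.< y → 0ℚ ℚ.< x ℚ.+ y
+-pos {x} {y} 0<x 0<y = subst (ℚ._< x ℚ.+ y) (ℚ.+-identityˡ 0ℚ) (ℚ.+-mono-< 0<x 0<y)

*-mono-≤ : ∀ {w x y z} → 0ℚ ℚ.≤ w → 0ℚ ℚ.≤ y → w ℚ.≤ x → y ℚ.≤ z → w ℚ.* y ℚ.≤ x ℚ.* z
*-mono-≤ {w} {x} {y} {z} 0≤w 0≤y w≤x y≤z = ℚ.≤-trans
  (ℚ.*-monoʳ-≤-nonNeg y {{ℚ.nonNegative 0≤y}} w≤x)
  (ℚ.*-monoˡ-≤-nonNeg x {{ℚ.nonNegative (ℚ.≤-trans 0≤w w≤x)}} y≤z)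

∣∣≤ : ∀ {x y} → x ℚ.≤ y → ℚ.- x ℚ.≤ y → ∣ x ∣ ℚ.≤ y
∣∣≤ {x} {y} x≤y -x≤y with ℚ.∣p∣≡p∨∣p∣≡-p x
... | inj₁ eq = subst (ℚ._≤ y) (sym eq) x≤y
... | inj₂ eq = subst (ℚ._≤ y) (sym eq) -x≤y

-- The reciprocal extended by 0 at 0.
inv : ℚ → ℚ
inv x with x ℚ.≟ 0ℚ
... | yes _   = 0ℚ
... | no  x≢0 = ℚ.1/_ x {{ℚ.≢-nonZero x≢0}}

inv-inverseʳ : ∀ x → 0ℚ ℚ.< x → x ℚ.* inv x ≡ 1ℚ
inv-inverseʳ x 0<x with x ℚ.≟ 0ℚ
... | yes x≡0 = contradiction (subst (0ℚ ℚ.<_) x≡0 0<x) (ℚ.<-irrefl refl)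
... | no  x≢0 = ℚ.*-inverseʳ x {{ℚ.≢-nonZero x≢0}}

inv-pos : ∀ x → 0ℚ ℚ.< x → 0ℚ ℚ.< inv x
inv-pos x 0<x with x ℚ.≟ 0ℚ
... | yes x≡0 = contradiction (subst (0ℚ ℚ.<_) x≡0 0<x) (ℚ.<-irrefl refl)
... | no  x≢0 = ℚ.positive⁻¹ _ {{ℚ.1/pos⇒pos x {{ℚ.positive 0<x}}}}

------------------------------------------------------------------------
-- Real numbers: Cauchy sequences of rationals, with pointwise operations

Close : (ℕ → ℚ) → ℚ → Set
Close s ε = ∃[ N ] (∀ i j → N ℕ.≤ i → N ℕ.≤ j → ∣ s i ℚ.- s j ∣ ℚ.≤ ε)

record ℝ : Set where
  no-eta-equality
  field
    seq    : ℕ → ℚ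
    cauchy : ∀ ε → 0ℚ ℚ.< ε → Close seq ε

open ℝ public

record Positive (x : ℝ) : Set where
  constructor mkPositive
  field
    ε      : ℚ
    0<ε    : 0ℚ ℚ.< ε
    N      : ℕ
    bounds : ∀ n → N ℕ.≤ n → ε ℚ.≤ seq x n

infix 4 _≤_

-- Equivalent to ¬ Positive (x - y).
_≤_ : ℝ → ℝ → Set
x ≤ y = ∀ ε → 0ℚ ℚ.< ε → ∃[ N ] (∀ n → N ℕ.≤ n → seq x n ℚ.≤ seq y n ℚ.+ ε)

fromℚ : ℚ → ℝ
fromℚ a .seq _ = a
fromℚ a .cauchy ε 0<ε = 0 , λ _ _ _ _ →
  subst (ℚ._≤ ε) (sym (cong ∣_∣ (ℚ.+-inverseʳ a))) (ℚ.<⇒≤ 0<ε)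

fromℕ : ℕ → ℝ
fromℕ n .seq    = fromℚ (+ n ℚ./ 1) .seq
fromℕ n .cauchy = fromℚ (+ n ℚ./ 1) .cauchy

infixl 6 _+_

_+_ : ℝ → ℝ → ℝ
(x + y) .seq n = seq x n ℚ.+ seq y n
(x + y) .cauchy ε 0<ε with cauchy x (½ ℚ.* ε) (*-pos (ℚ.positive⁻¹ ½) 0<ε)
                         | cauchy y (½ ℚ.* ε) (*-pos (ℚ.positive⁻¹ ½) 0<ε)
... | M , x-close | N , y-close = M ℕ.+ N , λ i j M+N≤i M+N≤j → begin
  ∣ (seq x i ℚ.+ seq y i) ℚ.- (seq x j ℚ.+ seq y j) ∣
    ≡⟨ cong ∣_∣ (rearrange (seq x i) (seq y i) (seq x j) (seq y j)) ⟩
  ∣ (seq x i ℚ.- seq x j) ℚ.+ (seq y i ℚ.- seq y j) ∣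
    ≤⟨ ℚ.∣p+q∣≤∣p∣+∣q∣ (seq x i ℚ.- seq x j) (seq y i ℚ.- seq y j) ⟩
  ∣ seq x i ℚ.- seq x j ∣ ℚ.+ ∣ seq y i ℚ.- seq y j ∣
    ≤⟨ ℚ.+-mono-≤
         (x-close i j (ℕ.m+n≤o⇒m≤o M M+N≤i) (ℕ.m+n≤o⇒m≤o M M+N≤j))
         (y-close i j (ℕ.m+n≤o⇒n≤o M M+N≤i) (ℕ.m+n≤o⇒n≤o M M+N≤j)) ⟩
  ½ ℚ.* ε ℚ.+ ½ ℚ.* ε
    ≡⟨ half+half ε ⟩
  ε ∎
  where
  open ℚ.≤-Reasoning
  rearrange : ∀ a b c d → (a ℚ.+ b) ℚ.- (c ℚ.+ d) ≡ (a ℚ.- c) ℚ.+ (b ℚ.- d)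
  rearrange = solve 4 (λ a b c d → (a :+ b) :- (c :+ d) := (a :- c) :+ (b :- d)) refl
    where open ℚ.+-*-Solver

infix 8 -_

-_ : ℝ → ℝ
(- x) .seq n = ℚ.- seq x n
(- x) .cauchy ε 0<ε with cauchy x ε 0<ε
... | N , x-close = N , λ i j N≤i N≤j →
  subst (ℚ._≤ ε)
    (trans (sym (ℚ.∣-p∣≡∣p∣ (seq x i ℚ.- seq x j)))
           (cong ∣_∣ (ℚ.neg-distrib-+ (seq x i) (ℚ.- seq x j))))
    (x-close i j N≤i N≤j)

infixl 6 _-_

_-_ : ℝ → ℝ → ℝ
x - y = x + - y

Bounded : ℝ → Set
Bounded x = ∃[ B ] ∃[ N ] (0ℚ ℚ.< B × (∀ n → N ℕ.≤ n → ∣ seq x n ∣ ℚ.≤ B))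

bounded : ∀ x → Bounded x
bounded x with cauchy x 1ℚ (ℚ.positive⁻¹ 1ℚ)
... | N , x-close =
  ∣ seq x N ∣ ℚ.+ 1ℚ , N ,
  subst (ℚ._< ∣ seq x N ∣ ℚ.+ 1ℚ) (ℚ.+-identityˡ 0ℚ)
    (ℚ.+-mono-≤-< (ℚ.0≤∣p∣ (seq x N)) (ℚ.positive⁻¹ 1ℚ)) ,
  λ n N≤n → begin
    ∣ seq x n ∣
      ≡⟨ cong ∣_∣ (x+[y-x] (seq x N) (seq x n)) ⟨
    ∣ seq x N ℚ.+ (seq x n ℚ.- seq x N) ∣
      ≤⟨ ℚ.∣p+q∣≤∣p∣+∣q∣ (seq x N) (seq x n ℚ.- seq x N) ⟩
    ∣ seq x N ∣ ℚ.+ ∣ seq x n ℚ.- seq x N ∣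
      ≤⟨ ℚ.+-monoʳ-≤ ∣ seq x N ∣ (x-close n N N≤n ℕ.≤-refl) ⟩
    ∣ seq x N ∣ ℚ.+ 1ℚ ∎
  where open ℚ.≤-Reasoning

product-close : ∀ a b c d B C δ → ∣ a ∣ ℚ.≤ B → ∣ d ∣ ℚ.≤ C →
                ∣ a ℚ.- c ∣ ℚ.≤ δ → ∣ b ℚ.- d ∣ ℚ.≤ δ →
                ∣ a ℚ.* b ℚ.- c ℚ.* d ∣ ℚ.≤ (B ℚ.+ C) ℚ.* δ
product-close a b c d B C δ ∣a∣≤B ∣d∣≤C a-c≤δ b-d≤δ = begin
  ∣ a ℚ.* b ℚ.- c ℚ.* d ∣
    ≡⟨ cong ∣_∣ (rearrange a b c d) ⟩
  ∣ a ℚ.* (b ℚ.- d) ℚ.+ d ℚ.* (a ℚ.- c) ∣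
    ≤⟨ ℚ.∣p+q∣≤∣p∣+∣q∣ (a ℚ.* (b ℚ.- d)) (d ℚ.* (a ℚ.- c)) ⟩
  ∣ a ℚ.* (b ℚ.- d) ∣ ℚ.+ ∣ d ℚ.* (a ℚ.- c) ∣
    ≡⟨ cong₂ ℚ._+_ (ℚ.∣p*q∣≡∣p∣*∣q∣ a (b ℚ.- d)) (ℚ.∣p*q∣≡∣p∣*∣q∣ d (a ℚ.- c)) ⟩
  ∣ a ∣ ℚ.* ∣ b ℚ.- d ∣ ℚ.+ ∣ d ∣ ℚ.* ∣ a ℚ.- c ∣
    ≤⟨ ℚ.+-mono-≤
         (*-mono-≤ (ℚ.0≤∣p∣ a) (ℚ.0≤∣p∣ (b ℚ.- d)) ∣a∣≤B b-d≤δ)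
         (*-mono-≤ (ℚ.0≤∣p∣ d) (ℚ.0≤∣p∣ (a ℚ.- c)) ∣d∣≤C a-c≤δ) ⟩
  B ℚ.* δ ℚ.+ C ℚ.* δ
    ≡⟨ ℚ.*-distribʳ-+ δ B C ⟨
  (B ℚ.+ C) ℚ.* δ ∎
  where
  open ℚ.≤-Reasoning
  rearrange : ∀ a b c d → a ℚ.* b ℚ.- c ℚ.* d ≡ a ℚ.* (b ℚ.- d) ℚ.+ d ℚ.* (a ℚ.- c)
  rearrange = solve 4 (λ a b c d → a :* b :- c :* d := a :* (b :- d) :+ d :* (a :- c)) refl
    where open ℚ.+-*-Solver

infixl 7 _*_

_*_ : ℝ → ℝ → ℝ
(x * y) .seq n = seq x n ℚ.* seq y n
(x * y) .cauchy ε 0<ε = close (bounded x) (bounded y)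
  where
  combine : ∀ B C δ M N →
            (∀ n → M ℕ.≤ n → ∣ seq x n ∣ ℚ.≤ B) → (∀ n → N ℕ.≤ n → ∣ seq y n ∣ ℚ.≤ C) →
            (B ℚ.+ C) ℚ.* δ ≡ ε → Close (seq x) δ → Close (seq y) δ →
            Close (λ n → seq x n ℚ.* seq y n) ε
  combine B C δ M N ∣x∣≤B ∣y∣≤C eq (M′ , x-close) (N′ , y-close) =
    (M ℕ.+ M′) ℕ.+ (N ℕ.+ N′) , λ i j ≤i ≤j →
    let ≤i₁ = ℕ.m+n≤o⇒m≤o (M ℕ.+ M′) ≤i
        ≤i₂ = ℕ.m+n≤o⇒n≤o (M ℕ.+ M′) ≤i
        ≤j₁ = ℕ.m+n≤o⇒m≤o (M ℕ.+ M′) ≤j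
        ≤j₂ = ℕ.m+n≤o⇒n≤o (M ℕ.+ M′) ≤j
    in subst (∣ seq x i ℚ.* seq y i ℚ.- seq x j ℚ.* seq y j ∣ ℚ.≤_) eq
      (product-close (seq x i) (seq y i) (seq x j) (seq y j) B C δ
        (∣x∣≤B i (ℕ.m+n≤o⇒m≤o M ≤i₁))
        (∣y∣≤C j (ℕ.m+n≤o⇒m≤o N ≤j₂))
        (x-close i j (ℕ.m+n≤o⇒n≤o M ≤i₁) (ℕ.m+n≤o⇒n≤o M ≤j₁))
        (y-close i j (ℕ.m+n≤o⇒n≤o N ≤i₂) (ℕ.m+n≤o⇒n≤o N ≤j₂)))

  pull : ∀ a b c → a ℚ.* (b ℚ.* c) ≡ b ℚ.* (a ℚ.* c)
  pull = solve 3 (λ a b c → a :* (b :* c) := b :* (a :* c)) refl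
    where open ℚ.+-*-Solver

  close : Bounded x → Bounded y → Close (λ n → seq x n ℚ.* seq y n) ε
  close (B , M , 0<B , ∣x∣≤B) (C , N , 0<C , ∣y∣≤C) =
    combine B C δ M N ∣x∣≤B ∣y∣≤C eq (cauchy x δ 0<δ) (cauchy y δ 0<δ)
    where
    0<B+C : 0ℚ ℚ.< B ℚ.+ C
    0<B+C = +-pos 0<B 0<C
    δ : ℚ
    δ = ε ℚ.* inv (B ℚ.+ C)
    0<δ : 0ℚ ℚ.< δ
    0<δ = *-pos 0<ε (inv-pos (B ℚ.+ C) 0<B+C)
    eq : (B ℚ.+ C) ℚ.* δ ≡ ε
    eq = trans (pull (B ℚ.+ C) ε (inv (B ℚ.+ C)))
      (trans (cong (ε ℚ.*_) (inv-inverseʳ (B ℚ.+ C) 0<B+C)) (ℚ.*-identityʳ ε))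

inv-lipschitz : ∀ δ x y → 0ℚ ℚ.< δ → δ ℚ.≤ x → δ ℚ.≤ y →
                ∣ inv x ℚ.- inv y ∣ ℚ.≤ (inv δ ℚ.* inv δ) ℚ.* ∣ x ℚ.- y ∣
inv-lipschitz δ x y 0<δ δ≤x δ≤y = begin
  ∣ inv x ℚ.- inv y ∣
    ≡⟨ cong ∣_∣ (difference (ℚ.<-≤-trans 0<δ δ≤x) (ℚ.<-≤-trans 0<δ δ≤y)) ⟩
  ∣ (inv x ℚ.* inv y) ℚ.* (y ℚ.- x) ∣
    ≡⟨ ℚ.∣p*q∣≡∣p∣*∣q∣ (inv x ℚ.* inv y) (y ℚ.- x) ⟩
  ∣ inv x ℚ.* inv y ∣ ℚ.* ∣ y ℚ.- x ∣
    ≡⟨ cong₂ ℚ._*_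
         (ℚ.0≤p⇒∣p∣≡p (ℚ.<⇒≤ (*-pos (inv-pos x 0<x) (inv-pos y 0<y))))
         (trans (sym (ℚ.∣-p∣≡∣p∣ (y ℚ.- x))) (cong ∣_∣ (flip y x))) ⟩
  (inv x ℚ.* inv y) ℚ.* ∣ x ℚ.- y ∣
    ≤⟨ ℚ.*-monoʳ-≤-nonNeg ∣ x ℚ.- y ∣ {{ℚ.∣-∣-nonNeg (x ℚ.- y)}}
         (*-mono-≤ (ℚ.<⇒≤ (inv-pos x 0<x)) (ℚ.<⇒≤ (inv-pos y 0<y))
           (antitone δ≤x) (antitone δ≤y)) ⟩
  (inv δ ℚ.* inv δ) ℚ.* ∣ x ℚ.- y ∣ ∎
  where
  open ℚ.≤-Reasoning
  0<x = ℚ.<-≤-trans 0<δ δ≤x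
  0<y = ℚ.<-≤-trans 0<δ δ≤y
  flip : ∀ a b → ℚ.- (a ℚ.- b) ≡ b ℚ.- a
  flip = solve 2 (λ a b → :- (a :- b) := b :- a) refl
    where open ℚ.+-*-Solver
  expand : ∀ a b c d → (c ℚ.* d) ℚ.* (b ℚ.- a) ≡ c ℚ.* (b ℚ.* d) ℚ.- d ℚ.* (a ℚ.* c)
  expand = solve 4 (λ a b c d → (c :* d) :* (b :- a) := c :* (b :* d) :- d :* (a :* c)) refl
    where open ℚ.+-*-Solver
  difference : ∀ {a b} → 0ℚ ℚ.< a → 0ℚ ℚ.< b →
               inv a ℚ.- inv b ≡ (inv a ℚ.* inv b) ℚ.* (b ℚ.- a)
  difference {a} {b} 0<a 0<b = sym (trans (expand a b (inv a) (inv b))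
    (cong₂ ℚ._-_
      (trans (cong (inv a ℚ.*_) (inv-inverseʳ b 0<b)) (ℚ.*-identityʳ (inv a)))
      (trans (cong (inv b ℚ.*_) (inv-inverseʳ a 0<a)) (ℚ.*-identityʳ (inv b)))))
  antitone : ∀ {z} → δ ℚ.≤ z → inv z ℚ.≤ inv δ
  antitone {z} δ≤z = begin
    inv z                        ≡⟨ ℚ.*-identityʳ (inv z) ⟨
    inv z ℚ.* 1ℚ                 ≡⟨ cong (inv z ℚ.*_) (inv-inverseʳ δ 0<δ) ⟨
    inv z ℚ.* (δ ℚ.* inv δ)      ≤⟨ ℚ.*-monoˡ-≤-nonNeg (inv z)
                                      {{ℚ.nonNegative (ℚ.<⇒≤ (inv-pos z 0<z))}}
                                      (ℚ.*-monoʳ-≤-nonNeg (inv δ)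
                                        {{ℚ.nonNegative (ℚ.<⇒≤ (inv-pos δ 0<δ))}} δ≤z) ⟩
    inv z ℚ.* (z ℚ.* inv δ)      ≡⟨ ℚ.*-assoc (inv z) z (inv δ) ⟨
    (inv z ℚ.* z) ℚ.* inv δ      ≡⟨ cong (ℚ._* inv δ)
                                      (trans (ℚ.*-comm (inv z) z) (inv-inverseʳ z 0<z)) ⟩
    1ℚ ℚ.* inv δ                 ≡⟨ ℚ.*-identityˡ (inv δ) ⟩
    inv δ                        ∎
    where 0<z = ℚ.<-≤-trans 0<δ δ≤z

infix 8 _⁻¹

-- Terms of the sequence that vanish are finitely many, so the value of
-- inv at 0 does not matter.
_⁻¹ : (x : ℝ) → {{Positive x}} → ℝ
(x ⁻¹) .seq n = inv (seq x n)
((x ⁻¹) {{mkPositive δ 0<δ M δ≤x}}) .cauchy ε 0<ε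
  with cauchy x (ε ℚ.* (δ ℚ.* δ)) (*-pos 0<ε (*-pos 0<δ 0<δ))
... | N , x-close = M ℕ.+ N , λ i j ≤i ≤j → begin
  ∣ inv (seq x i) ℚ.- inv (seq x j) ∣
    ≤⟨ inv-lipschitz δ (seq x i) (seq x j) 0<δ
         (δ≤x i (ℕ.m+n≤o⇒m≤o M ≤i)) (δ≤x j (ℕ.m+n≤o⇒m≤o M ≤j)) ⟩
  (inv δ ℚ.* inv δ) ℚ.* ∣ seq x i ℚ.- seq x j ∣
    ≤⟨ ℚ.*-monoˡ-≤-nonNeg (inv δ ℚ.* inv δ)
         {{ℚ.nonNegative (ℚ.<⇒≤ (*-pos (inv-pos δ 0<δ) (inv-pos δ 0<δ)))}}
         (x-close i j (ℕ.m+n≤o⇒n≤o M ≤i) (ℕ.m+n≤o⇒n≤o M ≤j)) ⟩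
  (inv δ ℚ.* inv δ) ℚ.* (ε ℚ.* (δ ℚ.* δ))
    ≡⟨ rearrange ε δ (inv δ) ⟩
  ε ℚ.* ((δ ℚ.* inv δ) ℚ.* (δ ℚ.* inv δ))
    ≡⟨ cong (λ u → ε ℚ.* (u ℚ.* u)) (inv-inverseʳ δ 0<δ) ⟩
  ε ℚ.* 1ℚ
    ≡⟨ ℚ.*-identityʳ ε ⟩
  ε ∎
  where
  open ℚ.≤-Reasoning
  rearrange : ∀ a b c → (c ℚ.* c) ℚ.* (a ℚ.* (b ℚ.* b)) ≡ a ℚ.* ((b ℚ.* c) ℚ.* (b ℚ.* c))
  rearrange = solve 3 (λ a b c → (c :* c) :* (a :* (b :* b)) := a :* ((b :* c) :* (b :* c))) refl
    where open ℚ.+-*-Solver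

infixl 7 _/_

_/_ : ℝ → (y : ℝ) → {{Positive y}} → ℝ
x / y = x * y ⁻¹

------------------------------------------------------------------------
-- Square roots of natural numbers

-- ⌊√n⌋
isqrt : ℕ → ℕ
isqrt zero = 0
isqrt (suc n) with suc (isqrt n) ℕ.* suc (isqrt n) ℕ.≤? suc n
... | yes _ = suc (isqrt n)
... | no  _ = isqrt n

isqrt-lower : ∀ n → isqrt n ℕ.* isqrt n ℕ.≤ n
isqrt-lower zero = z≤n
isqrt-lower (suc n) with suc (isqrt n) ℕ.* suc (isqrt n) ℕ.≤? suc n
... | yes p = p
... | no  _ = ℕ.m≤n⇒m≤1+n (isqrt-lower n)

isqrt-upper : ∀ n → n ℕ.< suc (isqrt n) ℕ.* suc (isqrt n)
isqrt-upper zero = s≤s z≤n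
isqrt-upper (suc n) with suc (isqrt n) ℕ.* suc (isqrt n) ℕ.≤? suc n
... | yes _ = ℕ.<-≤-trans (s≤s (isqrt-upper n))
  (ℕ.*-mono-< {suc s} {suc (suc s)} {suc s} (ℕ.n<1+n (suc s)) (ℕ.n<1+n (suc s)))
  where s = isqrt n
... | no ¬p = ℕ.≰⇒> ¬p

square-cancel-≤ : ∀ {a b} → a ℕ.* a ℕ.≤ b ℕ.* b → a ℕ.≤ b
square-cancel-≤ {a} {b} a²≤b² with a ℕ.≤? b
... | yes a≤b = a≤b
... | no  a≰b = contradiction a²≤b² (ℕ.<⇒≱ (ℕ.*-mono-< (ℕ.≰⇒> a≰b) (ℕ.≰⇒> a≰b)))

square-cancel-< : ∀ {a b} → a ℕ.* a ℕ.< b ℕ.* b → a ℕ.< b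
square-cancel-< {a} {b} a²<b² with b ℕ.≤? a
... | yes b≤a = contradiction (ℕ.*-mono-≤ b≤a b≤a) (ℕ.<⇒≱ a²<b²)
... | no  b≰a = ℕ.≰⇒> b≰a

/-mono : ∀ a b c d .{{_ : ℕ.NonZero b}} .{{_ : ℕ.NonZero d}} →
         a ℕ.* d ℕ.≤ c ℕ.* b → + a ℚ./ b ℚ.≤ + c ℚ./ d
/-mono a (suc b) c (suc d) ad≤cb =
  ℚ.toℚᵘ-cancel-≤
    (ℚᵘ.≤-respˡ-≃ (ℚᵘ.≃-sym (ℚ.toℚᵘ-fromℚᵘ (ℚᵘ.mkℚᵘ (+ a) b)))
    (ℚᵘ.≤-respʳ-≃ (ℚᵘ.≃-sym (ℚ.toℚᵘ-fromℚᵘ (ℚᵘ.mkℚᵘ (+ c) d)))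
      (ℚᵘ.*≤* (subst₂ ℤ._≤_ (ℤ.pos-* a (suc d)) (ℤ.pos-* c (suc b)) (ℤ.+≤+ ad≤cb)))))

-- The n-th term is ⌊(n+1)√a⌋ / (n+1).
sqrtSeq : ℕ → ℕ → ℚ
sqrtSeq a n = + isqrt (a ℕ.* (suc n ℕ.* suc n)) ℚ./ suc n

1/ᵈ≤ : ∀ ε → 0ℚ ℚ.< ε → + 1 ℚ./ ℚ.↧ₙ ε ℚ.≤ ε
1/ᵈ≤ ε@(mkℚ (+ suc m) d _) _ =
  subst (+ 1 ℚ./ suc d ℚ.≤_) (ℚ.fromℚᵘ-toℚᵘ ε)
    (/-mono 1 (suc d) (suc m) (suc d) (ℕ.*-monoˡ-≤ (suc d) {1} {suc m} (s≤s z≤n)))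
1/ᵈ≤ (mkℚ (+ zero) d _) (ℚ.*<* (ℤ.+<+ ()))
1/ᵈ≤ (mkℚ (ℤ.-[1+ _ ]) d _) (ℚ.*<* ())

sqrtSeq-close : ∀ a i j → sqrtSeq a j ℚ.≤ sqrtSeq a i ℚ.+ + 1 ℚ./ suc i
sqrtSeq-close a i j = begin
  + s j ℚ./ suc j                    ≤⟨ /-mono (s j) (suc j) (suc (s i)) (suc i) crossed ⟩
  + suc (s i) ℚ./ suc i              ≡⟨ split ⟩
  + s i ℚ./ suc i ℚ.+ + 1 ℚ./ suc i  ∎
  where
  open ℚ.≤-Reasoning
  s : ℕ → ℕ
  s n = isqrt (a ℕ.* (suc n ℕ.* suc n))
  swap : ∀ x y → (x ℕ.* y) ℕ.* (x ℕ.* y) ≡ (x ℕ.* x) ℕ.* (y ℕ.* y)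
  swap = solve 2 (λ x y → (x :* y) :* (x :* y) := (x :* x) :* (y :* y)) refl
    where open ℕ.+-*-Solver
  shuffle : ∀ x y z → (x ℕ.* y) ℕ.* z ≡ (x ℕ.* z) ℕ.* y
  shuffle = solve 3 (λ x y z → (x :* y) :* z := (x :* z) :* y) refl
    where open ℕ.+-*-Solver
  crossed : s j ℕ.* suc i ℕ.≤ suc (s i) ℕ.* suc j
  crossed = square-cancel-≤ (ℕ.≤-trans (ℕ.≤-reflexive (swap (s j) (suc i)))
    (ℕ.≤-trans (ℕ.*-monoˡ-≤ (suc i ℕ.* suc i) (isqrt-lower (a ℕ.* (suc j ℕ.* suc j))))
    (ℕ.≤-trans (ℕ.≤-reflexive (shuffle a (suc j ℕ.* suc j) (suc i ℕ.* suc i)))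
    (ℕ.≤-trans (ℕ.*-monoˡ-≤ (suc j ℕ.* suc j) (ℕ.<⇒≤ (isqrt-upper (a ℕ.* (suc i ℕ.* suc i)))))
    (ℕ.≤-reflexive (sym (swap (suc (s i)) (suc j))))))))
  split : + suc (s i) ℚ./ suc i ≡ + s i ℚ./ suc i ℚ.+ + 1 ℚ./ suc i
  split = ℚ.toℚᵘ-injective (ℚᵘ.≃-trans (ℚ.toℚᵘ-fromℚᵘ (ℚᵘ.mkℚᵘ (+ suc (s i)) i))
    (ℚᵘ.≃-trans (ℚᵘ.*≡* eq)
    (ℚᵘ.≃-sym (ℚᵘ.≃-trans (ℚ.toℚᵘ-homo-+ (+ s i ℚ./ suc i) (+ 1 ℚ./ suc i))
      (ℚᵘ.+-cong (ℚ.toℚᵘ-fromℚᵘ (ℚᵘ.mkℚᵘ (+ s i) i)) (ℚ.toℚᵘ-fromℚᵘ (ℚᵘ.mkℚᵘ (+ 1) i)))))))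
    where
    sum = ℚᵘ.mkℚᵘ (+ s i) i ℚᵘ.+ ℚᵘ.mkℚᵘ (+ 1) i
    natural : ∀ x y → suc x ℕ.* (y ℕ.* y) ≡ (x ℕ.* y ℕ.+ 1 ℕ.* y) ℕ.* y
    natural = solve 2 (λ x y → (con 1 :+ x) :* (y :* y) := (x :* y :+ con 1 :* y) :* y) refl
      where open ℕ.+-*-Solver
    eq : + suc (s i) ℤ.* ℚᵘ.↧ sum ≡ ℚᵘ.↥ sum ℤ.* + suc i
    eq = trans (sym (ℤ.pos-* (suc (s i)) (suc i ℕ.* suc i)))
      (trans (cong +_ (natural (s i) (suc i)))
      (trans (ℤ.pos-* (s i ℕ.* suc i ℕ.+ 1 ℕ.* suc i) (suc i))
        (cong (ℤ._* + suc i)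
          (cong₂ ℤ._+_ (ℤ.pos-* (s i) (suc i)) (ℤ.pos-* 1 (suc i))))))

infix 9 √_

√_ : ℕ → ℝ
(√ a) .seq = sqrtSeq a
(√ a) .cauchy ε 0<ε = N , λ i j N≤i N≤j → ∣∣≤ (one-sided N≤j)
  (subst (ℚ._≤ ε) (sym (flip (sqrtSeq a i) (sqrtSeq a j))) (one-sided N≤i))
  where
  N = ℚ.ℚ.denominator-1 ε
  flip : ∀ x y → ℚ.- (x ℚ.- y) ≡ y ℚ.- x
  flip = solve 2 (λ x y → :- (x :- y) := y :- x) refl
    where open ℚ.+-*-Solver
  cancel : ∀ x y → (x ℚ.+ y) ℚ.- x ≡ y
  cancel = solve 2 (λ x y → (x :+ y) :- x := y) refl
    where open ℚ.+-*-Solver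
  one-sided : ∀ {i j} → N ℕ.≤ i → sqrtSeq a j ℚ.- sqrtSeq a i ℚ.≤ ε
  one-sided {i} {j} N≤i = begin
    sqrtSeq a j ℚ.- sqrtSeq a i
      ≤⟨ ℚ.+-monoˡ-≤ (ℚ.- sqrtSeq a i) (sqrtSeq-close a i j) ⟩
    (sqrtSeq a i ℚ.+ + 1 ℚ./ suc i) ℚ.- sqrtSeq a i
      ≡⟨ cancel (sqrtSeq a i) (+ 1 ℚ./ suc i) ⟩
    + 1 ℚ./ suc i
      ≤⟨ /-mono 1 (suc i) 1 (suc N) (ℕ.*-monoʳ-≤ 1 (s≤s N≤i)) ⟩
    + 1 ℚ./ suc N
      ≤⟨ 1/ᵈ≤ ε 0<ε ⟩
    ε ∎
    where open ℚ.≤-Reasoning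

0≤sqrtSeq : ∀ a n → 0ℚ ℚ.≤ sqrtSeq a n
0≤sqrtSeq a n = /-mono 0 1 (isqrt (a ℕ.* (suc n ℕ.* suc n))) (suc n) z≤n

instance

  fromℕ-positive : ∀ {n} .{{_ : ℕ.NonZero n}} → Positive (fromℕ n)
  fromℕ-positive {suc n} = mkPositive 1ℚ (ℚ.positive⁻¹ 1ℚ) 0
    λ _ _ → /-mono 1 1 (suc n) 1 (s≤s z≤n)

  √-positive : ∀ {a} .{{_ : ℕ.NonZero a}} → Positive (√ a)
  √-positive {a} = mkPositive 1ℚ (ℚ.positive⁻¹ 1ℚ) 0 λ n _ →
    /-mono 1 1 (isqrt (a ℕ.* (suc n ℕ.* suc n))) (suc n)
      (ℕ.≤-trans (ℕ.≤-reflexive (ℕ.*-identityˡ (suc n)))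
      (ℕ.≤-trans
        (ℕ.s≤s⁻¹ (square-cancel-< {suc n}
          (ℕ.≤-<-trans (ℕ.m≤n*m (suc n ℕ.* suc n) a)
            (isqrt-upper (a ℕ.* (suc n ℕ.* suc n))))))
        (ℕ.≤-reflexive (sym (ℕ.*-identityʳ (isqrt (a ℕ.* (suc n ℕ.* suc n))))))))

  *-positive : ∀ {x y} {{_ : Positive x}} {{_ : Positive y}} → Positive (x * y)
  *-positive {{mkPositive δ 0<δ M δ≤x}} {{mkPositive ε 0<ε N ε≤y}} =
    mkPositive (δ ℚ.* ε) (*-pos 0<δ 0<ε) (M ℕ.+ N) λ n ≤n →
      *-mono-≤ (ℚ.<⇒≤ 0<δ) (ℚ.<⇒≤ 0<ε)
        (δ≤x n (ℕ.m+n≤o⇒m≤o M ≤n)) (ε≤y n (ℕ.m+n≤o⇒n≤o M ≤n))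

  k√a+1-positive : ∀ {k a} → Positive (fromℕ k * √ a + fromℕ 1)
  k√a+1-positive {k} {a} = mkPositive 1ℚ (ℚ.positive⁻¹ 1ℚ) 0 λ n _ →
    subst (ℚ._≤ (+ k ℚ./ 1) ℚ.* sqrtSeq a n ℚ.+ 1ℚ) (ℚ.+-identityˡ 1ℚ)
      (ℚ.+-monoˡ-≤ 1ℚ
        (*-mono-≤ {0ℚ} {+ k ℚ./ 1} {0ℚ} ℚ.≤-refl ℚ.≤-refl
          (/-mono 0 1 k 1 z≤n) (0≤sqrtSeq a n)))

------------------------------------------------------------------------
-- The biquadratic field ℚ(√p, √q)

-- a +√p b +√q c +√pq d stands for a + b√p + c√q + d√p√q; this is a basis
-- over ℚ when p ≠ q are square-free and different from 1.
record K (p q : ℕ) : Set where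
  constructor _+√p_+√q_+√pq_
  field
    re coeff-√p coeff-√q coeff-√pq : ℚ

module _ {p q : ℕ} where

  fromℤᴷ : ℤ → K p q
  fromℤᴷ n = (n ℚ./ 1) +√p 0ℚ +√q 0ℚ +√pq 0ℚ

  infixl 6 _+ᴷ_
  infixl 7 _*ᴷ_

  _+ᴷ_ : K p q → K p q → K p q
  (a +√p b +√q c +√pq d) +ᴷ (a′ +√p b′ +√q c′ +√pq d′) =
    (a ℚ.+ a′) +√p (b ℚ.+ b′) +√q (c ℚ.+ c′) +√pq (d ℚ.+ d′)

  _*ᴷ_ : K p q → K p q → K p q
  (a +√p b +√q c +√pq d) *ᴷ (a′ +√p b′ +√q c′ +√pq d′) =
       (a ℚ.* a′ ℚ.+ P ℚ.* (b ℚ.* b′) ℚ.+ Q ℚ.* (c ℚ.* c′) ℚ.+ P ℚ.* Q ℚ.* (d ℚ.* d′))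
    +√p (a ℚ.* b′ ℚ.+ b ℚ.* a′ ℚ.+ Q ℚ.* (c ℚ.* d′ ℚ.+ d ℚ.* c′))
    +√q (a ℚ.* c′ ℚ.+ c ℚ.* a′ ℚ.+ P ℚ.* (b ℚ.* d′ ℚ.+ d ℚ.* b′))
    +√pq (a ℚ.* d′ ℚ.+ d ℚ.* a′ ℚ.+ b ℚ.* c′ ℚ.+ c ℚ.* b′)
    where
    P Q : ℚ
    P = + p ℚ./ 1
    Q = + q ℚ./ 1

  -- The value at x of the monic polynomial Xⁿ + cₙ₋₁Xⁿ⁻¹ + ⋯ + c₀ with
  -- lower coefficients [c₀, …, cₙ₋₁].
  evalMonic : List ℤ → K p q → K p q
  evalMonic []       x = fromℤᴷ (+ 1)
  evalMonic (c ∷ cs) x = fromℤᴷ c +ᴷ x *ᴷ evalMonic cs x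

  sumOfSquares : List (K p q) → K p q
  sumOfSquares []       = fromℤᴷ (+ 0)
  sumOfSquares (x ∷ xs) = x *ᴷ x +ᴷ sumOfSquares xs

signed : Sign → ℝ → ℝ
signed Sign.+ x = x
signed Sign.- x = - x

-- The real embedding sending √p to s√p and √q to s′√q.
embed : ∀ {p q} → Sign → Sign → K p q → ℝ
embed {p} {q} s s′ (a +√p b +√q c +√pq d) =
  fromℚ a + fromℚ b * u + fromℚ c * v + fromℚ d * (u * v)
  where
  u v : ℝ
  u = signed s (√ p)
  v = signed s′ (√ q)

-- Elements integral over ℤ.
𝒪 : ∀ p q → Pred (K p q) 0ℓ
𝒪 p q x = ∃[ cs ] evalMonic cs x ≡ fromℤᴷ (+ 0)

𝒪⁺ : ∀ p q → Pred (K p q) 0ℓ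
𝒪⁺ p q x = 𝒪 p q x × (∀ s s′ → Positive (embed s s′ x))

infix 7 _·_

_·_ : ∀ {p q} → ℕ → Pred (K p q) 0ℓ → Pred (K p q) 0ℓ
(m · S) y = ∃[ x ] (S x × y ≡ fromℤᴷ (+ m) *ᴷ x)

SumsOfSquares : ∀ p q → Pred (K p q) 0ℓ
SumsOfSquares p q x = ∃[ ys ] (All (𝒪 p q) ys × x ≡ sumOfSquares ys)

------------------------------------------------------------------------
-- The interval

-- For t = 1 the right endpoint is ∞.
I₄ : (m t κ : ℕ) .{{_ : ℕ.NonZero t}} → Pred ℝ 0ℓ
I₄ m 1 κ x =
  fromℕ (m ℕ.* κ) / fromℕ 1 + fromℕ 2 * (√ m / √ 1) ≤ x
I₄ m t@(suc t-1@(suc _)) κ x =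
    fromℕ (m ℕ.* κ) / fromℕ t + fromℕ 2 * (√ m / √ t) ≤ x
  × x ≤ fromℕ (m ℕ.* κ) / fromℕ t-1 - fromℕ 2 * (√ m / √ t-1)

{-# OPTIONS --safe #-}
module Submission where

-- Choose u ≡ κ (mod 2) with u − 2 < κ√p < u and put α = (u + κ√p)/2, a totally
-- positive integer. Suppose mα = Σ βᵢ² with βᵢ = aᵢ + bᵢ√p + cᵢ√q + dᵢ√(pq).
-- If some dᵢ ≠ 0, then g dᵢ ∈ ¼ℤ for g = gcd(p,q) gives mu/2 ≥ r/16, contradicting the bound
-- on m. So all dᵢ vanish; then 2bᵢ ∈ ℤ, and B = Σ (2bᵢ)² satisfies pB² + (mκ)² ≤ 2muB by the
-- Cauchy–Schwarz inequality. But √p ∈ I₄ says that F(x) = px² + (mκ)² − 2mux is positive at t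
-- and, for t > 1, at t − 1. These lie on the two sides of mκ/√p, so F is positive at every
-- positive integer.

open import Defs
open import Data.Integer.Base as ℤ using (ℤ; +_)
import Data.Integer.Divisibility.Signed as ℤ
import Data.Integer.Properties as ℤ
open import Data.List.Base using (List; []; _∷_; length)
open import Data.List.Relation.Unary.All as All using (All; []; _∷_)
import Data.Nat.Coprimality as Coprime
open Coprime using (Coprime)
open import Data.Nat.Base as ℕ using (ℕ; zero; suc; NonZero)
open import Data.Nat.Divisibility as ℕ using (_∣_; divides)
open import Data.Nat.DivMod using (m≡m%n+[m/n]*n)
open import Data.Nat.GCD as ℕ using (gcd)
import Data.Nat.Properties as ℕ
open import Data.Product.Base using (_×_; _,_; proj₁; proj₂; ∃-syntax)
open import Data.Rational.Base as ℚ using (ℚ; mkℚ; 0ℚ; 1ℚ; ½; ↥_; ↧ₙ_)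
import Data.Rational.Properties as ℚ
import Data.Rational.Solver as ℚ
import Data.Rational.Unnormalised.Base as ℚᵘ
import Data.Rational.Unnormalised.Properties as ℚᵘ
open import Data.Sign.Base as Sign using (Sign)
open import Data.Sum.Base using (_⊎_; inj₁; inj₂; [_,_]′)
open import Relation.Binary.PropositionalEquality
open import Relation.Nullary using (¬_; Dec; yes; no; contradiction)
open import Relation.Unary using (_∈_; _⊈_; Satisfiable)

open ℚ.+-*-Solver

-- The endpoints of `I₄` are the solutions of (x√p - mκ)² ≥ 4mx at x = t and, for t > 1, at x = t -
-- 1. The right-hand side pays for rounding κ√p up to u: as u < κ√p + 2, 2mux < 2mκ√p·x + 4mx, which
-- turns the condition into F(x) > 0. Two values suffice because F(x)/x = px + (mκ)²/x - 2mu falls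
-- up to mκ/√p and rises afterwards, while t - 1 and t are consecutive. This is why B has to be an
-- integer, hence why 2bᵢ ∈ ℤ is needed and not merely 4bᵢ ∈ ℤ.
--
-- The congruences u ≡ κ (mod 2) and p ≡ 1 (mod 4) make the norm (u² - κ²p)/4 of α an integer.
--
-- The constant 16: a non-zero d with 4gd ∈ ℤ has pqd² = r(gd)² ≥ r/16, whereas the rational part
-- mu/2 of mα satisfies 8mu < 8m(κ√p + 2) ≤ 16m(κ√r + 1) ≤ r.
--
-- Real inequalities are proved by certificates: a sum of products of non-negative reals, matched
-- with the goal by an identity between the rational terms of the sequences. Since √a² = a holds
-- only in the limit, a - √a² and √a² - a occur as summands.

ι : ℤ → ℚ
ι n = n ℚ./ 1

toℚᵘ-ι : ∀ n → ℚ.toℚᵘ (ι n) ℚᵘ.≃ ℚᵘ.mkℚᵘ n 0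
toℚᵘ-ι n = ℚ.toℚᵘ-fromℚᵘ (ℚᵘ.mkℚᵘ n 0)

ι-injective : ∀ {m n} → ι m ≡ ι n → m ≡ n
ι-injective {m} {n} eq
  with ℚᵘ.*≡* m1≡n1 ← ℚᵘ.≃-trans (ℚᵘ.≃-sym (toℚᵘ-ι m))
                        (subst (λ x → ℚ.toℚᵘ x ℚᵘ.≃ ℚᵘ.mkℚᵘ n 0) (sym eq) (toℚᵘ-ι n))
  = trans (sym (ℤ.*-identityʳ m)) (trans m1≡n1 (ℤ.*-identityʳ n))

ι-mono-≤ : ∀ {m n} → m ℤ.≤ n → ι m ℚ.≤ ι n
ι-mono-≤ {m} {n} m≤n = ℚ.toℚᵘ-cancel-≤
  (ℚᵘ.≤-respˡ-≃ (ℚᵘ.≃-sym (toℚᵘ-ι m)) (ℚᵘ.≤-respʳ-≃ (ℚᵘ.≃-sym (toℚᵘ-ι n))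
    (ℚᵘ.*≤* (ℤ.*-monoʳ-≤-nonNeg (+ 1) m≤n))))

ι-+ : ∀ m n → ι (m ℤ.+ n) ≡ ι m ℚ.+ ι n
ι-+ m n = ℚ.toℚᵘ-injective (ℚᵘ.≃-trans (toℚᵘ-ι (m ℤ.+ n))
  (ℚᵘ.≃-trans (ℚᵘ.*≡* (cong (ℤ._* + 1) (sym (cong₂ ℤ._+_ (ℤ.*-identityʳ m) (ℤ.*-identityʳ n)))))
  (ℚᵘ.≃-sym (ℚᵘ.≃-trans (ℚ.toℚᵘ-homo-+ (ι m) (ι n)) (ℚᵘ.+-cong (toℚᵘ-ι m) (toℚᵘ-ι n))))))

ι-* : ∀ m n → ι (m ℤ.* n) ≡ ι m ℚ.* ι n
ι-* m n = ℚ.toℚᵘ-injective (ℚᵘ.≃-trans (toℚᵘ-ι (m ℤ.* n))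
  (ℚᵘ.≃-trans (ℚᵘ.*≡* refl)
  (ℚᵘ.≃-sym (ℚᵘ.≃-trans (ℚ.toℚᵘ-homo-* (ι m) (ι n)) (ℚᵘ.*-cong (toℚᵘ-ι m) (toℚᵘ-ι n))))))

ι-neg : ∀ n → ι (ℤ.- n) ≡ ℚ.- ι n
ι-neg n = ℚ.toℚᵘ-injective (ℚᵘ.≃-trans (toℚᵘ-ι (ℤ.- n))
  (ℚᵘ.≃-sym (ℚᵘ.≃-trans (ℚ.toℚᵘ-homo‿- (ι n)) (ℚᵘ.-‿cong (toℚᵘ-ι n)))))

-- Rational inequalities

≤⇒0≤ : ∀ {x y} → x ℚ.≤ y → 0ℚ ℚ.≤ y ℚ.- x
≤⇒0≤ {x} {y} x≤y = subst (ℚ._≤ y ℚ.- x) (ℚ.+-inverseʳ x) (ℚ.+-monoˡ-≤ (ℚ.- x) x≤y)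

0≤⇒≤ : ∀ {x y e} → e ≡ y ℚ.- x → 0ℚ ℚ.≤ e → x ℚ.≤ y
0≤⇒≤ {x} {y} refl 0≤y-x =
  subst₂ ℚ._≤_ (ℚ.+-identityˡ x) (solve 2 (λ x y → y :- x :+ x := y) refl x y)
    (ℚ.+-monoˡ-≤ x 0≤y-x)

0≤-+ : ∀ {x y} → 0ℚ ℚ.≤ x → 0ℚ ℚ.≤ y → 0ℚ ℚ.≤ x ℚ.+ y
0≤-+ = ℚ.+-mono-≤

0≤-* : ∀ {x y} → 0ℚ ℚ.≤ x → 0ℚ ℚ.≤ y → 0ℚ ℚ.≤ x ℚ.* y
0≤-* 0≤x 0≤y = *-mono-≤ {0ℚ} {_} {0ℚ} ℚ.≤-refl ℚ.≤-refl 0≤x 0≤y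

0≤ι : ∀ n → 0ℚ ℚ.≤ ι (+ n)
0≤ι n = ι-mono-≤ {+ 0} {+ n} (ℤ.+≤+ ℕ.z≤n)

0≤square : ∀ x → 0ℚ ℚ.≤ x ℚ.* x
0≤square x with ℚ.≤-total 0ℚ x
... | inj₁ 0≤x = 0≤-* 0≤x 0≤x
... | inj₂ x≤0 = subst (0ℚ ℚ.≤_) (solve 1 (λ x → (con 0ℚ :- x) :* (con 0ℚ :- x) := x :* x) refl x)
  (0≤-* (≤⇒0≤ x≤0) (≤⇒0≤ x≤0))

-- The common end of the contradictions below: the ring solver identifies a non-negative expression
-- with the negative of a positive one.
0≤∧0<⇒≢- : ∀ {x y} → 0ℚ ℚ.≤ x → 0ℚ ℚ.< y → ¬ (x ≡ ℚ.- y)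
0≤∧0<⇒≢- {y = y} 0≤-y 0<y refl = ℚ.<-irrefl refl
  (ℚ.<-≤-trans 0<y (0≤⇒≤ (solve 1 (λ y → :- y := con 0ℚ :- y) refl y) 0≤-y))

square-≤ : ∀ {x y} → 0ℚ ℚ.≤ y → x ℚ.* x ℚ.≤ y ℚ.* y → x ℚ.≤ y
square-≤ {x} {y} 0≤y xx≤yy = ℚ.≮⇒≥ λ y<x →
  let 0<x = ℚ.≤-<-trans 0≤y y<x in
  ℚ.<-irrefl refl (ℚ.<-≤-trans
    (ℚ.≤-<-trans (ℚ.*-monoˡ-≤-nonNeg y {{ℚ.nonNegative 0≤y}} (ℚ.<⇒≤ y<x))
      (ℚ.*-monoˡ-<-pos x {{ℚ.positive 0<x}} y<x))
    xx≤yy)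

-- Inequalities between real numbers

0ℝ : ℝ
0ℝ = fromℚ 0ℚ

pointwise : ∀ {x} → (∀ n → 0ℚ ℚ.≤ seq x n) → 0ℝ ≤ x
pointwise {x} 0≤x ε 0<ε = 0 , λ n _ → 0≤-+ (0≤x n) (ℚ.<⇒≤ 0<ε)

≤⇒0≤-ℝ : ∀ {x y} → x ≤ y → 0ℝ ≤ y - x
≤⇒0≤-ℝ {x} {y} x≤y ε 0<ε = let N , h = x≤y ε 0<ε in
  N , λ n N≤n → subst (0ℚ ℚ.≤_)
    (solve 3 (λ x y e → (y :+ e) :- x := (y :- x) :+ e) refl (seq x n) (seq y n) ε)
    (≤⇒0≤ (h n N≤n))

0≤⇒≤-ℝ : ∀ {x y} → 0ℝ ≤ y - x → x ≤ y
0≤⇒≤-ℝ {x} {y} 0≤ ε 0<ε = let N , h = 0≤ ε 0<ε in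
  N , λ n N≤n → 0≤⇒≤
    (solve 3 (λ x y e → (y :- x) :+ e := (y :+ e) :- x) refl (seq x n) (seq y n) ε)
    (h n N≤n)

-- Sequence-wise equality suffices, since _≤_ ignores the Cauchy moduli.
0≤-resp : ∀ {x y} → (∀ n → seq x n ≡ seq y n) → 0ℝ ≤ x → 0ℝ ≤ y
0≤-resp x≗y 0≤x ε 0<ε = let N , h = 0≤x ε 0<ε in
  N , λ n N≤n → subst (λ z → 0ℚ ℚ.≤ z ℚ.+ ε) (x≗y n) (h n N≤n)

0≤-+ℝ : ∀ {x y} → 0ℝ ≤ x → 0ℝ ≤ y → 0ℝ ≤ x + y
0≤-+ℝ {x} {y} 0≤x 0≤y ε 0<ε =
  let 0<½ε = *-pos (ℚ.positive⁻¹ ½) 0<ε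
      M , h = 0≤x (½ ℚ.* ε) 0<½ε
      N , k = 0≤y (½ ℚ.* ε) 0<½ε
  in M ℕ.+ N , λ n ≤n → subst (0ℚ ℚ.≤_)
    (solve 3 (λ x y e → (x :+ con ½ :* e) :+ (y :+ con ½ :* e) := x :+ y :+ e) refl
      (seq x n) (seq y n) ε)
    (0≤-+ (h n (ℕ.m+n≤o⇒m≤o M ≤n)) (k n (ℕ.m+n≤o⇒n≤o M ≤n)))

∣∣≤⇒≤ : ∀ {x B} → ℚ.∣ x ∣ ℚ.≤ B → x ℚ.≤ B
∣∣≤⇒≤ {x} ∣x∣≤B with ℚ.∣p∣≡p∨∣p∣≡-p x
... | inj₁ eq = subst (ℚ._≤ _) eq ∣x∣≤B
... | inj₂ eq with ℚ.≤-total 0ℚ x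
...   | inj₁ 0≤x = subst (ℚ._≤ _) (ℚ.0≤p⇒∣p∣≡p 0≤x) ∣x∣≤B
...   | inj₂ x≤0 = ℚ.≤-trans x≤0 (ℚ.≤-trans (ℚ.0≤∣p∣ x) ∣x∣≤B)

-- Factors that are non-negative in the limit may have slightly negative terms. If b ≥ 0 then ab ≥
-- -δb ≥ -δC; if b ≤ 0 then ab ≥ Bb ≥ -ηB. Only one of the two losses occurs, so each may use up all
-- of ε.
product-lower : ∀ a b {B C δ η ε} → 0ℚ ℚ.≤ B → 0ℚ ℚ.≤ δ → δ ℚ.* C ≡ ε → η ℚ.* B ≡ ε →
                a ℚ.≤ B → b ℚ.≤ C → 0ℚ ℚ.≤ a ℚ.+ δ → 0ℚ ℚ.≤ b ℚ.+ η → 0ℚ ℚ.≤ a ℚ.* b ℚ.+ ε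
product-lower a b {B} {C} {δ} {η} 0≤B 0≤δ δC≡ε ηB≡ε a≤B b≤C 0≤a+δ 0≤b+η with ℚ.≤-total 0ℚ b
... | inj₁ 0≤b = subst (0ℚ ℚ.≤_)
  (trans
    (solve 4 (λ a b C δ → (a :+ δ) :* b :+ δ :* (C :- b) := a :* b :+ δ :* C) refl a b C δ)
    (cong (a ℚ.* b ℚ.+_) δC≡ε))
  (0≤-+ (0≤-* 0≤a+δ 0≤b) (0≤-* 0≤δ (≤⇒0≤ b≤C)))
... | inj₂ b≤0 = subst (0ℚ ℚ.≤_)
  (trans
    (solve 4 (λ a b B η → (b :+ η) :* B :+ (B :- a) :* (con 0ℚ :- b) := a :* b :+ η :* B) refl
      a b B η)
    (cong (a ℚ.* b ℚ.+_) ηB≡ε))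
  (0≤-+ (0≤-* 0≤b+η 0≤B) (0≤-* (≤⇒0≤ a≤B) (≤⇒0≤ b≤0)))

*-inv-cancel : ∀ ε C → 0ℚ ℚ.< C → ε ℚ.* inv C ℚ.* C ≡ ε
*-inv-cancel ε C 0<C = trans (ℚ.*-assoc ε (inv C) C)
  (trans (cong (ε ℚ.*_) (trans (ℚ.*-comm (inv C) C) (inv-inverseʳ C 0<C))) (ℚ.*-identityʳ ε))

0≤-*ℝ : ∀ {x y} → 0ℝ ≤ x → 0ℝ ≤ y → 0ℝ ≤ x * y
0≤-*ℝ {x} {y} 0≤x 0≤y ε 0<ε =
  let B , K₁ , 0<B , x≤B = bounded x
      C , K₂ , 0<C , y≤C = bounded y
      0<δ = *-pos 0<ε (inv-pos C 0<C)
      M , h = 0≤x (ε ℚ.* inv C) 0<δ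
      N , k = 0≤y (ε ℚ.* inv B) (*-pos 0<ε (inv-pos B 0<B))
  in (K₁ ℕ.+ K₂) ℕ.+ (M ℕ.+ N) , λ n ≤n →
  let ≤₁ = ℕ.m+n≤o⇒m≤o (K₁ ℕ.+ K₂) ≤n
      ≤₂ = ℕ.m+n≤o⇒n≤o (K₁ ℕ.+ K₂) ≤n
  in product-lower (seq x n) (seq y n) (ℚ.<⇒≤ 0<B) (ℚ.<⇒≤ 0<δ)
       (*-inv-cancel ε C 0<C) (*-inv-cancel ε B 0<B)
       (∣∣≤⇒≤ (x≤B n (ℕ.m+n≤o⇒m≤o K₁ ≤₁))) (∣∣≤⇒≤ (y≤C n (ℕ.m+n≤o⇒n≤o K₁ ≤₁)))
       (h n (ℕ.m+n≤o⇒m≤o M ≤₂)) (k n (ℕ.m+n≤o⇒n≤o M ≤₂))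

0≤-square-cancel : ∀ {x y} → (∀ n → 0ℚ ℚ.≤ seq y n) → 0ℝ ≤ y * y - x * x → 0ℝ ≤ y - x
0≤-square-cancel {x} {y} 0≤y 0≤yy-xx ε 0<ε =
  -- The tolerance ε² is chosen because x² ≤ y² + ε² ≤ (y + ε)² when y ≥ 0.
  let N , h = 0≤yy-xx (ε ℚ.* ε) (*-pos 0<ε 0<ε) in
  N , λ n N≤n →
    let a = seq x n ; b = seq y n in
    subst (0ℚ ℚ.≤_) (solve 3 (λ a b e → (b :+ e) :- a := (b :- a) :+ e) refl a b ε)
    (≤⇒0≤ (square-≤ (0≤-+ (0≤y n) (ℚ.<⇒≤ 0<ε))
      (0≤⇒≤
        (solve 3 (λ a b e → ((b :* b :- a :* a) :+ e :* e) :+ con (+ 2 ℚ./ 1) :* (b :* e)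
                          := (b :+ e) :* (b :+ e) :- a :* a) refl a b ε)
        (0≤-+ (h n N≤n) (0≤-* (0≤ι 2) (0≤-* (0≤y n) (ℚ.<⇒≤ 0<ε)))))))

0≤-fromℚ : ∀ {a} → 0ℝ ≤ fromℚ a → 0ℚ ℚ.≤ a
0≤-fromℚ {a} 0≤a = ℚ.≮⇒≥ λ a<0 →
  let 0<-a = ℚ.neg-antimono-< a<0
      0<ε  = *-pos (ℚ.positive⁻¹ ½) 0<-a
      N , h = 0≤a (½ ℚ.* ℚ.- a) 0<ε
  in 0≤∧0<⇒≢- (h N ℕ.≤-refl) 0<ε
       (solve 1 (λ a → a :+ con ½ :* (:- a) := :- (con ½ :* (:- a))) refl a)

-- Square roots

0<ι : ∀ n .{{_ : NonZero n}} → 0ℚ ℚ.< ι (+ n)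
0<ι (suc n) = ℚ.<-≤-trans (ℚ.positive⁻¹ 1ℚ) (ι-mono-≤ {+ 1} {+ suc n} (ℤ.+≤+ (ℕ.s≤s ℕ.z≤n)))

ι-+ℕ : ∀ m n → ι (+ (m ℕ.+ n)) ≡ ι (+ m) ℚ.+ ι (+ n)
ι-+ℕ m n = ι-+ (+ m) (+ n)

ι-*ℕ : ∀ m n → ι (+ (m ℕ.* n)) ≡ ι (+ m) ℚ.* ι (+ n)
ι-*ℕ m n = trans (cong ι (ℤ.pos-* m n)) (ι-* (+ m) (+ n))

/-*-cancel : ∀ i n → (i ℚ./ suc n) ℚ.* ι (+ suc n) ≡ ι i
/-*-cancel i n = ℚ.toℚᵘ-injective (ℚᵘ.≃-trans (ℚ.toℚᵘ-homo-* (i ℚ./ suc n) (ι (+ suc n)))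
  (ℚᵘ.≃-trans (ℚᵘ.*-cong (ℚ.toℚᵘ-fromℚᵘ (ℚᵘ.mkℚᵘ i n)) (toℚᵘ-ι (+ suc n)))
  (ℚᵘ.≃-trans (ℚᵘ.*≡* (trans (ℤ.*-identityʳ (i ℤ.* + suc n))
    (cong (λ m → i ℤ.* + m) (sym (ℕ.*-identityʳ (suc n))))))
  (ℚᵘ.≃-sym (toℚᵘ-ι i)))))

quotient-square-≤ : ∀ {x k s a} → 0ℚ ℚ.< k → x ℚ.* k ≡ s → s ℚ.* s ℚ.≤ a ℚ.* (k ℚ.* k) →
                    x ℚ.* x ℚ.≤ a
quotient-square-≤ {x} {k} {_} {a} 0<k refl ss≤akk =
  ℚ.*-cancelʳ-≤-pos (k ℚ.* k) {{ℚ.positive (*-pos 0<k 0<k)}}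
    (ℚ.≤-trans (ℚ.≤-reflexive
      (solve 2 (λ x k → x :* x :* (k :* k) := (x :* k) :* (x :* k)) refl x k)) ss≤akk)

quotient-square-≥ : ∀ {x k s a} → 0ℚ ℚ.< k → x ℚ.* k ≡ s → a ℚ.* (k ℚ.* k) ℚ.≤ s ℚ.* s →
                    a ℚ.≤ x ℚ.* x
quotient-square-≥ {x} {k} {_} {a} 0<k refl akk≤ss =
  ℚ.*-cancelʳ-≤-pos (k ℚ.* k) {{ℚ.positive (*-pos 0<k 0<k)}}
    (ℚ.≤-trans akk≤ss (ℚ.≤-reflexive
      (solve 2 (λ x k → (x :* k) :* (x :* k) := x :* x :* (k :* k)) refl x k)))

ι-*ℕ³ : ∀ a k → ι (+ (a ℕ.* (k ℕ.* k))) ≡ ι (+ a) ℚ.* (ι (+ k) ℚ.* ι (+ k))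
ι-*ℕ³ a k = trans (ι-*ℕ a (k ℕ.* k)) (cong (ι (+ a) ℚ.*_) (ι-*ℕ k k))

sqrtSeq-lower : ∀ a n → sqrtSeq a n ℚ.* sqrtSeq a n ℚ.≤ ι (+ a)
sqrtSeq-lower a n = quotient-square-≤ {sqrtSeq a n} {ι (+ suc n)} {ι (+ s)} {ι (+ a)} (0<ι (suc n)) (/-*-cancel (+ s) n)
  (subst₂ ℚ._≤_ (ι-*ℕ s s) (ι-*ℕ³ a (suc n))
    (ι-mono-≤ {+ (s ℕ.* s)} {+ (a ℕ.* (suc n ℕ.* suc n))} (ℤ.+≤+ (isqrt-lower (a ℕ.* (suc n ℕ.* suc n))))))
  where
  s = isqrt (a ℕ.* (suc n ℕ.* suc n))

sqrtSeq-upper : ∀ a n → let y = sqrtSeq a n ℚ.+ + 1 ℚ./ suc n in ι (+ a) ℚ.≤ y ℚ.* y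
sqrtSeq-upper a n = quotient-square-≥
  {sqrtSeq a n ℚ.+ + 1 ℚ./ suc n} {ι (+ suc n)} {ι (+ suc s)} {ι (+ a)} (0<ι (suc n)) y*k
  (subst₂ ℚ._≤_ (ι-*ℕ³ a (suc n)) (ι-*ℕ (suc s) (suc s))
    (ι-mono-≤ {+ (a ℕ.* (suc n ℕ.* suc n))} {+ (suc s ℕ.* suc s)}
      (ℤ.+≤+ (ℕ.<⇒≤ (isqrt-upper (a ℕ.* (suc n ℕ.* suc n)))))))
  where
  s = isqrt (a ℕ.* (suc n ℕ.* suc n))
  y*k : (sqrtSeq a n ℚ.+ + 1 ℚ./ suc n) ℚ.* ι (+ suc n) ≡ ι (+ suc s)
  y*k = trans (ℚ.*-distribʳ-+ (ι (+ suc n)) (sqrtSeq a n) (+ 1 ℚ./ suc n))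
    (trans (cong₂ ℚ._+_ (/-*-cancel (+ s) n) (/-*-cancel (+ 1) n))
    (trans (ℚ.+-comm (ι (+ s)) (ι (+ 1))) (sym (ι-+ℕ 1 s))))

√*√≤ : ∀ a → 0ℝ ≤ fromℕ a - √ a * √ a
√*√≤ a = pointwise {fromℕ a - √ a * √ a} λ n → ≤⇒0≤ {sqrtSeq a n ℚ.* sqrtSeq a n} {ι (+ a)} (sqrtSeq-lower a n)

-- From a ≤ (x + d)² the defect a - x² is at most d² + 2xd, hence at most (1 + 2C)d by d ≤ 1 and x ≤
-- C.
square-near : ∀ a x d C {η ε} → 0ℚ ℚ.≤ 1ℚ ℚ.+ ι (+ 2) ℚ.* C → (1ℚ ℚ.+ ι (+ 2) ℚ.* C) ℚ.* η ≡ ε →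
              a ℚ.≤ (x ℚ.+ d) ℚ.* (x ℚ.+ d) → 0ℚ ℚ.≤ d → d ℚ.≤ 1ℚ → d ℚ.≤ η → x ℚ.≤ C →
              0ℚ ℚ.≤ x ℚ.* x ℚ.- a ℚ.+ ε
square-near a x d C {η} 0≤E refl a≤ 0≤d d≤1 d≤η x≤C = subst (0ℚ ℚ.≤_)
  (solve 5 (λ a x d C η →
      ((x :+ d) :* (x :+ d) :- a)
      :+ d :* ((con 1ℚ :- d) :+ con (+ 2 ℚ./ 1) :* (C :- x))
      :+ (con 1ℚ :+ con (+ 2 ℚ./ 1) :* C) :* (η :- d)
    := (x :* x :- a) :+ (con 1ℚ :+ con (+ 2 ℚ./ 1) :* C) :* η) refl a x d C η)
  (0≤-+ {(x ℚ.+ d) ℚ.* (x ℚ.+ d) ℚ.- a ℚ.+ d ℚ.* (1ℚ ℚ.- d ℚ.+ ι (+ 2) ℚ.* (C ℚ.- x))}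
        {(1ℚ ℚ.+ ι (+ 2) ℚ.* C) ℚ.* (η ℚ.- d)}
    (0≤-+ {(x ℚ.+ d) ℚ.* (x ℚ.+ d) ℚ.- a} {d ℚ.* (1ℚ ℚ.- d ℚ.+ ι (+ 2) ℚ.* (C ℚ.- x))}
      (≤⇒0≤ a≤)
      (0≤-* {d} {1ℚ ℚ.- d ℚ.+ ι (+ 2) ℚ.* (C ℚ.- x)} 0≤d
        (0≤-+ {1ℚ ℚ.- d} {ι (+ 2) ℚ.* (C ℚ.- x)} (≤⇒0≤ d≤1)
          (0≤-* {ι (+ 2)} {C ℚ.- x} (0≤ι 2) (≤⇒0≤ x≤C)))))
    (0≤-* {1ℚ ℚ.+ ι (+ 2) ℚ.* C} {η ℚ.- d} 0≤E (≤⇒0≤ d≤η)))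

-- The terms of `√ a` approximate the root from below, so, in contrast to `√*√≤`, this direction
-- holds only up to an error that tends to 0.
≤√*√ : ∀ a → 0ℝ ≤ √ a * √ a - fromℕ a
≤√*√ a ε 0<ε = M ℕ.+ N , λ n ≤n →
  let d = + 1 ℚ./ suc n in
  square-near (ι (+ a)) (sqrtSeq a n) d C (ℚ.<⇒≤ 0<E)
    (trans (ℚ.*-comm E η) (*-inv-cancel ε E 0<E))
    (sqrtSeq-upper a n)
    (/-mono 0 1 1 (suc n) ℕ.z≤n)
    (/-mono 1 (suc n) 1 1 (ℕ.s≤s ℕ.z≤n))
    (ℚ.≤-trans {d} {+ 1 ℚ./ suc N} {η}
      (/-mono 1 (suc n) 1 (suc N) (ℕ.*-monoʳ-≤ 1 (ℕ.s≤s (ℕ.m+n≤o⇒n≤o M ≤n))))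
      (1/ᵈ≤ η 0<η))
    (∣∣≤⇒≤ {sqrtSeq a n} {C} (x≤C n (ℕ.m+n≤o⇒m≤o M ≤n)))
  where
  C = proj₁ (bounded (√ a))
  M = proj₁ (proj₂ (bounded (√ a)))
  0<C = proj₁ (proj₂ (proj₂ (bounded (√ a))))
  x≤C = proj₂ (proj₂ (proj₂ (bounded (√ a))))
  E = 1ℚ ℚ.+ ι (+ 2) ℚ.* C
  0<E : 0ℚ ℚ.< E
  0<E = +-pos {1ℚ} {ι (+ 2) ℚ.* C} (ℚ.positive⁻¹ 1ℚ) (*-pos {ι (+ 2)} {C} (0<ι 2) 0<C)
  η = ε ℚ.* inv E
  0<η : 0ℚ ℚ.< η
  0<η = *-pos {ε} {inv E} 0<ε (inv-pos E 0<E)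
  N = ℚ.ℚ.denominator-1 η

1≤sqrtSeq : ∀ a .{{_ : NonZero a}} n → 1ℚ ℚ.≤ sqrtSeq a n
1≤sqrtSeq a n = Positive.bounds (√-positive {a}) n ℕ.z≤n

√-inverse : ∀ a .{{_ : NonZero a}} n → sqrtSeq a n ℚ.* inv (sqrtSeq a n) ≡ 1ℚ
√-inverse a n = inv-inverseʳ _ (ℚ.<-≤-trans (ℚ.positive⁻¹ 1ℚ) (1≤sqrtSeq a n))

0≤√⁻¹ : ∀ a .{{_ : NonZero a}} n → 0ℚ ℚ.≤ inv (sqrtSeq a n)
0≤√⁻¹ a n = ℚ.<⇒≤ (inv-pos _ (ℚ.<-≤-trans (ℚ.positive⁻¹ 1ℚ) (1≤sqrtSeq a n)))

-- A record, because `0ℝ ≤ x` unfolds to a statement about `seq x` from which `x` cannot be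
-- inferred; wrapped, the operators below need no explicit reals.
record NonNeg (x : ℝ) : Set where
  constructor nonNeg
  field
    holds : 0ℝ ≤ x

open NonNeg

infixl 6 _⊕_
infixl 7 _⊗_

_⊕_ : ∀ {x y} → NonNeg x → NonNeg y → NonNeg (x + y)
_⊕_ {x} {y} (nonNeg 0≤x) (nonNeg 0≤y) = nonNeg (0≤-+ℝ {x} {y} 0≤x 0≤y)

_⊗_ : ∀ {x y} → NonNeg x → NonNeg y → NonNeg (x * y)
_⊗_ {x} {y} (nonNeg 0≤x) (nonNeg 0≤y) = nonNeg (0≤-*ℝ {x} {y} 0≤x 0≤y)

ptw : ∀ {x} → (∀ n → 0ℚ ℚ.≤ seq x n) → NonNeg x
ptw {x} 0≤x = nonNeg (pointwise {x} 0≤x)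

infix 3 _by_

-- The closing step of a certificate: the left side is assembled with `_⊕_` and `_⊗_`, and the
-- identity is left to the ring solver over ℚ.
_by_ : ∀ {x y} → NonNeg x → (∀ n → seq x n ≡ seq y n) → NonNeg y
_by_ {x} {y} (nonNeg 0≤x) x≗y = nonNeg (0≤-resp {x} {y} x≗y 0≤x)

const : ∀ {a} → 0ℚ ℚ.≤ a → NonNeg (fromℚ a)
const 0≤a = ptw λ _ → 0≤a

natural : ∀ a → NonNeg (fromℕ a)
natural a = ptw λ _ → 0≤ι a

root : ∀ a → NonNeg (√ a)
root a = ptw (0≤sqrtSeq a)

-- The way back from ℝ to ℚ: b² - a²p = (b - a√p)(b + a√p), where b + a√p is written as (b - a√p) +
-- 2a√p to show its sign.
√-free : ∀ p {a b} → 0ℚ ℚ.≤ a → NonNeg (fromℚ b - fromℚ a * √ p) →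
         0ℚ ℚ.≤ b ℚ.* b ℚ.- a ℚ.* a ℚ.* ι (+ p)
√-free p {a} {b} 0≤a 0≤D = 0≤-fromℚ (holds certificate)
  where
  0≤y = const 0≤a ⊗ root p
  certificate : NonNeg (fromℚ (b ℚ.* b ℚ.- a ℚ.* a ℚ.* ι (+ p)))
  certificate = 0≤D ⊗ (0≤D ⊕ (0≤y ⊕ 0≤y)) ⊕ (const 0≤a ⊗ const 0≤a) ⊗ nonNeg {√ p * √ p - fromℕ p} (≤√*√ p)
    by λ n → solve 4 (λ a b p x →
      (b :- a :* x) :* ((b :- a :* x) :+ (a :* x :+ a :* x)) :+ a :* a :* (x :* x :- p)
        := b :* b :- a :* a :* p)
    refl a b (ι (+ p)) (sqrtSeq p n)

-- The interval I₄

ι⁻¹ : ∀ n .{{_ : NonZero n}} → ι (+ n) ℚ.* inv (ι (+ n)) ≡ 1ℚ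
ι⁻¹ n = inv-inverseʳ (ι (+ n)) (0<ι n)

0≤ι⁻¹ : ∀ n .{{_ : NonZero n}} → 0ℚ ℚ.≤ inv (ι (+ n))
0≤ι⁻¹ n = ℚ.<⇒≤ (inv-pos (ι (+ n)) (0<ι n))

√² : ∀ a → NonNeg (fromℕ a - √ a * √ a)
√² a = nonNeg (√*√≤ a)

√²≥ : ∀ a → NonNeg (√ a * √ a - fromℕ a)
√²≥ a = nonNeg (≤√*√ a)

two four : ℚ
two = + 2 ℚ./ 1
four = + 4 ℚ./ 1

-- With y = μi in the role of √m/√t, the first summand is t²(e² - 4y²). The other three replace x²
-- by p, and t·y² by μ² and then by m; the result is (tx - k)² - 4tm expanded.
tangency-identity : ∀ t k p m c x e μ i → c ℚ.* t ≡ k → e ℚ.* e ≡ (x ℚ.- c) ℚ.* (x ℚ.- c) →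
  t ℚ.* t ℚ.* ((e ℚ.- two ℚ.* (μ ℚ.* i)) ℚ.* (e ℚ.- two ℚ.* (μ ℚ.* i) ℚ.+ four ℚ.* (μ ℚ.* i)))
  ℚ.+ t ℚ.* t ℚ.* (p ℚ.- x ℚ.* x)
  ℚ.+ four ℚ.* t ℚ.* (μ ℚ.* μ ℚ.- m)
  ℚ.+ four ℚ.* t ℚ.* (t ℚ.* (μ ℚ.* i ℚ.* (μ ℚ.* i)) ℚ.- μ ℚ.* μ)
  ≡ t ℚ.* t ℚ.* p ℚ.+ k ℚ.* k ℚ.- four ℚ.* t ℚ.* m ℚ.- two ℚ.* k ℚ.* t ℚ.* x
tangency-identity t _ p m c x e μ i refl ee = trans
  (solve 7 (λ t p m x e μ i →
      t :* t :* ((e :- con two :* (μ :* i)) :* (e :- con two :* (μ :* i) :+ con four :* (μ :* i)))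
      :+ t :* t :* (p :- x :* x)
      :+ con four :* t :* (μ :* μ :- m)
      :+ con four :* t :* (t :* (μ :* i :* (μ :* i)) :- μ :* μ)
    := t :* t :* (e :* e) :+ (t :* t :* (p :- x :* x) :- con four :* t :* m)) refl t p m x e μ i)
  (trans (cong (λ y → t ℚ.* t ℚ.* y ℚ.+ (t ℚ.* t ℚ.* (p ℚ.- x ℚ.* x) ℚ.- four ℚ.* t ℚ.* m)) ee)
  (solve 5 (λ t p m c x →
      t :* t :* ((x :- c) :* (x :- c)) :+ (t :* t :* (p :- x :* x) :- con four :* t :* m)
    := t :* t :* p :+ (c :* t) :* (c :* t) :- con four :* t :* m :- con two :* (c :* t) :* t :* x)
    refl t p m c x))

t∙y²≥μ² : ∀ t s μ i → s ℚ.* i ≡ 1ℚ → s ℚ.* s ℚ.≤ t →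
          0ℚ ℚ.≤ t ℚ.* (μ ℚ.* i ℚ.* (μ ℚ.* i)) ℚ.- μ ℚ.* μ
t∙y²≥μ² t s μ i si≡1 ss≤t = subst (0ℚ ℚ.≤_)
  (trans
    (solve 4 (λ t s μ i → (t :- s :* s) :* (μ :* i :* (μ :* i)) :=
       t :* (μ :* i :* (μ :* i)) :- (s :* i) :* (s :* i) :* (μ :* μ)) refl t s μ i)
    (trans (cong (λ o → t ℚ.* (μ ℚ.* i ℚ.* (μ ℚ.* i)) ℚ.- o ℚ.* o ℚ.* (μ ℚ.* μ)) si≡1)
    (solve 2 (λ z μ → z :- con 1ℚ :* con 1ℚ :* (μ :* μ) := z :- μ :* μ) refl (t ℚ.* (μ ℚ.* i ℚ.* (μ ℚ.* i))) μ)))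
  (0≤-* {t ℚ.- s ℚ.* s} {μ ℚ.* i ℚ.* (μ ℚ.* i)} (≤⇒0≤ ss≤t) (0≤square (μ ℚ.* i)))

-- |√p - k/t| ≥ 2√m/√t, multiplied by t and squared. `E` may be √p - c or c - √p, which serves the
-- left and the right endpoint alike.
tangency : ∀ p m k t .{{_ : NonZero t}} {E c} →
  NonNeg (E - fromℕ 2 * (√ m / √ t)) →
  (∀ n → seq E n ℚ.* seq E n ≡ (sqrtSeq p n ℚ.- c) ℚ.* (sqrtSeq p n ℚ.- c)) →
  c ℚ.* ι (+ t) ≡ ι (+ k) →
  let T = ι (+ t) ; k′ = ι (+ k) in
  NonNeg (fromℚ (T ℚ.* T ℚ.* ι (+ p) ℚ.+ k′ ℚ.* k′ ℚ.- four ℚ.* T ℚ.* ι (+ m))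
          - fromℚ (two ℚ.* k′ ℚ.* T) * √ p)
tangency p m k t {E} {c} D E² ct≡k =
  (natural t ⊗ natural t) ⊗ (D ⊗ (D ⊕ natural 4 ⊗ Y))
  ⊕ (natural t ⊗ natural t) ⊗ √² p
  ⊕ (natural 4 ⊗ natural t) ⊗ √²≥ m
  ⊕ (natural 4 ⊗ natural t) ⊗ W
  by λ n → tangency-identity (ι (+ t)) (ι (+ k)) (ι (+ p)) (ι (+ m)) c
    (sqrtSeq p n) (seq E n) (sqrtSeq m n) (inv (sqrtSeq t n)) ct≡k (E² n)
  where
  Y : NonNeg (√ m / √ t)
  Y = root m ⊗ ptw {(√ t) ⁻¹} (0≤√⁻¹ t)
  W : NonNeg (fromℕ t * ((√ m / √ t) * (√ m / √ t)) - √ m * √ m)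
  W = ptw λ n → t∙y²≥μ² (ι (+ t)) (sqrtSeq t n) (sqrtSeq m n) (inv (sqrtSeq t n))
        (√-inverse t n) (sqrtSeq-lower t n)

√≥⇒square≥ : ∀ p {c} → 0ℚ ℚ.≤ c → NonNeg (√ p - fromℚ c) → c ℚ.* c ℚ.≤ ι (+ p)
√≥⇒square≥ p {c} 0≤c D = 0≤⇒≤ {c ℚ.* c} {ι (+ p)} refl (0≤-fromℚ (holds certificate))
  where
  certificate : NonNeg (fromℚ (ι (+ p) ℚ.- c ℚ.* c))
  certificate = D ⊗ (D ⊕ (const 0≤c ⊕ const 0≤c)) ⊕ √² p
    by λ n → solve 3 (λ p c x → (x :- c) :* ((x :- c) :+ (c :+ c)) :+ (p :- x :* x) := p :- c :* c)
      refl (ι (+ p)) c (sqrtSeq p n)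

√≤⇒square≤ : ∀ p {c} → NonNeg (fromℚ c - √ p) → ι (+ p) ℚ.≤ c ℚ.* c
√≤⇒square≤ p {c} D = 0≤⇒≤ {ι (+ p)} {c ℚ.* c} refl (0≤-fromℚ (holds certificate))
  where
  certificate : NonNeg (fromℚ (c ℚ.* c ℚ.- ι (+ p)))
  certificate = D ⊗ (D ⊕ (root p ⊕ root p)) ⊕ √²≥ p
    by λ n → solve 3 (λ p c x → (c :- x) :* ((c :- x) :+ (x :+ x)) :+ (x :* x :- p) := c :* c :- p)
      refl (ι (+ p)) c (sqrtSeq p n)

<⇒0< : ∀ {x y} → x ℚ.< y → 0ℚ ℚ.< y ℚ.- x
<⇒0< {x} {y} x<y = subst (ℚ._< y ℚ.- x) (ℚ.+-inverseʳ x) (ℚ.+-monoˡ-< (ℚ.- x) x<y)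

-- As k = mκ, the hypothesis reads T²p + k² ≥ 2mT(κ√p + 2), and w < κ√p. Were the conclusion false,
-- 2kT√p ≤ 2mTw would follow, and squaring contradicts w² < κ²p.
secant : ∀ p m k t κ w .{{_ : NonZero m}} .{{_ : NonZero t}} → k ≡ m ℕ.* κ →
  let P = ι (+ p) ; M = ι (+ m) ; k′ = ι (+ k) ; T = ι (+ t) ; κ′ = ι (+ κ) ; w′ = ι (+ w) in
  w′ ℚ.* w′ ℚ.< κ′ ℚ.* κ′ ℚ.* P →
  NonNeg (fromℚ (T ℚ.* T ℚ.* P ℚ.+ k′ ℚ.* k′ ℚ.- four ℚ.* T ℚ.* M)
          - fromℚ (two ℚ.* k′ ℚ.* T) * √ p) →
  two ℚ.* M ℚ.* (w′ ℚ.+ two) ℚ.* T ℚ.< T ℚ.* T ℚ.* P ℚ.+ k′ ℚ.* k′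
secant p m k t κ w k≡mκ w²<κ²P D = ℚ.≰⇒> λ ≤c →
  let D′ : NonNeg (fromℚ (two ℚ.* M ℚ.* T ℚ.* w′) - fromℚ (two ℚ.* k′ ℚ.* T) * √ p)
      D′ = D ⊕ const (≤⇒0≤ ≤c) by λ n →
        solve 5 (λ s M T w y →
            (s :- con four :* T :* M :- y) :+ (con two :* M :* (w :+ con two) :* T :- s)
          := con two :* M :* T :* w :- y) refl
          (T ℚ.* T ℚ.* P ℚ.+ k′ ℚ.* k′) M T w′ (two ℚ.* k′ ℚ.* T ℚ.* sqrtSeq p n)
      0≤2kT = 0≤-* {two ℚ.* k′} {T} (0≤-* {two} {k′} (0≤ι 2) (0≤ι k)) (0≤ι t)
      0≤e = √-free p {two ℚ.* k′ ℚ.* T} {two ℚ.* M ℚ.* T ℚ.* w′} 0≤2kT D′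
  in 0≤∧0<⇒≢- 0≤e
       (*-pos {s} {κ′ ℚ.* κ′ ℚ.* P ℚ.- w′ ℚ.* w′} 0<s (<⇒0< w²<κ²P))
       (trans (cong (λ k → two ℚ.* M ℚ.* T ℚ.* w′ ℚ.* (two ℚ.* M ℚ.* T ℚ.* w′)
                 ℚ.- two ℚ.* k ℚ.* T ℚ.* (two ℚ.* k ℚ.* T) ℚ.* P)
                 (trans (cong (λ k → ι (+ k)) k≡mκ) (ι-*ℕ m κ)))
         (solve 5 (λ M T w κ P →
           con two :* M :* T :* w :* (con two :* M :* T :* w)
             :- con two :* (M :* κ) :* T :* (con two :* (M :* κ) :* T) :* P
           := :- ((con two :* M :* T) :* (con two :* M :* T) :* (κ :* κ :* P :- w :* w)))
           refl M T w′ κ′ P))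
  where
  P = ι (+ p)
  M = ι (+ m)
  k′ = ι (+ k)
  T = ι (+ t)
  κ′ = ι (+ κ)
  w′ = ι (+ w)
  s = (two ℚ.* M ℚ.* T) ℚ.* (two ℚ.* M ℚ.* T)
  0<2MT : 0ℚ ℚ.< two ℚ.* M ℚ.* T
  0<2MT = *-pos {two ℚ.* M} {T} (*-pos {two} {M} (0<ι 2) (0<ι m)) (0<ι t)
  0<s : 0ℚ ℚ.< s
  0<s = *-pos {two ℚ.* M ℚ.* T} {two ℚ.* M ℚ.* T} 0<2MT 0<2MT

-- With F(x) = P x² + K − c x, the hypotheses say F(T) > 0 and F(B) ≤ 0.
-- Both cases use B F(T) − T F(B) = (T − B) (P T B − K).
no-root-above : ∀ {P K c T B} → 0ℚ ℚ.< T → 0ℚ ℚ.≤ P → T ℚ.≤ B → K ℚ.≤ T ℚ.* T ℚ.* P →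
  c ℚ.* T ℚ.< T ℚ.* T ℚ.* P ℚ.+ K → ¬ (B ℚ.* B ℚ.* P ℚ.+ K ℚ.≤ c ℚ.* B)
no-root-above {P} {K} {c} {T} {B} 0<T 0≤P T≤B K≤ FT FB =
  0≤∧0<⇒≢-
    (0≤-+ {T ℚ.* (c ℚ.* B ℚ.- (B ℚ.* B ℚ.* P ℚ.+ K))}
          {(B ℚ.- T) ℚ.* (P ℚ.* T ℚ.* (B ℚ.- T) ℚ.+ (T ℚ.* T ℚ.* P ℚ.- K))}
      (0≤-* {T} {c ℚ.* B ℚ.- (B ℚ.* B ℚ.* P ℚ.+ K)} (ℚ.<⇒≤ 0<T) (≤⇒0≤ FB))
      (0≤-* {B ℚ.- T} {P ℚ.* T ℚ.* (B ℚ.- T) ℚ.+ (T ℚ.* T ℚ.* P ℚ.- K)} (≤⇒0≤ T≤B)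
        (0≤-+ {P ℚ.* T ℚ.* (B ℚ.- T)} {T ℚ.* T ℚ.* P ℚ.- K}
          (0≤-* {P ℚ.* T} {B ℚ.- T} (0≤-* {P} {T} 0≤P (ℚ.<⇒≤ 0<T)) (≤⇒0≤ T≤B))
          (≤⇒0≤ K≤))))
    (*-pos {B} {T ℚ.* T ℚ.* P ℚ.+ K ℚ.- c ℚ.* T} (ℚ.<-≤-trans 0<T T≤B) (<⇒0< FT))
    (solve 5 (λ P K c T B →
        T :* (c :* B :- (B :* B :* P :+ K)) :+ (B :- T) :* (P :* T :* (B :- T) :+ (T :* T :* P :- K))
        := :- (B :* (T :* T :* P :+ K :- c :* T))) refl P K c T B)

no-root-below : ∀ {P K c T B} → 0ℚ ℚ.< B → 0ℚ ℚ.≤ P → B ℚ.≤ T → T ℚ.* T ℚ.* P ℚ.≤ K →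
  c ℚ.* T ℚ.< T ℚ.* T ℚ.* P ℚ.+ K → ¬ (B ℚ.* B ℚ.* P ℚ.+ K ℚ.≤ c ℚ.* B)
no-root-below {P} {K} {c} {T} {B} 0<B 0≤P B≤T ≤K FT FB =
  0≤∧0<⇒≢-
    (0≤-+ {T ℚ.* (c ℚ.* B ℚ.- (B ℚ.* B ℚ.* P ℚ.+ K))}
          {(T ℚ.- B) ℚ.* (P ℚ.* T ℚ.* (T ℚ.- B) ℚ.+ (K ℚ.- T ℚ.* T ℚ.* P))}
      (0≤-* {T} {c ℚ.* B ℚ.- (B ℚ.* B ℚ.* P ℚ.+ K)} 0≤T (≤⇒0≤ FB))
      (0≤-* {T ℚ.- B} {P ℚ.* T ℚ.* (T ℚ.- B) ℚ.+ (K ℚ.- T ℚ.* T ℚ.* P)} (≤⇒0≤ B≤T)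
        (0≤-+ {P ℚ.* T ℚ.* (T ℚ.- B)} {K ℚ.- T ℚ.* T ℚ.* P}
          (0≤-* {P ℚ.* T} {T ℚ.- B} (0≤-* {P} {T} 0≤P 0≤T) (≤⇒0≤ B≤T))
          (≤⇒0≤ ≤K))))
    (*-pos {B} {T ℚ.* T ℚ.* P ℚ.+ K ℚ.- c ℚ.* T} 0<B (<⇒0< FT))
    (solve 5 (λ P K c T B →
        T :* (c :* B :- (B :* B :* P :+ K)) :+ (T :- B) :* (P :* T :* (T :- B) :+ (K :- T :* T :* P))
        := :- (B :* (T :* T :* P :+ K :- c :* T))) refl P K c T B)
  where
  0≤T = ℚ.≤-trans (ℚ.<⇒≤ 0<B) B≤T

module _ (p m κ w : ℕ) .{{_ : NonZero m}} where

  private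
    P = ι (+ p)
    M = ι (+ m)
    k = ι (+ (m ℕ.* κ))
    κ′ = ι (+ κ)
    w′ = ι (+ w)

    ratio : ∀ t .{{_ : NonZero t}} → ℚ
    ratio t = k ℚ.* inv (ι (+ t))

    ratio-* : ∀ t .{{_ : NonZero t}} → ratio t ℚ.* ι (+ t) ≡ k
    ratio-* t = *-inv-cancel k (ι (+ t)) (0<ι t)

    c₀ : ℚ
    c₀ = two ℚ.* M ℚ.* (w′ ℚ.+ two)

  -- The negation of F(B) ≤ 0; `c₀` is 2mu with u = w + 2.
  Excluded : ℕ → Set
  Excluded B = ¬ (ι (+ B) ℚ.* ι (+ B) ℚ.* P ℚ.+ k ℚ.* k ℚ.≤ c₀ ℚ.* ι (+ B))

  -- The left endpoint is used twice: in full for F(t) > 0, and weakened to √p ≥ mκ/t, which places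
  -- t to the right of mκ/√p, where F(x)/x increases.
  excluded-above : ∀ t .{{_ : NonZero t}} → w′ ℚ.* w′ ℚ.< κ′ ℚ.* κ′ ℚ.* P →
    fromℕ (m ℕ.* κ) / fromℕ t + fromℕ 2 * (√ m / √ t) ≤ √ p →
    ∀ B → t ℕ.≤ B → Excluded B
  excluded-above t w²<κ²P h B t≤B =
    no-root-above {P} {k ℚ.* k} {c₀} {ι (+ t)} {ι (+ B)} (0<ι t) (0≤ι p)
      (ι-mono-≤ {+ t} {+ B} (ℤ.+≤+ t≤B)) k²≤t²P
      (secant p m (m ℕ.* κ) t κ w refl w²<κ²P
        (tangency p m (m ℕ.* κ) t {√ p - fromℚ (ratio t)} {ratio t} D (λ n → refl) (ratio-* t)))
    where
    Y = √ m / √ t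
    0≤Y : NonNeg Y
    0≤Y = root m ⊗ ptw {(√ t) ⁻¹} (0≤√⁻¹ t)
    D : NonNeg (√ p - fromℚ (ratio t) - fromℕ 2 * Y)
    D = nonNeg {√ p - (fromℕ (m ℕ.* κ) / fromℕ t + fromℕ 2 * Y)}
          (≤⇒0≤-ℝ {fromℕ (m ℕ.* κ) / fromℕ t + fromℕ 2 * Y} {√ p} h)
      by λ n → solve 3 (λ x c y → x :- (c :+ y) := x :- c :- y) refl
           (sqrtSeq p n) (ratio t) (seq (fromℕ 2 * Y) n)
    E : NonNeg (√ p - fromℚ (ratio t))
    E = D ⊕ natural 2 ⊗ 0≤Y
      by λ n → solve 2 (λ x y → x :- y :+ y := x) refl
           (sqrtSeq p n ℚ.- ratio t) (seq (fromℕ 2 * Y) n)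
    0≤ratio : 0ℚ ℚ.≤ ratio t
    0≤ratio = 0≤-* {k} {inv (ι (+ t))} (0≤ι (m ℕ.* κ)) (0≤ι⁻¹ t)
    k²≤t²P : k ℚ.* k ℚ.≤ ι (+ t) ℚ.* ι (+ t) ℚ.* P
    k²≤t²P = subst (ℚ._≤ ι (+ t) ℚ.* ι (+ t) ℚ.* P)
      (trans (solve 2 (λ t c → t :* t :* (c :* c) := (c :* t) :* (c :* t)) refl (ι (+ t)) (ratio t))
        (cong₂ ℚ._*_ (ratio-* t) (ratio-* t)))
      (ℚ.*-monoˡ-≤-nonNeg (ι (+ t) ℚ.* ι (+ t)) {{ℚ.nonNegative (0≤square (ι (+ t)))}}
        {ratio t ℚ.* ratio t} {P} (√≥⇒square≥ p 0≤ratio E))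

  excluded-below : ∀ t .{{_ : NonZero t}} → w′ ℚ.* w′ ℚ.< κ′ ℚ.* κ′ ℚ.* P →
    √ p ≤ fromℕ (m ℕ.* κ) / fromℕ t - fromℕ 2 * (√ m / √ t) →
    ∀ B .{{_ : NonZero B}} → B ℕ.≤ t → Excluded B
  excluded-below t w²<κ²P h B B≤t =
    no-root-below {P} {k ℚ.* k} {c₀} {ι (+ t)} {ι (+ B)} (0<ι B) (0≤ι p)
      (ι-mono-≤ {+ B} {+ t} (ℤ.+≤+ B≤t)) t²P≤k²
      (secant p m (m ℕ.* κ) t κ w refl w²<κ²P
        (tangency p m (m ℕ.* κ) t {fromℚ (ratio t) - √ p} {ratio t} D
          (λ n → solve 2 (λ x c → (c :- x) :* (c :- x) := (x :- c) :* (x :- c)) refl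
            (sqrtSeq p n) (ratio t))
          (ratio-* t)))
    where
    Y = √ m / √ t
    0≤Y : NonNeg Y
    0≤Y = root m ⊗ ptw {(√ t) ⁻¹} (0≤√⁻¹ t)
    D : NonNeg (fromℚ (ratio t) - √ p - fromℕ 2 * Y)
    D = nonNeg {fromℕ (m ℕ.* κ) / fromℕ t - fromℕ 2 * Y - √ p}
          (≤⇒0≤-ℝ {√ p} {fromℕ (m ℕ.* κ) / fromℕ t - fromℕ 2 * Y} h)
      by λ n → solve 3 (λ x c y → c :- y :- x := c :- x :- y) refl
           (sqrtSeq p n) (ratio t) (seq (fromℕ 2 * Y) n)
    E : NonNeg (fromℚ (ratio t) - √ p)
    E = D ⊕ natural 2 ⊗ 0≤Y
      by λ n → solve 2 (λ x y → x :- y :+ y := x) refl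
           (ratio t ℚ.- sqrtSeq p n) (seq (fromℕ 2 * Y) n)
    t²P≤k² : ι (+ t) ℚ.* ι (+ t) ℚ.* P ℚ.≤ k ℚ.* k
    t²P≤k² = subst (ι (+ t) ℚ.* ι (+ t) ℚ.* P ℚ.≤_)
      (trans (solve 2 (λ t c → t :* t :* (c :* c) := (c :* t) :* (c :* t)) refl (ι (+ t)) (ratio t))
        (cong₂ ℚ._*_ (ratio-* t) (ratio-* t)))
      (ℚ.*-monoˡ-≤-nonNeg (ι (+ t) ℚ.* ι (+ t)) {{ℚ.nonNegative (0≤square (ι (+ t)))}}
        {P} {ratio t ℚ.* ratio t} (√≤⇒square≤ p E))

  -- No integer lies strictly between t - 1 and t, so each B ≥ 1 is caught from one side; for t = 1
  -- all of them lie above.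
  excluded : ∀ t .{{_ : NonZero t}} → w′ ℚ.* w′ ℚ.< κ′ ℚ.* κ′ ℚ.* P →
    √ p ∈ I₄ m t κ → ∀ B .{{_ : NonZero B}} → Excluded B
  excluded 1 w²<κ²P h (suc B) = excluded-above 1 w²<κ²P h (suc B) (ℕ.s≤s ℕ.z≤n)
  excluded (suc t@(suc _)) w²<κ²P (h₁ , h₂) B =
    [ excluded-below t w²<κ²P h₂ B , excluded-above (suc t) w²<κ²P h₁ B ]′ (ℕ.≤-<-connex B t)

-- The bound on m

*-inv-cancel′ : ∀ x y d → 0ℚ ℚ.< d → (x ℚ.* inv d ℚ.- y) ℚ.* d ≡ x ℚ.- y ℚ.* d
*-inv-cancel′ x y d 0<d = trans
  (solve 4 (λ x y d i → (x :* i :- y) :* d := x :* i :* d :- y :* d) refl x y d (inv d))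
  (cong (ℚ._- y ℚ.* d) (*-inv-cancel x d 0<d))

eight sixteen : ℚ
eight = + 8 ℚ./ 1
sixteen = + 16 ℚ./ 1

-- If r ≤ 8m(w + 2), then 16m(κ√r + 1) ≤ r leaves 16mκ√r ≤ 8mw, that is 4κ²r ≤ w², against w² < κ²p
-- ≤ κ²r.
trace-bound : ∀ m κ p r w .{{_ : NonZero m}} → p ℕ.≤ r →
  let P = ι (+ p) ; κ′ = ι (+ κ) ; w′ = ι (+ w) in
  w′ ℚ.* w′ ℚ.< κ′ ℚ.* κ′ ℚ.* P →
  fromℕ m ≤ fromℕ r / (fromℕ 16 * (fromℕ κ * √ r + fromℕ 1)) →
  eight ℚ.* ι (+ m) ℚ.* (w′ ℚ.+ two) ℚ.< ι (+ r)
trace-bound m κ p r w p≤r w²<κ²P h = ℚ.≰⇒> λ R≤ →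
  let D′ : NonNeg (fromℚ (eight ℚ.* M ℚ.* w′) - fromℚ (sixteen ℚ.* M ℚ.* κ′) * √ r)
      D′ = D ⊕ const (≤⇒0≤ R≤) by λ n →
        solve 5 (λ R M w κ x →
            (R :- M :* (con sixteen :* (κ :* x :+ con 1ℚ))) :+ (con eight :* M :* (w :+ con two) :- R)
          := con eight :* M :* w :- con sixteen :* M :* κ :* x) refl R M w′ κ′ (sqrtSeq r n)
  in 0≤∧0<⇒≢-
       (√-free r {sixteen ℚ.* M ℚ.* κ′} {eight ℚ.* M ℚ.* w′} 0≤16Mκ D′)
       (*-pos {(eight ℚ.* M) ℚ.* (eight ℚ.* M)} {κ′ ℚ.* κ′ ℚ.* P ℚ.- w′ ℚ.* w′ ℚ.+ rest}
         (*-pos {eight ℚ.* M} {eight ℚ.* M} 0<8M 0<8M)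
         (subst (ℚ._< κ′ ℚ.* κ′ ℚ.* P ℚ.- w′ ℚ.* w′ ℚ.+ rest) (ℚ.+-identityʳ 0ℚ)
           (ℚ.+-mono-<-≤ {0ℚ} {κ′ ℚ.* κ′ ℚ.* P ℚ.- w′ ℚ.* w′} {0ℚ} {rest} (<⇒0< w²<κ²P) 0≤rest)))
       (solve 5 (λ M w κ P R →
            con eight :* M :* w :* (con eight :* M :* w)
              :- con sixteen :* M :* κ :* (con sixteen :* M :* κ) :* R
         := :- ((con eight :* M) :* (con eight :* M) :*
                (κ :* κ :* P :- w :* w :+ κ :* κ :* ((R :- P) :+ con (+ 3 ℚ./ 1) :* R))))
         refl M w′ κ′ P R)
  where
  P = ι (+ p)
  R = ι (+ r)
  M = ι (+ m)
  κ′ = ι (+ κ)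
  w′ = ι (+ w)
  d = fromℕ 16 * (fromℕ κ * √ r + fromℕ 1)
  0<8M : 0ℚ ℚ.< eight ℚ.* M
  0<8M = *-pos {eight} {M} (0<ι 8) (0<ι m)
  0≤16Mκ : 0ℚ ℚ.≤ sixteen ℚ.* M ℚ.* κ′
  0≤16Mκ = 0≤-* {sixteen ℚ.* M} {κ′} (0≤-* {sixteen} {M} (0≤ι 16) (0≤ι m)) (0≤ι κ)
  -- 4κ²R - w² split as (κ²P - w²) + `rest`, so that the positive part is isolated.
  rest = κ′ ℚ.* κ′ ℚ.* ((R ℚ.- P) ℚ.+ ι (+ 3) ℚ.* R)
  0≤rest : 0ℚ ℚ.≤ rest
  0≤rest = 0≤-* {κ′ ℚ.* κ′} {(R ℚ.- P) ℚ.+ ι (+ 3) ℚ.* R} (0≤square κ′)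
    (0≤-+ {R ℚ.- P} {ι (+ 3) ℚ.* R} (≤⇒0≤ (ι-mono-≤ {+ p} {+ r} (ℤ.+≤+ p≤r)))
      (0≤-* {ι (+ 3)} {R} (0≤ι 3) (0≤ι r)))
  0<d : ∀ n → 0ℚ ℚ.< seq d n
  0<d n = *-pos {sixteen} {κ′ ℚ.* sqrtSeq r n ℚ.+ 1ℚ} (0<ι 16)
    (ℚ.+-mono-≤-< {0ℚ} {κ′ ℚ.* sqrtSeq r n} {0ℚ} {1ℚ}
      (0≤-* {κ′} {sqrtSeq r n} (0≤ι κ) (0≤sqrtSeq r n)) (ℚ.positive⁻¹ 1ℚ))
  D : NonNeg (fromℕ r - fromℕ m * d)
  D = nonNeg {fromℕ r / d - fromℕ m} (≤⇒0≤-ℝ {fromℕ m} {fromℕ r / d} h) ⊗ ptw {d} (λ n → ℚ.<⇒≤ (0<d n))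
    by λ n → *-inv-cancel′ R M (seq d n) (0<d n)

-- Non-emptiness of the interval

√-*-≤ : ∀ a b → NonNeg (√ (a ℕ.* b) - √ b * √ a)
√-*-≤ a b = nonNeg (0≤-square-cancel {√ b * √ a} {√ (a ℕ.* b)} (0≤sqrtSeq (a ℕ.* b)) (holds certificate))
  where
  z = √ (a ℕ.* b)
  certificate : NonNeg (z * z - (√ b * √ a) * (√ b * √ a))
  certificate = √²≥ (a ℕ.* b) ⊕ natural a ⊗ √² b ⊕ (root b ⊗ root b) ⊗ √² a
    by λ n → trans (cong (λ y → (sqrtSeq (a ℕ.* b) n ℚ.* sqrtSeq (a ℕ.* b) n ℚ.- y)
          ℚ.+ ι (+ a) ℚ.* (ι (+ b) ℚ.- sqrtSeq b n ℚ.* sqrtSeq b n)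
          ℚ.+ sqrtSeq b n ℚ.* sqrtSeq b n ℚ.* (ι (+ a) ℚ.- sqrtSeq a n ℚ.* sqrtSeq a n)) (ι-*ℕ a b))
      (solve 5 (λ z a b x y →
          (z :* z :- a :* b) :+ a :* (b :- y :* y) :+ y :* y :* (a :- x :* x)
        := z :* z :- (y :* x) :* (y :* x)) refl
        (sqrtSeq (a ℕ.* b) n) (ι (+ a)) (ι (+ b)) (sqrtSeq a n) (sqrtSeq b n))

-- With t = n + 1, upper - lower = (√m/(tn))·(κ√m - 2√(tn)(√t + √n)). The bracket is non-negative
-- exactly when mκ² ≥ 4tn(t + n + 2√(tn)), and t + n = 2t - 1. The 4 in `bound` is thus the square
-- of the 2 in the endpoints and cannot be dropped: for t = 2, κ = 1, m = 12 the interval is empty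
-- although 12 > 2(3 + 2√2).
module NonEmpty (m n κ : ℕ) .{{_ : NonZero m}} .{{_ : NonZero n}} .{{_ : NonZero κ}} where

  private
    t = suc n
    T = ι (+ t)
    N = ι (+ n)
    M = ι (+ m)
    k = ι (+ κ)
    μ = √ m
    s = √ t
    v = √ n
    z = √ (t ℕ.* n)
    j = 2 ℕ.* t ℕ.∸ 1

    lower upper bound : ℝ
    lower = fromℕ (m ℕ.* κ) / fromℕ t + fromℕ 2 * (√ m / √ t)
    upper = fromℕ (m ℕ.* κ) / fromℕ n - fromℕ 2 * (√ m / √ n)
    bound = fromℕ 4 * (fromℕ (t ℕ.* n) * (fromℕ j + fromℕ 2 * √ (t ℕ.* n)) / (fromℕ κ * fromℕ κ))

    T≡1+N : T ≡ 1ℚ ℚ.+ N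
    T≡1+N = ι-+ℕ 1 n

    j≡T+N : ι (+ j) ≡ T ℚ.+ N
    j≡T+N = trans (cong (λ i → ι (+ i)) 
        (trans (ℕ.+-comm n (suc (n ℕ.+ 0))) (cong (λ i → suc i ℕ.+ n) (ℕ.+-identityʳ n))))
      (ι-+ℕ t n)

    kk⁻¹ : (k ℚ.* k) ℚ.* inv (k ℚ.* k) ≡ 1ℚ
    kk⁻¹ = inv-inverseʳ (k ℚ.* k) (*-pos {k} {k} (0<ι κ) (0<ι κ))

    H-identity : ∀ M T N a j z k i → a ≡ T ℚ.* N → j ≡ T ℚ.+ N → (k ℚ.* k) ℚ.* i ≡ 1ℚ →
      k ℚ.* k ℚ.* (M ℚ.- four ℚ.* (a ℚ.* (j ℚ.+ two ℚ.* z) ℚ.* i))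
      ≡ M ℚ.* (k ℚ.* k) ℚ.- four ℚ.* (T ℚ.* N ℚ.* (T ℚ.+ N ℚ.+ two ℚ.* z))
    H-identity M T N _ _ z k i refl refl kki = trans
      (solve 6 (λ M T N z k i →
          k :* k :* (M :- con four :* (T :* N :* (T :+ N :+ con two :* z) :* i))
        := M :* (k :* k) :- con four :* (T :* N :* (T :+ N :+ con two :* z)) :* ((k :* k) :* i)) refl M T N z k i)
      (trans (cong (λ o → M ℚ.* (k ℚ.* k) ℚ.- four ℚ.* (T ℚ.* N ℚ.* (T ℚ.+ N ℚ.+ two ℚ.* z)) ℚ.* o) kki)
      (cong (λ y → M ℚ.* (k ℚ.* k) ℚ.- y) (ℚ.*-identityʳ (four ℚ.* (T ℚ.* N ℚ.* (T ℚ.+ N ℚ.+ two ℚ.* z))))))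

  module _ (h : bound ≤ fromℕ m) where

    private
      H : NonNeg (fromℚ (M ℚ.* (k ℚ.* k)) - fromℕ 4 * (fromℕ t * fromℕ n * (fromℕ t + fromℕ n + fromℕ 2 * z)))
      H = (natural κ ⊗ natural κ) ⊗ nonNeg {fromℕ m - bound} (≤⇒0≤-ℝ {bound} {fromℕ m} h)
        by λ i → H-identity M T N (ι (+ (t ℕ.* n))) (ι (+ j)) (sqrtSeq (t ℕ.* n) i) k (inv (k ℚ.* k))
             (ι-*ℕ t n) j≡T+N kk⁻¹

      X : ℝ
      X = fromℕ 2 * ((v * s) * (s + v))

      squares : NonNeg ((μ * fromℕ κ) * (μ * fromℕ κ) - X * X)
      -- The summands put μ² for m, then, in `H`, vs for √(tn), v²s² for tn, and s² + v² for t + n.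
      squares = (natural κ ⊗ natural κ) ⊗ √²≥ m
        ⊕ H
        ⊕ (natural 8 ⊗ (natural t ⊗ natural n)) ⊗ √-*-≤ t n
        ⊕ natural 4 ⊗ ((natural t ⊗ √² n ⊕ (root n ⊗ root n) ⊗ √² t)
                        ⊗ (natural t ⊕ natural n ⊕ natural 2 ⊗ (root n ⊗ root t)))
        ⊕ natural 4 ⊗ ((root n ⊗ root n ⊗ (root t ⊗ root t)) ⊗ (√² t ⊕ √² n))
        by λ i → solve 8 (λ k M T N μ s v z →
             k :* k :* (μ :* μ :- M)
             :+ (M :* (k :* k) :- con four :* (T :* N :* (T :+ N :+ con two :* z)))
             :+ con eight :* (T :* N) :* (z :- v :* s)
             :+ con four :* ((T :* (N :- v :* v) :+ v :* v :* (T :- s :* s)) :* (T :+ N :+ con two :* (v :* s)))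
             :+ con four :* (v :* v :* (s :* s) :* ((T :- s :* s) :+ (N :- v :* v)))
           := (μ :* k) :* (μ :* k) :- con two :* ((v :* s) :* (s :+ v)) :* (con two :* ((v :* s) :* (s :+ v))))
           refl k M T N (sqrtSeq m i) (sqrtSeq t i) (sqrtSeq n i) (sqrtSeq (t ℕ.* n) i)

      G : NonNeg (μ * fromℕ κ - X)
      G = nonNeg (0≤-square-cancel {X} {μ * fromℕ κ}
        (λ i → 0≤-* {sqrtSeq m i} {k} (0≤sqrtSeq m i) (0≤ι κ)) (holds squares))

      -- Here `a`, `b`, `e`, `f` are the inverses of `v`, `s`, `N`, `T`. The first summand is the
      -- gap between the endpoints with 1/(vs)² for 1/(tn) and μ² for m; the other two correct this.
      -- T - N = 1 gives e - f = ef.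
      gap-identity : ∀ {T} N M k μ v s a b e f → T ≡ 1ℚ ℚ.+ N → v ℚ.* a ≡ 1ℚ → s ℚ.* b ≡ 1ℚ →
        N ℚ.* e ≡ 1ℚ → T ℚ.* f ≡ 1ℚ →
        (μ ℚ.* k ℚ.- two ℚ.* ((v ℚ.* s) ℚ.* (s ℚ.+ v))) ℚ.* (μ ℚ.* ((a ℚ.* a) ℚ.* (b ℚ.* b)))
        ℚ.+ k ℚ.* ((e ℚ.* f) ℚ.* (M ℚ.- μ ℚ.* μ))
        ℚ.+ k ℚ.* ((μ ℚ.* μ) ℚ.* ((e ℚ.* f) ℚ.* ((a ℚ.* a) ℚ.* (b ℚ.* b)) ℚ.*
              (v ℚ.* v ℚ.* (s ℚ.* s ℚ.- T) ℚ.+ T ℚ.* (v ℚ.* v ℚ.- N))))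
        ≡ (M ℚ.* k) ℚ.* e ℚ.- two ℚ.* (μ ℚ.* a) ℚ.- ((M ℚ.* k) ℚ.* f ℚ.+ two ℚ.* (μ ℚ.* b))
      -- The solver cannot use va = 1 and the like. So the expression is first arranged to display
      -- the products va, sb, Ne, Tf, which `F-cong` replaces by 1.
      gap-identity N M k μ v s a b e f refl va sb Ne Tf = trans
        (solve 10 (λ N M k μ v s a b e f →
            (μ :* k :- con two :* ((v :* s) :* (s :+ v))) :* (μ :* ((a :* a) :* (b :* b)))
            :+ k :* ((e :* f) :* (M :- μ :* μ))
            :+ k :* ((μ :* μ) :* ((e :* f) :* ((a :* a) :* (b :* b)) :*
                  (v :* v :* (s :* s :- (con 1ℚ :+ N)) :+ (con 1ℚ :+ N) :* (v :* v :- N))))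
          := (k :* M :* (e :* ((con 1ℚ :+ N) :* f) :- f :* (N :* e)) :- k :* μ :* μ :* e :* f
              :+ μ :* μ :* k :* a :* a :* b :* b)
             :+ k :* μ :* μ :* (e :* f :* (v :* a) :* (v :* a) :* (s :* b) :* (s :* b)
                                :- (N :* e) :* ((con 1ℚ :+ N) :* f) :* a :* a :* b :* b)
             :- con two :* μ :* (v :* a) :* (s :* b) :* (a :* (s :* b) :+ b :* (v :* a)))
          refl N M k μ v s a b e f)
        (trans (F-cong va sb Ne Tf)
        (solve 7 (λ M k μ a b e f →
             (k :* M :* (e :* con 1ℚ :- f :* con 1ℚ) :- k :* μ :* μ :* e :* f
              :+ μ :* μ :* k :* a :* a :* b :* b)
             :+ k :* μ :* μ :* (e :* f :* con 1ℚ :* con 1ℚ :* con 1ℚ :* con 1ℚ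
                                :- con 1ℚ :* con 1ℚ :* a :* a :* b :* b)
             :- con two :* μ :* con 1ℚ :* con 1ℚ :* (a :* con 1ℚ :+ b :* con 1ℚ)
          := (M :* k) :* e :- con two :* (μ :* a) :- ((M :* k) :* f :+ con two :* (μ :* b)))
          refl M k μ a b e f))
        where
        F : ℚ → ℚ → ℚ → ℚ → ℚ
        F A B C D = (k ℚ.* M ℚ.* (e ℚ.* D ℚ.- f ℚ.* C) ℚ.- k ℚ.* μ ℚ.* μ ℚ.* e ℚ.* f
              ℚ.+ μ ℚ.* μ ℚ.* k ℚ.* a ℚ.* a ℚ.* b ℚ.* b)
             ℚ.+ k ℚ.* μ ℚ.* μ ℚ.* (e ℚ.* f ℚ.* A ℚ.* A ℚ.* B ℚ.* B
                                ℚ.- C ℚ.* D ℚ.* a ℚ.* a ℚ.* b ℚ.* b)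
             ℚ.- two ℚ.* μ ℚ.* A ℚ.* B ℚ.* (a ℚ.* B ℚ.+ b ℚ.* A)
        F-cong : ∀ {A A′ B B′ C C′ D D′} → A ≡ A′ → B ≡ B′ → C ≡ C′ → D ≡ D′ → F A B C D ≡ F A′ B′ C′ D′
        F-cong refl refl refl refl = refl

      interval : NonNeg (upper - lower)
      interval = G ⊗ (root m ⊗ ((0≤a ⊗ 0≤a) ⊗ (0≤b ⊗ 0≤b)))
        ⊕ natural κ ⊗ ((0≤e ⊗ 0≤f) ⊗ √² m)
        ⊕ natural κ ⊗ ((root m ⊗ root m) ⊗ ((0≤e ⊗ 0≤f) ⊗ ((0≤a ⊗ 0≤a) ⊗ (0≤b ⊗ 0≤b))
              ⊗ (root n ⊗ root n ⊗ √²≥ t ⊕ natural t ⊗ √²≥ n)))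
        by λ i → trans
          (gap-identity N M k (sqrtSeq m i) (sqrtSeq n i) (sqrtSeq t i) (inv (sqrtSeq n i)) (inv (sqrtSeq t i))
            (inv N) (inv T) T≡1+N (√-inverse n i) (√-inverse t i) (ι⁻¹ n) (ι⁻¹ t))
          (cong (λ y → y ℚ.* inv N ℚ.- two ℚ.* (sqrtSeq m i ℚ.* inv (sqrtSeq n i))
              ℚ.- (y ℚ.* inv T ℚ.+ two ℚ.* (sqrtSeq m i ℚ.* inv (sqrtSeq t i)))) (sym (ι-*ℕ m κ)))
        where
        0≤a : NonNeg (v ⁻¹)
        0≤a = ptw (0≤√⁻¹ n)
        0≤b : NonNeg (s ⁻¹)
        0≤b = ptw (0≤√⁻¹ t)
        0≤e : NonNeg (fromℚ (inv N))
        0≤e = const (0≤ι⁻¹ n)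
        0≤f : NonNeg (fromℚ (inv T))
        0≤f = const (0≤ι⁻¹ t)

    lower≤upper : lower ≤ upper
    lower≤upper = 0≤⇒≤-ℝ {lower} {upper} (holds interval)

≤-reflℝ : ∀ x → x ≤ x
≤-reflℝ x = 0≤⇒≤-ℝ {x} {x} (pointwise {x - x} λ n → ≤⇒0≤ {seq x n} ℚ.≤-refl)

I₄-satisfiable : ∀ m t κ .{{_ : NonZero m}} .{{_ : NonZero t}} .{{_ : NonZero κ}} →
  fromℕ 4 *
    ( fromℕ (t ℕ.* (t ℕ.∸ 1)) * (fromℕ (2 ℕ.* t ℕ.∸ 1) + fromℕ 2 * √ (t ℕ.* (t ℕ.∸ 1)))
      / (fromℕ κ * fromℕ κ) )
    ≤ fromℕ m →
  Satisfiable (I₄ m t κ)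
I₄-satisfiable m 1 κ h = lower , ≤-reflℝ lower
  where
  lower = fromℕ (m ℕ.* κ) / fromℕ 1 + fromℕ 2 * (√ m / √ 1)
I₄-satisfiable m (suc n@(suc _)) κ h = lower , ≤-reflℝ lower , NonEmpty.lower≤upper m n κ h
  where
  lower = fromℕ (m ℕ.* κ) / fromℕ (suc n) + fromℕ 2 * (√ m / √ (suc n))

-- The field K

IsInt : ℚ → Set
IsInt x = ∃[ n ] x ≡ ι n

isInt-+ : ∀ {x y} → IsInt x → IsInt y → IsInt (x ℚ.+ y)
isInt-+ (m , refl) (n , refl) = m ℤ.+ n , sym (ι-+ m n)

isInt-* : ∀ {x y} → IsInt x → IsInt y → IsInt (x ℚ.* y)
isInt-* (m , refl) (n , refl) = m ℤ.* n , sym (ι-* m n)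

isInt-neg : ∀ {x} → IsInt x → IsInt (ℚ.- x)
isInt-neg (m , refl) = ℤ.- m , sym (ι-neg m)

isInt-ι : ∀ n → IsInt (ι n)
isInt-ι n = n , refl

K-≡ : ∀ {p q} {a b c d a′ b′ c′ d′ : ℚ} → a ≡ a′ → b ≡ b′ → c ≡ c′ → d ≡ d′ →
  _≡_ {A = K p q} (a +√p b +√q c +√pq d) (a′ +√p b′ +√q c′ +√pq d′)
K-≡ refl refl refl refl = refl

-- Formal elements of K, to which the ring solver applies coordinatewise.
module _ {n : ℕ} where

  record Kᵖ : Set where
    constructor ⟨_,_,_,_⟩
    field c₁ c₂ c₃ c₄ : Polynomial n

  mulᵖ : Polynomial n → Polynomial n → Kᵖ → Kᵖ → Kᵖ
  mulᵖ P Q ⟨ a , b , c , d ⟩ ⟨ a′ , b′ , c′ , d′ ⟩ = ⟨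
       (a :* a′ :+ P :* (b :* b′) :+ Q :* (c :* c′) :+ P :* Q :* (d :* d′)) ,
       (a :* b′ :+ b :* a′ :+ Q :* (c :* d′ :+ d :* c′)) ,
       (a :* c′ :+ c :* a′ :+ P :* (b :* d′ :+ d :* b′)) ,
       (a :* d′ :+ d :* a′ :+ b :* c′ :+ c :* b′) ⟩

  addᵖ : Kᵖ → Kᵖ → Kᵖ
  addᵖ ⟨ a , b , c , d ⟩ ⟨ a′ , b′ , c′ , d′ ⟩ = ⟨ a :+ a′ , b :+ b′ , c :+ c′ , d :+ d′ ⟩

  scaleᵖ : Polynomial n → Kᵖ → Kᵖ
  scaleᵖ s ⟨ a , b , c , d ⟩ = ⟨ s :* a , s :* b , s :* c , s :* d ⟩

  σᵖ τᵖ : Kᵖ → Kᵖ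
  σᵖ ⟨ a , b , c , d ⟩ = ⟨ a , :- b , c , :- d ⟩
  τᵖ ⟨ a , b , c , d ⟩ = ⟨ a , b , :- c , :- d ⟩

open Kᵖ

module _ {p q : ℕ} where

  private
    P Q : ℚ
    P = ι (+ p)
    Q = ι (+ q)

  0ᴷ 1ᴷ : K p q
  0ᴷ = fromℤᴷ (+ 0)
  1ᴷ = fromℤᴷ (+ 1)

  *ᴷ-assoc : ∀ (x y z : K p q) → (x *ᴷ y) *ᴷ z ≡ x *ᴷ (y *ᴷ z)
  *ᴷ-assoc (a +√p b +√q c +√pq d) (a′ +√p b′ +√q c′ +√pq d′) (e +√p f +√q g +√pq h) = K-≡
    (solve 14 (law c₁) refl P Q a b c d a′ b′ c′ d′ e f g h)
    (solve 14 (law c₂) refl P Q a b c d a′ b′ c′ d′ e f g h)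
    (solve 14 (law c₃) refl P Q a b c d a′ b′ c′ d′ e f g h)
    (solve 14 (law c₄) refl P Q a b c d a′ b′ c′ d′ e f g h)
    where
    law = λ (π : Kᵖ → Polynomial 14) P Q a b c d a′ b′ c′ d′ e f g h →
      let _·ᵖ_ = mulᵖ P Q ; X = ⟨ a , b , c , d ⟩ ; Y = ⟨ a′ , b′ , c′ , d′ ⟩ ; Z = ⟨ e , f , g , h ⟩
      in π ((X ·ᵖ Y) ·ᵖ Z) := π (X ·ᵖ (Y ·ᵖ Z))

  *ᴷ-distribʳ-+ᴷ : ∀ (x y z : K p q) → (y +ᴷ z) *ᴷ x ≡ y *ᴷ x +ᴷ z *ᴷ x
  *ᴷ-distribʳ-+ᴷ (e +√p f +√q g +√pq h) (a +√p b +√q c +√pq d) (a′ +√p b′ +√q c′ +√pq d′) = K-≡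
    (solve 14 (law c₁) refl P Q a b c d a′ b′ c′ d′ e f g h)
    (solve 14 (law c₂) refl P Q a b c d a′ b′ c′ d′ e f g h)
    (solve 14 (law c₃) refl P Q a b c d a′ b′ c′ d′ e f g h)
    (solve 14 (law c₄) refl P Q a b c d a′ b′ c′ d′ e f g h)
    where
    law = λ (π : Kᵖ → Polynomial 14) P Q a b c d a′ b′ c′ d′ e f g h →
      let _·ᵖ_ = mulᵖ P Q ; X = ⟨ a , b , c , d ⟩ ; Y = ⟨ a′ , b′ , c′ , d′ ⟩ ; Z = ⟨ e , f , g , h ⟩
      in π (addᵖ X Y ·ᵖ Z) := π (addᵖ (X ·ᵖ Z) (Y ·ᵖ Z))

  *ᴷ-comm : ∀ (x y : K p q) → x *ᴷ y ≡ y *ᴷ x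
  *ᴷ-comm (a +√p b +√q c +√pq d) (a′ +√p b′ +√q c′ +√pq d′) = K-≡
    (solve 10 (law c₁) refl P Q a b c d a′ b′ c′ d′)
    (solve 10 (law c₂) refl P Q a b c d a′ b′ c′ d′)
    (solve 10 (law c₃) refl P Q a b c d a′ b′ c′ d′)
    (solve 10 (law c₄) refl P Q a b c d a′ b′ c′ d′)
    where
    law = λ (π : Kᵖ → Polynomial 10) P Q a b c d a′ b′ c′ d′ →
      let _·ᵖ_ = mulᵖ P Q ; X = ⟨ a , b , c , d ⟩ ; Y = ⟨ a′ , b′ , c′ , d′ ⟩
      in π (X ·ᵖ Y) := π (Y ·ᵖ X)

  infixr 8 _∙_

  _∙_ : ℚ → K p q → K p q
  s ∙ (a +√p b +√q c +√pq d) = (s ℚ.* a) +√p (s ℚ.* b) +√q (s ℚ.* c) +√pq (s ℚ.* d)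

  ∙-distrib-*ᴷ : ∀ s t (x y : K p q) → (s ℚ.* t) ∙ (x *ᴷ y) ≡ (s ∙ x) *ᴷ (t ∙ y)
  ∙-distrib-*ᴷ s t (a +√p b +√q c +√pq d) (a′ +√p b′ +√q c′ +√pq d′) = K-≡
    (solve 12 (law c₁) refl s t P Q a b c d a′ b′ c′ d′)
    (solve 12 (law c₂) refl s t P Q a b c d a′ b′ c′ d′)
    (solve 12 (law c₃) refl s t P Q a b c d a′ b′ c′ d′)
    (solve 12 (law c₄) refl s t P Q a b c d a′ b′ c′ d′)
    where
    law = λ (π : Kᵖ → Polynomial 12) s t P Q a b c d a′ b′ c′ d′ →
      let _·ᵖ_ = mulᵖ P Q ; X = ⟨ a , b , c , d ⟩ ; Y = ⟨ a′ , b′ , c′ , d′ ⟩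
      in π (scaleᵖ (s :* t) (X ·ᵖ Y)) := π (scaleᵖ s X ·ᵖ scaleᵖ t Y)

  ∙-distrib-+ᴷ : ∀ s (x y : K p q) → s ∙ (x +ᴷ y) ≡ s ∙ x +ᴷ s ∙ y
  ∙-distrib-+ᴷ s (a +√p b +√q c +√pq d) (a′ +√p b′ +√q c′ +√pq d′) = K-≡
    (ℚ.*-distribˡ-+ s a a′) (ℚ.*-distribˡ-+ s b b′) (ℚ.*-distribˡ-+ s c c′) (ℚ.*-distribˡ-+ s d d′)

  -- The conjugations √p ↦ -√p and √q ↦ -√q.
  σ τ : K p q → K p q
  σ (a +√p b +√q c +√pq d) = a +√p (ℚ.- b) +√q c +√pq (ℚ.- d)
  τ (a +√p b +√q c +√pq d) = a +√p b +√q (ℚ.- c) +√pq (ℚ.- d)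

  σ-* : ∀ (x y : K p q) → σ (x *ᴷ y) ≡ σ x *ᴷ σ y
  σ-* (a +√p b +√q c +√pq d) (a′ +√p b′ +√q c′ +√pq d′) = K-≡
    (solve 10 (law c₁) refl P Q a b c d a′ b′ c′ d′)
    (solve 10 (law c₂) refl P Q a b c d a′ b′ c′ d′)
    (solve 10 (law c₃) refl P Q a b c d a′ b′ c′ d′)
    (solve 10 (law c₄) refl P Q a b c d a′ b′ c′ d′)
    where
    law = λ (π : Kᵖ → Polynomial 10) P Q a b c d a′ b′ c′ d′ →
      let _·ᵖ_ = mulᵖ P Q ; X = ⟨ a , b , c , d ⟩ ; Y = ⟨ a′ , b′ , c′ , d′ ⟩
      in π (σᵖ (X ·ᵖ Y)) := π (σᵖ X ·ᵖ σᵖ Y)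

  τ-* : ∀ (x y : K p q) → τ (x *ᴷ y) ≡ τ x *ᴷ τ y
  τ-* (a +√p b +√q c +√pq d) (a′ +√p b′ +√q c′ +√pq d′) = K-≡
    (solve 10 (law c₁) refl P Q a b c d a′ b′ c′ d′)
    (solve 10 (law c₂) refl P Q a b c d a′ b′ c′ d′)
    (solve 10 (law c₃) refl P Q a b c d a′ b′ c′ d′)
    (solve 10 (law c₄) refl P Q a b c d a′ b′ c′ d′)
    where
    law = λ (π : Kᵖ → Polynomial 10) P Q a b c d a′ b′ c′ d′ →
      let _·ᵖ_ = mulᵖ P Q ; X = ⟨ a , b , c , d ⟩ ; Y = ⟨ a′ , b′ , c′ , d′ ⟩
      in π (τᵖ (X ·ᵖ Y)) := π (τᵖ X ·ᵖ τᵖ Y)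

  -- The elements of ℤ + ℤ√p + ℤ√q + ℤ√p√q: closed under products, and reached from every element of
  -- K by a positive integer multiple. Denominators are measured against it.
  record Lattice (x : K p q) : Set where
    constructor lattice
    open K x
    field
      re∈ℤ        : IsInt re
      coeff-√p∈ℤ  : IsInt coeff-√p
      coeff-√q∈ℤ  : IsInt coeff-√q
      coeff-√pq∈ℤ : IsInt coeff-√pq

  lattice-+ : ∀ {x y} → Lattice x → Lattice y → Lattice (x +ᴷ y)
  lattice-+ (lattice a b c d) (lattice a′ b′ c′ d′) =
    lattice (isInt-+ a a′) (isInt-+ b b′) (isInt-+ c c′) (isInt-+ d d′)

  lattice-* : ∀ {x y} → Lattice x → Lattice y → Lattice (x *ᴷ y)
  lattice-* (lattice a b c d) (lattice a′ b′ c′ d′) = lattice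
    (isInt-+ (isInt-+ (isInt-+ (isInt-* a a′) (isInt-* P∈ℤ (isInt-* b b′))) (isInt-* Q∈ℤ (isInt-* c c′)))
      (isInt-* (isInt-* P∈ℤ Q∈ℤ) (isInt-* d d′)))
    (isInt-+ (isInt-+ (isInt-* a b′) (isInt-* b a′)) (isInt-* Q∈ℤ (isInt-+ (isInt-* c d′) (isInt-* d c′))))
    (isInt-+ (isInt-+ (isInt-* a c′) (isInt-* c a′)) (isInt-* P∈ℤ (isInt-+ (isInt-* b d′) (isInt-* d b′))))
    (isInt-+ (isInt-+ (isInt-+ (isInt-* a d′) (isInt-* d a′)) (isInt-* b c′)) (isInt-* c b′))
    where
    P∈ℤ = isInt-ι (+ p)
    Q∈ℤ = isInt-ι (+ q)

-- Almost integral elements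

*-denominator : ∀ x → x ℚ.* ι (+ ↧ₙ x) ≡ ι (↥ x)
*-denominator x@(mkℚ u d _) =
  trans (cong (ℚ._* ι (+ suc d)) (sym (ℚ.↥p/↧p≡p x))) (/-*-cancel u d)

Clears : ℕ → ℚ → Set
Clears N x = IsInt (ι (+ N) ℚ.* x)

clears-denominator : ∀ x → Clears (↧ₙ x) x
clears-denominator x = ↥ x , trans (ℚ.*-comm (ι (+ ↧ₙ x)) x) (*-denominator x)

clears-multiple : ∀ M {N} x → Clears N x → Clears (M ℕ.* N) x
clears-multiple M {N} x Nx = subst IsInt
  (trans (sym (ℚ.*-assoc (ι (+ M)) (ι (+ N)) x)) (cong (ℚ._* x) (sym (ι-*ℕ M N))))
  (isInt-* {ι (+ M)} {ι (+ N) ℚ.* x} (isInt-ι (+ M)) Nx)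

clears-multiple′ : ∀ M {N} x → Clears N x → Clears (N ℕ.* M) x
clears-multiple′ M {N} x Nx = subst (λ k → Clears k x) (ℕ.*-comm M N) (clears-multiple M x Nx)

module _ {p q : ℕ} where

  *ᴷ-identityˡ : ∀ (x : K p q) → 1ᴷ *ᴷ x ≡ x
  *ᴷ-identityˡ (a +√p b +√q c +√pq d) = K-≡
    (solve 6 (law c₁) refl (ι (+ p)) (ι (+ q)) a b c d)
    (solve 6 (law c₂) refl (ι (+ p)) (ι (+ q)) a b c d)
    (solve 6 (law c₃) refl (ι (+ p)) (ι (+ q)) a b c d)
    (solve 6 (law c₄) refl (ι (+ p)) (ι (+ q)) a b c d)
    where
    law = λ (π : Kᵖ → Polynomial 6) P Q a b c d →
      π (mulᵖ P Q ⟨ con 1ℚ , con 0ℚ , con 0ℚ , con 0ℚ ⟩ ⟨ a , b , c , d ⟩) := π ⟨ a , b , c , d ⟩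

  *ᴷ-zeroˡ : ∀ (x : K p q) → 0ᴷ *ᴷ x ≡ 0ᴷ
  *ᴷ-zeroˡ (a +√p b +√q c +√pq d) = K-≡
    (solve 6 (law c₁) refl (ι (+ p)) (ι (+ q)) a b c d)
    (solve 6 (law c₂) refl (ι (+ p)) (ι (+ q)) a b c d)
    (solve 6 (law c₃) refl (ι (+ p)) (ι (+ q)) a b c d)
    (solve 6 (law c₄) refl (ι (+ p)) (ι (+ q)) a b c d)
    where
    zeroᵖ = ⟨ con 0ℚ , con 0ℚ , con 0ℚ , con 0ℚ ⟩
    law = λ (π : Kᵖ → Polynomial 6) P Q a b c d → π (mulᵖ P Q zeroᵖ ⟨ a , b , c , d ⟩) := π zeroᵖ

  *ᴷ-swap : ∀ (x y z : K p q) → (x *ᴷ y) *ᴷ z ≡ y *ᴷ (x *ᴷ z)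
  *ᴷ-swap x y z = trans (cong (_*ᴷ z) (*ᴷ-comm x y)) (*ᴷ-assoc y x z)

  pow : K p q → ℕ → K p q
  pow x zero    = 1ᴷ
  pow x (suc k) = x *ᴷ pow x k

  ClearsK : ℕ → K p q → Set
  ClearsK N x = Lattice (ι (+ N) ∙ x)

  clearsK-multiple : ∀ M {N} {x} → ClearsK N x → ClearsK (M ℕ.* N) x
  clearsK-multiple M {N} {a +√p b +√q c +√pq d} (lattice a∈ b∈ c∈ d∈) =
    lattice (clears-multiple M {N} a a∈) (clears-multiple M {N} b b∈)
            (clears-multiple M {N} c c∈) (clears-multiple M {N} d d∈)

  clearsK-multiple′ : ∀ M {N} {x} → ClearsK N x → ClearsK (N ℕ.* M) x
  clearsK-multiple′ M {N} {x} Nx = subst (λ k → ClearsK k x) (ℕ.*-comm M N) (clearsK-multiple M {N} {x} Nx)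

  common-denominator : ∀ (x : K p q) → ∃[ N ] (NonZero N × ClearsK N x)
  common-denominator x@(a +√p b +√q c +√pq d) =
    (k ℕ.* l) ℕ.* (m ℕ.* n) ,
    ℕ.m*n≢0 (k ℕ.* l) (m ℕ.* n) {{ℕ.m*n≢0 k l}} {{ℕ.m*n≢0 m n}} ,
    lattice
      (clears-multiple′ (m ℕ.* n) {k ℕ.* l} a (clears-multiple′ l {k} a (clears-denominator a)))
      (clears-multiple′ (m ℕ.* n) {k ℕ.* l} b (clears-multiple k {l} b (clears-denominator b)))
      (clears-multiple (k ℕ.* l) {m ℕ.* n} c (clears-multiple′ n {m} c (clears-denominator c)))
      (clears-multiple (k ℕ.* l) {m ℕ.* n} d (clears-multiple m {n} d (clears-denominator d)))
    where
    k = ↧ₙ a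
    l = ↧ₙ b
    m = ↧ₙ c
    n = ↧ₙ d

  clearsK-+ : ∀ N {x y} → ClearsK N x → ClearsK N y → ClearsK N (x +ᴷ y)
  clearsK-+ N {x} {y} Nx Ny = subst Lattice (sym (∙-distrib-+ᴷ (ι (+ N)) x y)) (lattice-+ Nx Ny)

  clearsK-* : ∀ M N {x y} → ClearsK M x → ClearsK N y → ClearsK (M ℕ.* N) (x *ᴷ y)
  clearsK-* M N {x} {y} Mx Ny = subst Lattice
    (trans (sym (∙-distrib-*ᴷ (ι (+ M)) (ι (+ N)) x y)) (cong (_∙ (x *ᴷ y)) (sym (ι-*ℕ M N))))
    (lattice-* Mx Ny)

  fromℤᴷ-lattice : ∀ c → Lattice {p} {q} (fromℤᴷ c)
  fromℤᴷ-lattice c = lattice (isInt-ι c) (isInt-ι (+ 0)) (isInt-ι (+ 0)) (isInt-ι (+ 0))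

  1∙ : ∀ (x : K p q) → 1ℚ ∙ x ≡ x
  1∙ (a +√p b +√q c +√pq d) = K-≡ (ℚ.*-identityˡ a) (ℚ.*-identityˡ b) (ℚ.*-identityˡ c) (ℚ.*-identityˡ d)

  clearsK-fromℤ* : ∀ N c {y} → ClearsK N y → ClearsK N (fromℤᴷ c *ᴷ y)
  clearsK-fromℤ* N c {y} Ny = subst (λ k → ClearsK k (fromℤᴷ c *ᴷ y)) (ℕ.*-identityˡ N)
    (clearsK-* 1 N {fromℤᴷ c} {y} (subst Lattice (sym (1∙ (fromℤᴷ c))) (fromℤᴷ-lattice c)) Ny)

  clearsK-cancel : ∀ N {x y} → ClearsK N (x +ᴷ y) → ClearsK N x → ClearsK N y
  clearsK-cancel N {x} {y} Nx+y Nx = subst (ClearsK N) (eq x y)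
    (clearsK-+ N {fromℤᴷ (ℤ.- (+ 1)) *ᴷ x} {x +ᴷ y} (clearsK-fromℤ* N (ℤ.- (+ 1)) {x} Nx) Nx+y)
    where
    eq : ∀ x y → fromℤᴷ (ℤ.- (+ 1)) *ᴷ x +ᴷ (x +ᴷ y) ≡ y
    eq (a +√p b +√q c +√pq d) (a′ +√p b′ +√q c′ +√pq d′) = K-≡
      (solve 10 (law c₁) refl (ι (+ p)) (ι (+ q)) a b c d a′ b′ c′ d′)
      (solve 10 (law c₂) refl (ι (+ p)) (ι (+ q)) a b c d a′ b′ c′ d′)
      (solve 10 (law c₃) refl (ι (+ p)) (ι (+ q)) a b c d a′ b′ c′ d′)
      (solve 10 (law c₄) refl (ι (+ p)) (ι (+ q)) a b c d a′ b′ c′ d′)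
      where
      law = λ (π : Kᵖ → Polynomial 10) P Q a b c d a′ b′ c′ d′ →
        let X = ⟨ a , b , c , d ⟩ ; Y = ⟨ a′ , b′ , c′ , d′ ⟩
        in π (addᵖ (mulᵖ P Q ⟨ con (ℚ.- 1ℚ) , con 0ℚ , con 0ℚ , con 0ℚ ⟩ X) (addᵖ X Y)) := π Y

  -- Bounded denominators of all powers; unlike the existence of a monic integral
  -- polynomial, this passes directly to sums and products.
  record AlmostIntegral (x : K p q) : Set where
    constructor almostIntegral
    field
      N        : ℕ
      {{N≢0}}  : NonZero N
      powers   : ∀ k → ClearsK N (pow x k)

  powers-denominator : ∀ (x : K p q) n → ∃[ N ] (NonZero N × (∀ i → i ℕ.< n → ClearsK N (pow x i)))
  powers-denominator x zero    = 1 , _ , λ _ ()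
  powers-denominator x (suc n) =
    let M , M≢0 , h = powers-denominator x n
        N , N≢0 , k = common-denominator (pow x n)
    in M ℕ.* N , ℕ.m*n≢0 M N {{M≢0}} {{N≢0}} , λ i i<1+n →
       [ (λ i<n → clearsK-multiple′ N {M} {pow x i} (h i i<n)) , (λ { refl → clearsK-multiple M {N} {pow x n} k }) ]′
         (ℕ.m≤n⇒m<n∨m≡n (ℕ.s≤s⁻¹ i<1+n))

  -- f(x)xʲ minus its lower terms is the leading power. The recursion removes the lowest coefficient
  -- and shifts one factor x from `evalMonic` into the power.
  leading-power : ∀ N x cs j → (∀ i → i ℕ.< length cs → ClearsK N (pow x (i ℕ.+ j))) →
                  ClearsK N (evalMonic cs x *ᴷ pow x j) → ClearsK N (pow x (length cs ℕ.+ j))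
  leading-power N x []       j h e = subst (ClearsK N) (*ᴷ-identityˡ (pow x j)) e
  leading-power N x (c ∷ cs) j h e =
    subst (λ k → ClearsK N (pow x k)) (ℕ.+-suc (length cs) j)
      (leading-power N x cs (suc j)
        (λ i i<n → subst (λ k → ClearsK N (pow x k)) (sym (ℕ.+-suc i j)) (h (suc i) (ℕ.s≤s i<n)))
        (clearsK-cancel N {fromℤᴷ c *ᴷ pow x j} {E *ᴷ pow x (suc j)}
          (subst (ClearsK N)
            (trans (*ᴷ-distribʳ-+ᴷ (pow x j) (fromℤᴷ c) (x *ᴷ E))
              (cong (fromℤᴷ c *ᴷ pow x j +ᴷ_) (*ᴷ-swap x E (pow x j)))) e)
          (clearsK-fromℤ* N c {pow x j} (h 0 (ℕ.s≤s ℕ.z≤n)))))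
    where E = evalMonic cs x

  clearsK-0 : ∀ N → ClearsK N 0ᴷ
  clearsK-0 N = subst Lattice (sym (K-≡ (ℚ.*-zeroʳ n) (ℚ.*-zeroʳ n) (ℚ.*-zeroʳ n) (ℚ.*-zeroʳ n))) (fromℤᴷ-lattice (+ 0))
    where n = ι (+ N)

  -- A denominator common to the first n powers, n the degree, suffices for all: the monic relation
  -- expresses each later power through the n preceding ones with integer coefficients, so the
  -- window of cleared powers moves up by one.
  integral⇒almostIntegral : ∀ {x} → 𝒪 p q x → AlmostIntegral x
  integral⇒almostIntegral {x} (cs , root) with powers-denominator x (length cs)
  ... | N , N≢0 , h = almostIntegral N {{N≢0}} all
    where
    window : ∀ j i → i ℕ.< length cs → ClearsK N (pow x (i ℕ.+ j))
    next : ∀ j → ClearsK N (pow x (length cs ℕ.+ j))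
    next j = leading-power N x cs j (window j)
      (subst (ClearsK N) (sym (trans (cong (_*ᴷ pow x j) root) (*ᴷ-zeroˡ (pow x j)))) (clearsK-0 N))
    window zero    i i<n = subst (λ k → ClearsK N (pow x k)) (sym (ℕ.+-identityʳ i)) (h i i<n)
    window (suc j) i i<n = subst (λ k → ClearsK N (pow x k)) (sym (ℕ.+-suc i j))
      ([ window j (suc i) , (λ { eq → subst (λ n → ClearsK N (pow x (n ℕ.+ j))) (sym eq) (next j) }) ]′
        (ℕ.m≤n⇒m<n∨m≡n i<n))
    all : ∀ k → ClearsK N (pow x k)
    all k with ℕ.<-≤-connex k (length cs)
    ... | inj₁ k<n = h k k<n
    ... | inj₂ n≤k = subst (λ k → ClearsK N (pow x k)) (ℕ.m+[n∸m]≡n n≤k) (next (k ℕ.∸ length cs))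

  almostIntegral-+ : ∀ {x y} → AlmostIntegral x → AlmostIntegral y → AlmostIntegral (x +ᴷ y)
  almostIntegral-+ {x} {y} (almostIntegral M Mx) (almostIntegral N Ny) =
    almostIntegral (M ℕ.* N) {{ℕ.m*n≢0 M N}} λ k →
      subst (ClearsK (M ℕ.* N)) (trans (cong (pow (x +ᴷ y) k *ᴷ_) (*ᴷ-identityˡ 1ᴷ))
          (trans (*ᴷ-comm (pow (x +ᴷ y) k) 1ᴷ) (*ᴷ-identityˡ (pow (x +ᴷ y) k))))
        (mixed k 0 0)
    where
    -- With the extra factor xⁱyʲ the induction takes out one factor x + y at a time, and no
    -- binomial expansion is needed.
    mixed : ∀ k i j → ClearsK (M ℕ.* N) (pow (x +ᴷ y) k *ᴷ (pow x i *ᴷ pow y j))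
    mixed zero i j = subst (ClearsK (M ℕ.* N)) (sym (*ᴷ-identityˡ (pow x i *ᴷ pow y j)))
      (clearsK-* M N {pow x i} {pow y j} (Mx i) (Ny j))
    mixed (suc k) i j = subst (ClearsK (M ℕ.* N)) (sym expand)
      (clearsK-+ (M ℕ.* N) {W *ᴷ (pow x (suc i) *ᴷ pow y j)} {W *ᴷ (pow x i *ᴷ pow y (suc j))}
        (mixed k (suc i) j) (mixed k i (suc j)))
      where
      W = pow (x +ᴷ y) k
      U = pow x i
      V = pow y j
      expand : ((x +ᴷ y) *ᴷ W) *ᴷ (U *ᴷ V) ≡ W *ᴷ ((x *ᴷ U) *ᴷ V) +ᴷ W *ᴷ (U *ᴷ (y *ᴷ V))
      expand = trans (cong (_*ᴷ (U *ᴷ V)) (*ᴷ-distribʳ-+ᴷ W x y))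
        (trans (*ᴷ-distribʳ-+ᴷ (U *ᴷ V) (x *ᴷ W) (y *ᴷ W))
        (cong₂ _+ᴷ_
          (trans (*ᴷ-swap x W (U *ᴷ V)) (cong (W *ᴷ_) (sym (*ᴷ-assoc x U V))))
          (trans (*ᴷ-swap y W (U *ᴷ V)) (cong (W *ᴷ_)
            (trans (sym (*ᴷ-assoc y U V)) (*ᴷ-swap y U V))))))

  pow-* : ∀ x y k → pow (x *ᴷ y) k ≡ pow x k *ᴷ pow y k
  pow-* x y zero    = sym (*ᴷ-identityˡ 1ᴷ)
  pow-* x y (suc k) = trans (cong (x *ᴷ y *ᴷ_) (pow-* x y k))
    (trans (*ᴷ-assoc x y (pow x k *ᴷ pow y k))
    (trans (cong (x *ᴷ_) (trans (sym (*ᴷ-assoc y (pow x k) (pow y k))) (*ᴷ-swap y (pow x k) (pow y k))))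
    (sym (*ᴷ-assoc x (pow x k) (y *ᴷ pow y k)))))

  almostIntegral-* : ∀ {x y} → AlmostIntegral x → AlmostIntegral y → AlmostIntegral (x *ᴷ y)
  almostIntegral-* {x} {y} (almostIntegral M Mx) (almostIntegral N Ny) =
    almostIntegral (M ℕ.* N) {{ℕ.m*n≢0 M N}} λ k → subst (ClearsK (M ℕ.* N)) (sym (pow-* x y k))
      (clearsK-* M N {pow x k} {pow y k} (Mx k) (Ny k))

  module Conjugation (φ : K p q → K p q) (φ-* : ∀ x y → φ (x *ᴷ y) ≡ φ x *ᴷ φ y) (φ-1 : φ 1ᴷ ≡ 1ᴷ)
                     (φ-∙ : ∀ s x → φ (s ∙ x) ≡ s ∙ φ x)
                     (φ-lattice : ∀ {x} → Lattice x → Lattice (φ x)) where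

    pow-φ : ∀ x k → φ (pow x k) ≡ pow (φ x) k
    pow-φ x zero    = φ-1
    pow-φ x (suc k) = trans (φ-* x (pow x k)) (cong (φ x *ᴷ_) (pow-φ x k))

    almostIntegral-φ : ∀ {x} → AlmostIntegral x → AlmostIntegral (φ x)
    almostIntegral-φ {x} (almostIntegral N Nx) = almostIntegral N λ k →
      subst Lattice (trans (φ-∙ (ι (+ N)) (pow x k)) (cong (ι (+ N) ∙_) (pow-φ x k))) (φ-lattice (Nx k))

  almostIntegral-σ : ∀ {x} → AlmostIntegral x → AlmostIntegral (σ x)
  almostIntegral-σ = Conjugation.almostIntegral-φ σ σ-* refl
    (λ { s (a +√p b +√q c +√pq d) → K-≡ refl (ℚ.neg-distribʳ-* s b) refl (ℚ.neg-distribʳ-* s d) })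
    (λ { (lattice a b c d) → lattice a (isInt-neg b) c (isInt-neg d) })

  almostIntegral-τ : ∀ {x} → AlmostIntegral x → AlmostIntegral (τ x)
  almostIntegral-τ = Conjugation.almostIntegral-φ τ τ-* refl
    (λ { s (a +√p b +√q c +√pq d) → K-≡ refl refl (ℚ.neg-distribʳ-* s c) (ℚ.neg-distribʳ-* s d) })
    (λ { (lattice a b c d) → lattice a b (isInt-neg c) (isInt-neg d) })

-- Coefficients of integral elements

infixr 8 _^ℚ_

_^ℚ_ : ℚ → ℕ → ℚ
x ^ℚ zero  = 1ℚ
x ^ℚ suc k = x ℚ.* x ^ℚ k

*-cancelˡ-pos : ∀ a {x y} → 0ℚ ℚ.< a → a ℚ.* x ≡ a ℚ.* y → x ≡ y
*-cancelˡ-pos a 0<a ax≡ay = ℚ.≤-antisym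
  (ℚ.*-cancelˡ-≤-pos a {{ℚ.positive 0<a}} (ℚ.≤-reflexive ax≡ay))
  (ℚ.*-cancelˡ-≤-pos a {{ℚ.positive 0<a}} (ℚ.≤-reflexive (sym ax≡ay)))

coprime-* : ∀ {d m n} → Coprime d m → Coprime d n → Coprime d (m ℕ.* n)
coprime-* d⊥m d⊥n {e} (e∣d , e∣mn) =
  d⊥n (e∣d , Coprime.coprime-divisor (λ (f∣e , f∣m) → d⊥m (ℕ.∣-trans f∣e e∣d , f∣m)) e∣mn)

coprime-^ : ∀ {d m} k → Coprime d m → Coprime d (m ℕ.^ k)
coprime-^ zero    d⊥m (_ , e∣1) = ℕ.∣1⇒≡1 e∣1
coprime-^ {d} {m} (suc k) d⊥m = coprime-* {d} {m} {m ℕ.^ k} d⊥m (coprime-^ k d⊥m)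

n<m^n : ∀ {m} n → 1 ℕ.< m → n ℕ.< m ℕ.^ n
n<m^n zero    1<m = ℕ.s≤s ℕ.z≤n
n<m^n {m} (suc n) 1<m = begin-strict
  suc n              ≡⟨ ℕ.+-comm 1 n ⟩
  n ℕ.+ 1            <⟨ ℕ.+-mono-<-≤ (n<m^n n 1<m) (ℕ.≤-trans (ℕ.s≤s ℕ.z≤n) (n<m^n n 1<m)) ⟩
  m ℕ.^ n ℕ.+ m ℕ.^ n  ≡⟨ cong (m ℕ.^ n ℕ.+_) (ℕ.+-identityʳ (m ℕ.^ n)) ⟨
  2 ℕ.* m ℕ.^ n      ≤⟨ ℕ.*-monoˡ-≤ (m ℕ.^ n) 1<m ⟩
  m ℕ.* m ℕ.^ n      ∎
  where open ℕ.≤-Reasoning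

numerator-^ : ∀ z k → ∃[ w ] (z ^ℚ k ℚ.* ι (+ (↧ₙ z ℕ.^ k)) ≡ ι w × ℤ.∣ w ∣ ≡ ℤ.∣ ↥ z ∣ ℕ.^ k)
numerator-^ z zero    = + 1 , refl , refl
numerator-^ z (suc k) =
  let w , eq , ∣w∣ = numerator-^ z k in
  ↥ z ℤ.* w ,
  trans (cong (z ℚ.* z ^ℚ k ℚ.*_) (ι-*ℕ (↧ₙ z) (↧ₙ z ℕ.^ k)))
    (trans (solve 4 (λ z y v u → z :* y :* (v :* u) := (z :* v) :* (y :* u)) refl
      z (z ^ℚ k) (ι (+ ↧ₙ z)) (ι (+ (↧ₙ z ℕ.^ k))))
    (trans (cong₂ ℚ._*_ (*-denominator z) eq) (sym (ι-* (↥ z) w)))) ,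
  trans (ℤ.abs-* (↥ z) w) (cong (ℤ.∣ ↥ z ∣ ℕ.*_) ∣w∣)

denominator≡1⇒isInt : ∀ z → ↧ₙ z ≡ 1 → IsInt z
denominator≡1⇒isInt z eq = ↥ z , trans (sym (ℚ.*-identityʳ z))
  (trans (cong (λ n → z ℚ.* ι (+ n)) (sym eq)) (*-denominator z))

numerator⊥denominator : ∀ z → Coprime ℤ.∣ ↥ z ∣ (↧ₙ z)
numerator⊥denominator (mkℚ _ _ c) = Coprime.recompute c

-- Powers of a reduced fraction u/v stay reduced, so vᵏ divides N for every k; for v > 1 this fails
-- at k = N, as v^N > N.
bounded-denominators⇒isInt : ∀ z N .{{_ : NonZero N}} → (∀ k → Clears N (z ^ℚ k)) → IsInt z
bounded-denominators⇒isInt z N h = denominator≡1⇒isInt z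
  ([ (λ 1<v → contradiction (ℕ.∣⇒≤ (v^k∣N N)) (ℕ.<⇒≱ (n<m^n N 1<v)))
   , (λ 1≡v → sym 1≡v) ]′ (ℕ.m≤n⇒m<n∨m≡n (ℕ.>-nonZero⁻¹ v)))
  where
  v = ↧ₙ z
  v^k∣N : ∀ k → v ℕ.^ k ∣ N
  v^k∣N k = Coprime.coprime-divisor
    (Coprime.sym (coprime-^ k (Coprime.sym (coprime-^ k (Coprime.sym (numerator⊥denominator z))))))
    (divides ℤ.∣ j ∣ (begin
      ℤ.∣ ↥ z ∣ ℕ.^ k ℕ.* N    ≡⟨ ℕ.*-comm (ℤ.∣ ↥ z ∣ ℕ.^ k) N ⟩
      N ℕ.* ℤ.∣ ↥ z ∣ ℕ.^ k    ≡⟨ cong (N ℕ.*_) ∣w∣ ⟨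
      N ℕ.* ℤ.∣ w ∣            ≡⟨ ℤ.abs-* (+ N) w ⟨
      ℤ.∣ + N ℤ.* w ∣          ≡⟨ cong ℤ.∣_∣ (ι-injective {+ N ℤ.* w} {j ℤ.* + (v ℕ.^ k)} cleared) ⟩
      ℤ.∣ j ℤ.* + (v ℕ.^ k) ∣  ≡⟨ ℤ.abs-* j (+ (v ℕ.^ k)) ⟩
      ℤ.∣ j ∣ ℕ.* v ℕ.^ k      ∎))
    where
    open ≡-Reasoning
    j = proj₁ (h k)
    w = proj₁ (numerator-^ z k)
    ∣w∣ = proj₂ (proj₂ (numerator-^ z k))
    cleared : ι (+ N ℤ.* w) ≡ ι (j ℤ.* + (v ℕ.^ k))
    cleared = trans (ι-* (+ N) w)
      (trans (cong (ι (+ N) ℚ.*_) (sym (proj₁ (proj₂ (numerator-^ z k)))))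
      (trans (sym (ℚ.*-assoc (ι (+ N)) (z ^ℚ k) (ι (+ (v ℕ.^ k)))))
      (trans (cong (ℚ._* ι (+ (v ℕ.^ k))) (proj₂ (h k))) (sym (ι-* j (+ (v ℕ.^ k)))))))

-- The denominator of z clears all powers of z, since an even number of factors can be grouped into
-- the integer z².
square-isInt⇒isInt : ∀ z → IsInt (z ℚ.* z) → IsInt z
square-isInt⇒isInt z zz∈ℤ = bounded-denominators⇒isInt z (↧ₙ z) cleared
  where
  cleared : ∀ k → Clears (↧ₙ z) (z ^ℚ k)
  cleared 0 = isInt-* {ι (+ ↧ₙ z)} {1ℚ} (isInt-ι (+ ↧ₙ z)) (isInt-ι (+ 1))
  cleared 1 = subst (λ y → IsInt (ι (+ ↧ₙ z) ℚ.* y)) (sym (ℚ.*-identityʳ z)) (clears-denominator z)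
  cleared (suc (suc k)) = subst IsInt
    (solve 3 (λ z v y → z :* z :* (v :* y) := v :* (z :* (z :* y))) refl z (ι (+ ↧ₙ z)) (z ^ℚ k))
    (isInt-* {z ℚ.* z} {ι (+ ↧ₙ z) ℚ.* z ^ℚ k} zz∈ℤ (cleared k))

gcd-nonZero : ∀ m n .{{_ : NonZero m}} → NonZero (gcd m n)
gcd-nonZero m n = ℕ.≢-nonZero (λ g≡0 → ℕ.≢-nonZero⁻¹ m (ℕ.gcd[m,n]≡0⇒m≡0 g≡0))

coprime-cofactors : ∀ {m n m′ n′} .{{_ : NonZero m}} →
  m ≡ m′ ℕ.* gcd m n → n ≡ n′ ℕ.* gcd m n → Coprime m′ n′
coprime-cofactors {m} {n} m≡ n≡ {d} (divides x m′≡xd , divides y n′≡yd) =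
  ℕ.∣1⇒≡1 (ℕ.*-cancelʳ-∣ h {{gcd-nonZero m n}} (subst (d ℕ.* h ∣_) (sym (ℕ.*-identityˡ h)) (ℕ.gcd-greatest
    (divides x (trans m≡ (trans (cong (ℕ._* h) m′≡xd) (ℕ.*-assoc x d h))))
    (divides y (trans n≡ (trans (cong (ℕ._* h) n′≡yd) (ℕ.*-assoc y d h)))))))
  where
  h = gcd m n

-- Write m = m′h and n = n′h with h = gcd m n. From m ∣ n² one gets m′ ∣ h, so m′² ∣ m.
squareFree-∣ : ∀ {m n} .{{_ : NonZero m}} → SquareFree m → m ∣ n ℕ.* n → m ∣ n
squareFree-∣ {m} {n} sf m∣nn = cofactors (ℕ.gcd[m,n]∣m m n) (ℕ.gcd[m,n]∣n m n)
  where
  h = gcd m n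
  cofactors : h ∣ m → h ∣ n → m ∣ n
  cofactors (divides m′ m≡m′h) (divides n′ n≡n′h) = subst (_∣ n) (sym m≡h) (ℕ.gcd[m,n]∣n m n)
    where
    m′⊥n′ : Coprime m′ n′
    m′⊥n′ = coprime-cofactors {m} {n} m≡m′h n≡n′h
    m′∣n′n′h : m′ ∣ n′ ℕ.* (n′ ℕ.* h)
    m′∣n′n′h = ℕ.*-cancelʳ-∣ h {{gcd-nonZero m n}} (subst₂ _∣_ m≡m′h
      (trans (cong₂ ℕ._*_ n≡n′h n≡n′h)
        (trans (ℕ.*-assoc n′ h (n′ ℕ.* h)) (trans (cong (n′ ℕ.*_) (ℕ.*-comm h (n′ ℕ.* h)))
          (sym (ℕ.*-assoc n′ (n′ ℕ.* h) h)))))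
      m∣nn)
    m′∣h : m′ ∣ h
    m′∣h = Coprime.coprime-divisor m′⊥n′ (Coprime.coprime-divisor m′⊥n′ m′∣n′n′h)
    m≡h : m ≡ h
    m≡h = trans m≡m′h (trans (cong (ℕ._* h) (sf m′ (subst (m′ ℕ.* m′ ∣_) (sym m≡m′h) (ℕ.*-monoʳ-∣ m′ m′∣h))))
      (ℕ.*-identityˡ h))

-- (ny)² = n·(ny²) is an integer divisible by n.
square-numerator : ∀ n y → IsInt (ι (+ n) ℚ.* (y ℚ.* y)) → ∃[ M ] (ι (+ n) ℚ.* y ≡ ι M × n ∣ ℤ.∣ M ∣ ℕ.* ℤ.∣ M ∣)
square-numerator n y (l , nyy≡l) =
  let M , ny≡M = square-isInt⇒isInt (ι (+ n) ℚ.* y) (+ n ℤ.* l , square)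
      MM≡nl : M ℤ.* M ≡ + n ℤ.* l
      MM≡nl = ι-injective {M ℤ.* M} {+ n ℤ.* l} (trans (ι-* M M) (trans (cong₂ ℚ._*_ (sym ny≡M) (sym ny≡M)) square))
  in M , ny≡M , divides ℤ.∣ l ∣
       (trans (sym (ℤ.abs-* M M)) (trans (cong ℤ.∣_∣ MM≡nl) (trans (ℤ.abs-* (+ n) l) (ℕ.*-comm n ℤ.∣ l ∣))))
  where
  square : ι (+ n) ℚ.* y ℚ.* (ι (+ n) ℚ.* y) ≡ ι (+ n ℤ.* l)
  square = trans (solve 2 (λ n y → n :* y :* (n :* y) := n :* (n :* (y :* y))) refl (ι (+ n)) y)
    (trans (cong (ι (+ n) ℚ.*_) nyy≡l) (sym (ι-* (+ n) l)))

divide-isInt : ∀ n .{{_ : NonZero n}} y M → ι (+ n) ℚ.* y ≡ ι M → n ∣ ℤ.∣ M ∣ → ∃[ S ] (y ≡ ι S × M ≡ S ℤ.* + n)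
divide-isInt n y M ny≡M n∣M with ℤ.∣ᵤ⇒∣ {+ n} {M} n∣M
... | ℤ.divides S M≡Sn = S ,
  *-cancelˡ-pos (ι (+ n)) (0<ι n) (trans ny≡M (trans (cong ι M≡Sn)
    (trans (ι-* S (+ n)) (ℚ.*-comm (ι S) (ι (+ n)))))) , M≡Sn

squareFree-coefficient : ∀ n .{{_ : NonZero n}} y → SquareFree n → IsInt (ι (+ n) ℚ.* (y ℚ.* y)) → IsInt y
squareFree-coefficient n y sf h =
  let M , ny≡M , n∣MM = square-numerator n y h
      S , y≡S , _ = divide-isInt n y M ny≡M (squareFree-∣ sf n∣MM)
  in S , y≡S

module _ (p q : ℕ) .{{_ : NonZero p}} .{{_ : NonZero q}} (sfp : SquareFree p) (sfq : SquareFree q) where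

  private
    g = gcd p q

  -- The integer M = pqy has pq ∣ M². By square-freeness p and q both divide M, hence so does their
  -- least common multiple pq/g.
  product-coefficient : ∀ y → IsInt (ι (+ (p ℕ.* q)) ℚ.* (y ℚ.* y)) → IsInt (ι (+ g) ℚ.* y)
  product-coefficient y h = cofactors (ℕ.gcd[m,n]∣m p q) (ℕ.gcd[m,n]∣n p q)
    where
    sqn = square-numerator (p ℕ.* q) y h
    M = proj₁ sqn
    pq∣MM = proj₂ (proj₂ sqn)
    p∣M : p ∣ ℤ.∣ M ∣
    p∣M = squareFree-∣ sfp (ℕ.∣-trans (ℕ.m∣m*n q) pq∣MM)
    q∣M : q ∣ ℤ.∣ M ∣
    q∣M = squareFree-∣ sfq (ℕ.∣-trans (ℕ.n∣m*n p) pq∣MM)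
    dv = divide-isInt p (ι (+ q) ℚ.* y) M
      (trans (sym (trans (cong (ℚ._* y) (ι-*ℕ p q)) (ℚ.*-assoc (ι (+ p)) (ι (+ q)) y))) (proj₁ (proj₂ sqn))) p∣M
    S = proj₁ dv
    cofactors : g ∣ p → g ∣ q → IsInt (ι (+ g) ℚ.* y)
    cofactors (divides p′ p≡p′g) (divides q′ q≡q′g) =
      let T , gy≡T , _ = divide-isInt q′ {{q′≢0}} (ι (+ g) ℚ.* y) S
            (trans (sym (ℚ.*-assoc (ι (+ q′)) (ι (+ g)) y))
              (trans (cong (ℚ._* y) (trans (sym (ι-*ℕ q′ g)) (cong (λ n → ι (+ n)) (sym q≡q′g)))) (proj₁ (proj₂ dv))))
            q′∣S
      in T , gy≡T
      where
      q′≢0 : NonZero q′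
      q′≢0 = ℕ.≢-nonZero (λ { refl → ℕ.≢-nonZero⁻¹ q q≡q′g })
      q′∣S : q′ ∣ ℤ.∣ S ∣
      q′∣S = Coprime.coprime-divisor {n = p′} (Coprime.sym (coprime-cofactors {p} {q} p≡p′g q≡q′g))
        (subst (q′ ∣_) (ℕ.*-comm ℤ.∣ S ∣ p′) (ℕ.*-cancelʳ-∣ g {{gcd-nonZero p q}} (subst₂ _∣_ q≡q′g
          (trans (cong ℤ.∣_∣ (proj₂ (proj₂ dv))) (trans (ℤ.abs-* S (+ p))
            (trans (cong (ℤ.∣ S ∣ ℕ.*_) p≡p′g) (sym (ℕ.*-assoc ℤ.∣ S ∣ p′ g)))))
          q∣M)))

module _ {p q : ℕ} where

  fromℚᴷ : ℚ → K p q
  fromℚᴷ a = a +√p 0ℚ +√q 0ℚ +√pq 0ℚ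

  pow-fromℚᴷ : ∀ a k → pow (fromℚᴷ a) k ≡ fromℚᴷ (a ^ℚ k)
  pow-fromℚᴷ a zero    = refl
  pow-fromℚᴷ a (suc k) = trans (cong (fromℚᴷ a *ᴷ_) (pow-fromℚᴷ a k)) (K-≡
    (solve 4 (law c₁) refl (ι (+ p)) (ι (+ q)) a (a ^ℚ k))
    (solve 4 (law c₂) refl (ι (+ p)) (ι (+ q)) a (a ^ℚ k))
    (solve 4 (law c₃) refl (ι (+ p)) (ι (+ q)) a (a ^ℚ k))
    (solve 4 (law c₄) refl (ι (+ p)) (ι (+ q)) a (a ^ℚ k)))
    where
    law = λ (π : Kᵖ → Polynomial 4) P Q a b →
      π (mulᵖ P Q ⟨ a , con 0ℚ , con 0ℚ , con 0ℚ ⟩ ⟨ b , con 0ℚ , con 0ℚ , con 0ℚ ⟩)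
      := π ⟨ a :* b , con 0ℚ , con 0ℚ , con 0ℚ ⟩

  rational-almostIntegral : ∀ {x : K p q} {a} → x ≡ fromℚᴷ a → AlmostIntegral x → IsInt a
  rational-almostIntegral {a = a} refl (almostIntegral N h) = bounded-denominators⇒isInt a N λ k →
    Lattice.re∈ℤ (subst (λ y → Lattice (ι (+ N) ∙ y)) (pow-fromℚᴷ a k) (h k))

  module _ {a b c d : ℚ} (β∈ : AlmostIntegral {p} {q} (a +√p b +√q c +√pq d)) where

    private
      P Q : ℚ
      P = ι (+ p)
      Q = ι (+ q)
      β : K p q
      β = a +√p b +√q c +√pq d
      σβ∈ = almostIntegral-σ β∈
      τβ∈ = almostIntegral-τ β∈

    four-re : IsInt (four ℚ.* a)
    four-re = rational-almostIntegral (K-≡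
      (solve 1 (λ a → a :+ a :+ (a :+ a) := con four :* a) refl a)
      (solve 1 (λ b → b :+ :- b :+ (b :+ :- b) := con 0ℚ) refl b)
      (solve 1 (λ c → c :+ c :+ :- (c :+ c) := con 0ℚ) refl c)
      (solve 1 (λ d → d :+ :- d :+ :- (d :+ :- d) := con 0ℚ) refl d))
      (almostIntegral-+ (almostIntegral-+ β∈ σβ∈) (almostIntegral-τ (almostIntegral-+ β∈ σβ∈)))

    -- β + σβ = 2(a + c√q) is the relative trace to ℚ(√q), and this is its norm to ℚ. The next two
    -- lemmas do the same for the subfields of √p and of √p√q.
    norm-√q : IsInt (four ℚ.* (a ℚ.* a ℚ.- Q ℚ.* (c ℚ.* c)))
    norm-√q = rational-almostIntegral (K-≡
      (solve 6 (law c₁) refl P Q a b c d) (solve 6 (law c₂) refl P Q a b c d)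
      (solve 6 (law c₃) refl P Q a b c d) (solve 6 (law c₄) refl P Q a b c d))
      (almostIntegral-* (almostIntegral-+ β∈ σβ∈) (almostIntegral-τ (almostIntegral-+ β∈ σβ∈)))
      where
      law = λ (π : Kᵖ → Polynomial 6) P Q a b c d →
        let β = ⟨ a , b , c , d ⟩ ; γ = addᵖ β (σᵖ β) in
        π (mulᵖ P Q γ (τᵖ γ)) := π ⟨ con four :* (a :* a :- Q :* (c :* c)) , con 0ℚ , con 0ℚ , con 0ℚ ⟩

    norm-√p : IsInt (four ℚ.* (a ℚ.* a ℚ.- P ℚ.* (b ℚ.* b)))
    norm-√p = rational-almostIntegral (K-≡
      (solve 6 (law c₁) refl P Q a b c d) (solve 6 (law c₂) refl P Q a b c d)
      (solve 6 (law c₃) refl P Q a b c d) (solve 6 (law c₄) refl P Q a b c d))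
      (almostIntegral-* (almostIntegral-+ β∈ τβ∈) (almostIntegral-σ (almostIntegral-+ β∈ τβ∈)))
      where
      law = λ (π : Kᵖ → Polynomial 6) P Q a b c d →
        let β = ⟨ a , b , c , d ⟩ ; γ = addᵖ β (τᵖ β) in
        π (mulᵖ P Q γ (σᵖ γ)) := π ⟨ con four :* (a :* a :- P :* (b :* b)) , con 0ℚ , con 0ℚ , con 0ℚ ⟩

    norm-√pq : IsInt (four ℚ.* (a ℚ.* a ℚ.- P ℚ.* Q ℚ.* (d ℚ.* d)))
    norm-√pq = rational-almostIntegral (K-≡
      (solve 6 (law c₁) refl P Q a b c d) (solve 6 (law c₂) refl P Q a b c d)
      (solve 6 (law c₃) refl P Q a b c d) (solve 6 (law c₄) refl P Q a b c d))
      (almostIntegral-* (almostIntegral-+ β∈ (almostIntegral-σ τβ∈))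
        (almostIntegral-σ (almostIntegral-+ β∈ (almostIntegral-σ τβ∈))))
      where
      law = λ (π : Kᵖ → Polynomial 6) P Q a b c d →
        let β = ⟨ a , b , c , d ⟩ ; γ = addᵖ β (σᵖ (τᵖ β)) in
        π (mulᵖ P Q γ (σᵖ γ)) := π ⟨ con four :* (a :* a :- P :* Q :* (d :* d)) , con 0ℚ , con 0ℚ , con 0ℚ ⟩

    -- The trace eliminates a from the norm: (4a)² - 4·4(a² - pqd²) = pq(4d)².
    √pq-coefficient : .{{_ : NonZero p}} .{{_ : NonZero q}} → SquareFree p → SquareFree q →
                      IsInt (ι (+ gcd p q) ℚ.* (four ℚ.* d))
    √pq-coefficient sfp sfq = product-coefficient p q sfp sfq (four ℚ.* d) (subst IsInt
      (trans
        (solve 4 (λ a d P Q → (con four :* a) :* (con four :* a)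
            :- con four :* (con four :* (a :* a :- P :* Q :* (d :* d)))
          := P :* Q :* ((con four :* d) :* (con four :* d))) refl a d P Q)
        (cong (ℚ._* (four ℚ.* d ℚ.* (four ℚ.* d))) (sym (ι-*ℕ p q))))
      (isInt-+ {four ℚ.* a ℚ.* (four ℚ.* a)} (isInt-* {four ℚ.* a} {four ℚ.* a} four-re four-re)
        (isInt-neg {four ℚ.* norm} (isInt-* {four} {norm} (isInt-ι (+ 4)) norm-√pq))))
      where norm = four ℚ.* (a ℚ.* a ℚ.- P ℚ.* Q ℚ.* (d ℚ.* d))

  -- The trace to ℚ of the relative norm βσβ = (a + c√q)² - pb².
  trace-norm : ∀ {a b c} → AlmostIntegral {p} {q} (a +√p b +√q c +√pq 0ℚ) →
    IsInt (two ℚ.* (a ℚ.* a ℚ.+ ι (+ q) ℚ.* (c ℚ.* c) ℚ.- ι (+ p) ℚ.* (b ℚ.* b)))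
  trace-norm {a} {b} {c} β∈ = rational-almostIntegral (K-≡
    (solve 5 (law c₁) refl (ι (+ p)) (ι (+ q)) a b c) (solve 5 (law c₂) refl (ι (+ p)) (ι (+ q)) a b c)
    (solve 5 (law c₃) refl (ι (+ p)) (ι (+ q)) a b c) (solve 5 (law c₄) refl (ι (+ p)) (ι (+ q)) a b c))
    (almostIntegral-+ N∈ (almostIntegral-τ N∈))
    where
    N∈ = almostIntegral-* β∈ (almostIntegral-σ β∈)
    law = λ (π : Kᵖ → Polynomial 5) P Q a b c →
      let β = ⟨ a , b , c , con 0ℚ ⟩ ; N = mulᵖ P Q β (σᵖ β) in
      π (addᵖ N (τᵖ N)) := π ⟨ con two :* (a :* a :+ Q :* (c :* c) :- P :* (b :* b)) , con 0ℚ , con 0ℚ , con 0ℚ ⟩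

  -- Trace and `norm-√p` alone give only 4b ∈ ℤ. With d = 0 the combination `norm-√q` + 2
  -- `trace-norm` - 2 `norm-√p` cancels a² and c² and leaves p(2b)².
  √p-coefficient : ∀ {a b c} .{{_ : NonZero p}} → SquareFree p →
    AlmostIntegral {p} {q} (a +√p b +√q c +√pq 0ℚ) → IsInt (two ℚ.* b)
  √p-coefficient {a} {b} {c} sfp β∈ = squareFree-coefficient p (two ℚ.* b) sfp (subst IsInt
    (solve 5 (λ P Q a b c →
        con four :* (a :* a :- Q :* (c :* c))
        :+ con two :* (con two :* (a :* a :+ Q :* (c :* c) :- P :* (b :* b)))
        :+ con (ℚ.- two) :* (con four :* (a :* a :- P :* (b :* b)))
      := P :* ((con two :* b) :* (con two :* b))) refl P Q a b c)
    (isInt-+ {n ℚ.+ two ℚ.* t} {ℚ.- two ℚ.* n′}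
      (isInt-+ {n} {two ℚ.* t} (norm-√q β∈) (isInt-* {two} {t} (isInt-ι (+ 2)) (trace-norm β∈)))
      (isInt-* {ℚ.- two} {n′} (isInt-ι (ℤ.- (+ 2))) (norm-√p β∈))))
    where
    P = ι (+ p)
    Q = ι (+ q)
    n = four ℚ.* (a ℚ.* a ℚ.- Q ℚ.* (c ℚ.* c))
    n′ = four ℚ.* (a ℚ.* a ℚ.- P ℚ.* (b ℚ.* b))
    t = two ℚ.* (a ℚ.* a ℚ.+ Q ℚ.* (c ℚ.* c) ℚ.- P ℚ.* (b ℚ.* b))

-- Sums of squares

ι-square : ∀ n → ι (+ (ℤ.∣ n ∣ ℕ.* ℤ.∣ n ∣)) ≡ ι n ℚ.* ι n
ι-square n = trans (cong ι (square n)) (ι-* n n)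
  where
  square : ∀ n → + (ℤ.∣ n ∣ ℕ.* ℤ.∣ n ∣) ≡ n ℤ.* n
  square (+ n)      = ℤ.pos-* n n
  square ℤ.-[1+ n ] = refl

1≤ι-square : ∀ n → n ≢ + 0 → 1ℚ ℚ.≤ ι n ℚ.* ι n
1≤ι-square n n≢0 = subst (1ℚ ℚ.≤_) (ι-square n)
  (ι-mono-≤ {+ 1} {+ (ℤ.∣ n ∣ ℕ.* ℤ.∣ n ∣)} (ℤ.+≤+ (positive n n≢0)))
  where
  positive : ∀ n → n ≢ + 0 → 1 ℕ.≤ ℤ.∣ n ∣ ℕ.* ℤ.∣ n ∣
  positive (+ zero)   n≢0 = contradiction refl n≢0
  positive (+ suc n)  _   = ℕ.s≤s ℕ.z≤n
  positive ℤ.-[1+ n ] _   = ℕ.s≤s ℕ.z≤n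

≤-+-nonNegʳ : ∀ x {y} → 0ℚ ℚ.≤ y → x ℚ.≤ x ℚ.+ y
≤-+-nonNegʳ x {y} 0≤y = subst (ℚ._≤ x ℚ.+ y) (ℚ.+-identityʳ x) (ℚ.+-monoʳ-≤ x 0≤y)

≤-+-nonNegˡ : ∀ x {y} → 0ℚ ℚ.≤ y → x ℚ.≤ y ℚ.+ x
≤-+-nonNegˡ x {y} 0≤y = subst (x ℚ.≤_) (ℚ.+-comm x y) (≤-+-nonNegʳ x 0≤y)

-- For the integer n = 4Gd one has 16Nd² = Rn², which is at least R unless n = 0.
small⇒0 : ∀ {R G N d} → 0ℚ ℚ.≤ R → 0ℚ ℚ.< G → R ℚ.* (G ℚ.* G) ≡ N → IsInt (G ℚ.* (four ℚ.* d)) →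
          sixteen ℚ.* (N ℚ.* (d ℚ.* d)) ℚ.< R → d ≡ 0ℚ
small⇒0 {R} {G} {_} {d} 0≤R 0<G refl (n , G4d≡n) small = conclude (n ℤ.≟ + 0)
  where
  part≡Rnn : sixteen ℚ.* (R ℚ.* (G ℚ.* G) ℚ.* (d ℚ.* d)) ≡ R ℚ.* (ι n ℚ.* ι n)
  part≡Rnn = trans
    (solve 3 (λ R G d → con sixteen :* (R :* (G :* G) :* (d :* d))
        := R :* ((G :* (con four :* d)) :* (G :* (con four :* d)))) refl R G d)
    (cong (λ y → R ℚ.* (y ℚ.* y)) G4d≡n)
  conclude : Dec (n ≡ + 0) → d ≡ 0ℚ
  conclude (yes n≡0) = *-cancelˡ-pos four {d} {0ℚ} (0<ι 4)
    (*-cancelˡ-pos G {four ℚ.* d} {four ℚ.* 0ℚ} 0<G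
      (trans G4d≡n (trans (cong ι n≡0) (sym (ℚ.*-zeroʳ G)))))
  conclude (no n≢0) = contradiction
    (ℚ.<-≤-trans (subst (ℚ._< R) part≡Rnn small)
      (subst (ℚ._≤ R ℚ.* (ι n ℚ.* ι n)) (ℚ.*-identityʳ R)
        (ℚ.*-monoˡ-≤-nonNeg R {{ℚ.nonNegative 0≤R}} {1ℚ} {ι n ℚ.* ι n} (1≤ι-square n n≢0))))
    (ℚ.<-irrefl {R ℚ.* (ι n ℚ.* ι n)} refl)

summary-base : ∀ P l → 0ℚ ℚ.≤ four ℚ.* 0ℚ ℚ.- four ℚ.* l ℚ.* 0ℚ ℚ.- P ℚ.* 0ℚ ℚ.+ l ℚ.* l ℚ.* 0ℚ
summary-base P l = ℚ.≤-reflexive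
  (solve 2 (λ l P → con 0ℚ := con four :* con 0ℚ :- con four :* l :* con 0ℚ :- P :* con 0ℚ :+ l :* l :* con 0ℚ)
    refl l P)

-- With B = Σ (2b)², each square contributes 4 (a − l b)² + 4 q c².
summary-step : ∀ P Q a b c l re co B re′ co′ B′ → 0ℚ ℚ.≤ Q →
  re′ ≡ a ℚ.* a ℚ.+ P ℚ.* (b ℚ.* b) ℚ.+ Q ℚ.* (c ℚ.* c) ℚ.+ P ℚ.* Q ℚ.* (0ℚ ℚ.* 0ℚ) ℚ.+ re →
  co′ ≡ a ℚ.* b ℚ.+ b ℚ.* a ℚ.+ Q ℚ.* (c ℚ.* 0ℚ ℚ.+ 0ℚ ℚ.* c) ℚ.+ co →
  B′ ≡ (two ℚ.* b) ℚ.* (two ℚ.* b) ℚ.+ B →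
  0ℚ ℚ.≤ four ℚ.* re ℚ.- four ℚ.* l ℚ.* co ℚ.- P ℚ.* B ℚ.+ l ℚ.* l ℚ.* B →
  0ℚ ℚ.≤ four ℚ.* re′ ℚ.- four ℚ.* l ℚ.* co′ ℚ.- P ℚ.* B′ ℚ.+ l ℚ.* l ℚ.* B′
summary-step P Q a b c l re co B _ _ _ 0≤Q refl refl refl h = subst (0ℚ ℚ.≤_)
  (solve 9 (λ P Q a b c l re co B →
      con four :* ((a :- l :* b) :* (a :- l :* b) :+ Q :* (c :* c))
      :+ (con four :* re :- con four :* l :* co :- P :* B :+ l :* l :* B)
    := con four :* (a :* a :+ P :* (b :* b) :+ Q :* (c :* c) :+ P :* Q :* (con 0ℚ :* con 0ℚ) :+ re)
       :- con four :* l :* (a :* b :+ b :* a :+ Q :* (c :* con 0ℚ :+ con 0ℚ :* c) :+ co)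
       :- P :* ((con two :* b) :* (con two :* b) :+ B) :+ l :* l :* ((con two :* b) :* (con two :* b) :+ B))
    refl P Q a b c l re co B)
  (0≤-+ {four ℚ.* ((a ℚ.- l ℚ.* b) ℚ.* (a ℚ.- l ℚ.* b) ℚ.+ Q ℚ.* (c ℚ.* c))}
    {four ℚ.* re ℚ.- four ℚ.* l ℚ.* co ℚ.- P ℚ.* B ℚ.+ l ℚ.* l ℚ.* B}
    (0≤-* {four} {(a ℚ.- l ℚ.* b) ℚ.* (a ℚ.- l ℚ.* b) ℚ.+ Q ℚ.* (c ℚ.* c)} (0≤ι 4)
      (0≤-+ {(a ℚ.- l ℚ.* b) ℚ.* (a ℚ.- l ℚ.* b)} {Q ℚ.* (c ℚ.* c)} (0≤square (a ℚ.- l ℚ.* b))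
        (0≤-* {Q} {c ℚ.* c} 0≤Q (0≤square c))))
    h)

module _ {p q : ℕ} where

  private
    P Q : ℚ
    P = ι (+ p)
    Q = ι (+ q)

    weight : ∀ n x → 0ℚ ℚ.≤ ι (+ n) ℚ.* (x ℚ.* x)
    weight n x = 0≤-* {ι (+ n)} {x ℚ.* x} (0≤ι n) (0≤square x)

    weight′ : ∀ x → 0ℚ ℚ.≤ P ℚ.* Q ℚ.* (x ℚ.* x)
    weight′ x = 0≤-* {P ℚ.* Q} {x ℚ.* x} (0≤-* {P} {Q} (0≤ι p) (0≤ι q)) (0≤square x)

    0≤head : ∀ a b c → 0ℚ ℚ.≤ a ℚ.* a ℚ.+ P ℚ.* (b ℚ.* b) ℚ.+ Q ℚ.* (c ℚ.* c)
    0≤head a b c = 0≤-+ {a ℚ.* a ℚ.+ P ℚ.* (b ℚ.* b)} {Q ℚ.* (c ℚ.* c)}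
      (0≤-+ {a ℚ.* a} {P ℚ.* (b ℚ.* b)} (0≤square a) (weight p b)) (weight q c)

  0≤re-square : ∀ (x : K p q) → 0ℚ ℚ.≤ K.re (x *ᴷ x)
  0≤re-square (a +√p b +√q c +√pq d) = 0≤-+ {a ℚ.* a ℚ.+ P ℚ.* (b ℚ.* b) ℚ.+ Q ℚ.* (c ℚ.* c)} {P ℚ.* Q ℚ.* (d ℚ.* d)}
    (0≤head a b c) (weight′ d)

  0≤re-sumOfSquares : ∀ (xs : List (K p q)) → 0ℚ ℚ.≤ K.re (sumOfSquares xs)
  0≤re-sumOfSquares []       = ℚ.≤-refl
  0≤re-sumOfSquares (x ∷ xs) = 0≤-+ {K.re (x *ᴷ x)} {K.re (sumOfSquares xs)} (0≤re-square x) (0≤re-sumOfSquares xs)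

  √pq-part : K p q → ℚ
  √pq-part x = P ℚ.* Q ℚ.* (K.coeff-√pq x ℚ.* K.coeff-√pq x)

  √pq-part≤re : ∀ (xs : List (K p q)) → All (λ x → √pq-part x ℚ.≤ K.re (sumOfSquares xs)) xs
  √pq-part≤re []       = []
  √pq-part≤re (x@(a +√p b +√q c +√pq d) ∷ xs) =
    ℚ.≤-trans {√pq-part x} {K.re (x *ᴷ x)} {K.re (x *ᴷ x) ℚ.+ K.re (sumOfSquares xs)}
      (≤-+-nonNegˡ (√pq-part x) {a ℚ.* a ℚ.+ P ℚ.* (b ℚ.* b) ℚ.+ Q ℚ.* (c ℚ.* c)} (0≤head a b c))
      (≤-+-nonNegʳ (K.re (x *ᴷ x)) {K.re (sumOfSquares xs)} (0≤re-sumOfSquares xs))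
    ∷ All.map (λ {y} h → ℚ.≤-trans {√pq-part y} {K.re (sumOfSquares xs)} {K.re (x *ᴷ x) ℚ.+ K.re (sumOfSquares xs)} h
        (≤-+-nonNegˡ (K.re (sumOfSquares xs)) {K.re (x *ᴷ x)} (0≤re-square x)))
      (√pq-part≤re xs)

  module _ .{{_ : NonZero p}} .{{_ : NonZero q}} (sfp : SquareFree p) (sfq : SquareFree q) where

    √pq-part-bound : ∀ r → r ℕ.* (gcd p q ℕ.* gcd p q) ≡ p ℕ.* q → ∀ {x} → AlmostIntegral x →
      sixteen ℚ.* √pq-part x ℚ.< ι (+ r) → K.coeff-√pq x ≡ 0ℚ
    √pq-part-bound r rgg≡pq {a +√p b +√q c +√pq d} x∈ =
      small⇒0 (0≤ι r) (0<ι g {{gcd-nonZero p q}})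
        (trans (sym (ι-*ℕ³ r g)) (trans (cong (λ k → ι (+ k)) rgg≡pq) (ι-*ℕ p q)))
        (√pq-coefficient x∈ sfp sfq)
      where
      g = gcd p q

  -- For s = Σ βᵢ² with all dᵢ = 0 and B = Σ (2bᵢ)² the form is 4 Σ (aᵢ - l bᵢ)² + 4q Σ cᵢ². Keeping
  -- l free makes the condition additive along the list; choosing l afterwards yields the
  -- Cauchy-Schwarz inequality.
  Summary : K p q → ℕ → Set
  Summary s B = ∀ l → 0ℚ ℚ.≤ four ℚ.* K.re s ℚ.- four ℚ.* l ℚ.* K.coeff-√p s
                              ℚ.- P ℚ.* ι (+ B) ℚ.+ l ℚ.* l ℚ.* ι (+ B)

  summary-cons : ∀ a b c {d} (xs : List (K p q)) B → d ≡ 0ℚ → IsInt (two ℚ.* b) → Summary (sumOfSquares xs) B →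
    ∃[ B′ ] Summary (sumOfSquares ((a +√p b +√q c +√pq d) ∷ xs)) B′
  summary-cons a b c xs B refl (n , 2b≡n) h = ℤ.∣ n ∣ ℕ.* ℤ.∣ n ∣ ℕ.+ B , λ l →
      summary-step P Q a b c l (K.re S) (K.coeff-√p S) (ι (+ B)) (K.re S′) (K.coeff-√p S′)
        (ι (+ (ℤ.∣ n ∣ ℕ.* ℤ.∣ n ∣ ℕ.+ B))) (0≤ι q) refl refl
        (trans (ι-+ℕ (ℤ.∣ n ∣ ℕ.* ℤ.∣ n ∣) B)
          (cong (ℚ._+ ι (+ B)) (trans (ι-square n) (sym (cong₂ ℚ._*_ 2b≡n 2b≡n)))))
        (h l)
    where
    S = sumOfSquares xs
    S′ = sumOfSquares ((a +√p b +√q c +√pq 0ℚ) ∷ xs)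

  summary : .{{_ : NonZero p}} → SquareFree p → ∀ {xs : List (K p q)} →
    All AlmostIntegral xs → All (λ x → K.coeff-√pq x ≡ 0ℚ) xs → ∃[ B ] Summary (sumOfSquares xs) B
  summary sfp [] [] = 0 , λ l → summary-base P l
  summary sfp {(a +√p b +√q c +√pq _) ∷ xs} (x∈ ∷ xs∈) (d≡0 ∷ ds≡0) =
    let B , h = summary sfp xs∈ ds≡0 in
    summary-cons a b c xs B d≡0
      (√p-coefficient {p} {q} {a} {b} {c} sfp (subst (λ d → AlmostIntegral (a +√p b +√q c +√pq d)) d≡0 x∈)) h

-- Rounding κ√p within a parity class

crossing : ∀ (f : ℕ → ℕ) X n → f 0 ℕ.≤ X → X ℕ.< f n → ∃[ j ] (f j ℕ.≤ X × X ℕ.< f (suc j))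
crossing f X zero    f0≤X X<f0 = contradiction X<f0 (ℕ.≤⇒≯ f0≤X)
crossing f X (suc n) f0≤X X<fn with ℕ.<-≤-connex X (f n)
... | inj₁ X<fn′ = crossing f X n f0≤X X<fn′
... | inj₂ fn≤X  = n , fn≤X , X<fn

ratio-square : ∀ w k p → 0ℚ ℚ.< k → w ℚ.* w ≡ k ℚ.* k ℚ.* p → (w ℚ.* inv k) ℚ.* (w ℚ.* inv k) ≡ p
ratio-square w k p 0<k ww≡kkp = trans
  (solve 2 (λ w i → w :* i :* (w :* i) := w :* w :* (i :* i)) refl w (inv k))
  (trans (cong (ℚ._* (inv k ℚ.* inv k)) ww≡kkp)
  (trans (solve 3 (λ k p i → k :* k :* p :* (i :* i) := (k :* i) :* (k :* i) :* p) refl k p (inv k))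
  (trans (cong (λ o → o ℚ.* o ℚ.* p) (inv-inverseʳ k 0<k)) (ℚ.*-identityˡ p))))

integral-square : ∀ y p → IsInt y → y ℚ.* y ≡ ι (+ p) → ∃[ n ] n ℕ.* n ≡ p
integral-square _ p (n , refl) nn≡p =
  ℤ.∣ n ∣ , ℤ.+-injective (ι-injective {+ (ℤ.∣ n ∣ ℕ.* ℤ.∣ n ∣)} {+ p} (trans (ι-square n) nn≡p))

-- Otherwise w/κ has the integral square p, so p = n² for an integer n; square-freeness forces n =
-- 1, against p ≥ 2.
squareFree⇒≢square : ∀ p κ w .{{_ : NonZero κ}} → 2 ℕ.≤ p → SquareFree p → w ℕ.* w ≢ κ ℕ.* κ ℕ.* p
squareFree⇒≢square p κ w 2≤p sfp w²≡κ²p = absurd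
  (integral-square y p (square-isInt⇒isInt y (+ p , yy≡p)) yy≡p)
  where
  y = ι (+ w) ℚ.* inv (ι (+ κ))
  yy≡p : y ℚ.* y ≡ ι (+ p)
  yy≡p = ratio-square (ι (+ w)) (ι (+ κ)) (ι (+ p)) (0<ι κ)
    (trans (sym (ι-*ℕ w w)) (trans (cong (λ n → ι (+ n)) w²≡κ²p)
      (trans (ι-*ℕ (κ ℕ.* κ) p) (cong (ℚ._* ι (+ p)) (ι-*ℕ κ κ)))))
  absurd : ¬ (∃[ n ] n ℕ.* n ≡ p)
  absurd (n , nn≡p) = contradiction
    (trans (sym nn≡p) (cong (λ k → k ℕ.* k) (sfp n (ℕ.∣-reflexive nn≡p))))
    (λ { refl → contradiction 2≤p (ℕ.<⇒≱ (ℕ.s≤s (ℕ.s≤s ℕ.z≤n))) })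

-- w runs through κ, κ + 2, κ + 4, ..., starting with κ² ≤ κ²p, until the next square exceeds κ²p.
-- The step 2 keeps the parity of κ.
approximation : ∀ p κ .{{_ : NonZero κ}} → 2 ℕ.≤ p → SquareFree p →
  ∃[ j ] let w = κ ℕ.+ 2 ℕ.* j in
    w ℕ.* w ℕ.< κ ℕ.* κ ℕ.* p × κ ℕ.* κ ℕ.* p ℕ.< (w ℕ.+ 2) ℕ.* (w ℕ.+ 2)
approximation p κ 2≤p sfp =
  let j , ≤X , X< = crossing f X X f0≤X X<fX in
  j , ℕ.≤∧≢⇒< ≤X (squareFree⇒≢square p κ (κ ℕ.+ 2 ℕ.* j) 2≤p sfp) ,
  subst (λ w → X ℕ.< w ℕ.* w) (trans (cong (κ ℕ.+_) (trans (ℕ.*-suc 2 j) (ℕ.+-comm 2 (2 ℕ.* j))))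
    (sym (ℕ.+-assoc κ (2 ℕ.* j) 2))) X<
  where
  X = κ ℕ.* κ ℕ.* p
  f : ℕ → ℕ
  f j = (κ ℕ.+ 2 ℕ.* j) ℕ.* (κ ℕ.+ 2 ℕ.* j)
  f0≤X : f 0 ℕ.≤ X
  f0≤X = ℕ.≤-trans (ℕ.≤-reflexive (cong (λ k → k ℕ.* k) (ℕ.+-identityʳ κ)))
    (ℕ.m≤m*n (κ ℕ.* κ) p {{ℕ.>-nonZero (ℕ.≤-trans (ℕ.s≤s ℕ.z≤n) 2≤p)}})
  X<fX : X ℕ.< f X
  X<fX = ℕ.<-≤-trans (ℕ.+-mono-<-≤ (ℕ.>-nonZero⁻¹ κ) (ℕ.m≤m+n X (X ℕ.+ 0)))
    (ℕ.m≤m*n (κ ℕ.+ 2 ℕ.* X) (κ ℕ.+ 2 ℕ.* X)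
      {{ℕ.>-nonZero (ℕ.<-≤-trans (ℕ.>-nonZero⁻¹ κ) (ℕ.m≤m+n κ (2 ℕ.* X)))}})

-- The totally positive integer α

inv≤ : ∀ E v → 0ℚ ℚ.< E → 1ℚ ℚ.≤ E ℚ.* v → inv E ℚ.≤ v
inv≤ E v 0<E 1≤Ev = ℚ.*-cancelˡ-≤-pos E {{ℚ.positive 0<E}}
  (subst (ℚ._≤ E ℚ.* v) (sym (inv-inverseʳ E 0<E)) 1≤Ev)

minimal-polynomial : ∀ P u k e → four ℚ.* e ≡ u ℚ.* u ℚ.- k ℚ.* k ℚ.* P →
  e ℚ.+ (½ ℚ.* u ℚ.* (ℚ.- u ℚ.+ ½ ℚ.* u) ℚ.+ P ℚ.* (½ ℚ.* k ℚ.* (½ ℚ.* k))) ≡ 0ℚ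
minimal-polynomial P u k e 4e = *-cancelˡ-pos four (0<ι 4) (trans
  (solve 4 (λ P u k e →
      con four :* (e :+ (con ½ :* u :* (:- u :+ con ½ :* u) :+ P :* (con ½ :* k :* (con ½ :* k))))
    := con four :* e :- (u :* u :- k :* k :* P)) refl P u k e)
  (trans (cong (ℚ._- (u ℚ.* u ℚ.- k ℚ.* k ℚ.* P)) 4e)
    (ℚ.+-inverseʳ (u ℚ.* u ℚ.- k ℚ.* k ℚ.* P))))

-- `Positive` asks for one rational below all late terms. From 2u(u - kx) = (u - kx)² + (u² - k²x²)
-- and u² - k²P ≥ 1 the bound 1/(4u) works for the smaller conjugate.
conjugate-bound : ∀ P u k x → 0ℚ ℚ.≤ k → 0ℚ ℚ.≤ x → x ℚ.* x ℚ.≤ P →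
  k ℚ.* k ℚ.* P ℚ.+ 1ℚ ℚ.≤ u ℚ.* u → 1ℚ ℚ.≤ four ℚ.* u ℚ.* (½ ℚ.* (u ℚ.- k ℚ.* x))
conjugate-bound P u k x 0≤k 0≤x xx≤P kkP<uu = 0≤⇒≤
  {1ℚ} {four ℚ.* u ℚ.* (½ ℚ.* (u ℚ.- k ℚ.* x))}
  (solve 4 (λ P u k x → (u :- k :* x) :* (u :- k :* x) :+ k :* k :* (P :- x :* x) :+ (u :* u :- (k :* k :* P :+ con 1ℚ))
    := con four :* u :* (con ½ :* (u :- k :* x)) :- con 1ℚ) refl P u k x)
  (0≤-+ {(u ℚ.- k ℚ.* x) ℚ.* (u ℚ.- k ℚ.* x) ℚ.+ k ℚ.* k ℚ.* (P ℚ.- x ℚ.* x)} {u ℚ.* u ℚ.- (k ℚ.* k ℚ.* P ℚ.+ 1ℚ)}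
    (0≤-+ {(u ℚ.- k ℚ.* x) ℚ.* (u ℚ.- k ℚ.* x)} {k ℚ.* k ℚ.* (P ℚ.- x ℚ.* x)} (0≤square (u ℚ.- k ℚ.* x))
      (0≤-* {k ℚ.* k} {P ℚ.- x ℚ.* x} (0≤square k) (≤⇒0≤ xx≤P)))
    (≤⇒0≤ kkP<uu))

module Element (p q κ u : ℕ) where

  private
    P Q k u′ : ℚ
    P = ι (+ p)
    Q = ι (+ q)
    k = ι (+ κ)
    u′ = ι (+ u)

  α : K p q
  α = (½ ℚ.* u′) +√p (½ ℚ.* k) +√q 0ℚ +√pq 0ℚ

  α-integral : ∀ e → four ℚ.* ι e ≡ u′ ℚ.* u′ ℚ.- k ℚ.* k ℚ.* P → 𝒪 p q α
  -- The polynomial X² - uX + e, with u the trace and e the norm of α over ℚ.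
  α-integral e 4e = e ∷ ℤ.- (+ u) ∷ [] , trans
    (cong (λ y → fromℤᴷ e +ᴷ α *ᴷ ((y +√p 0ℚ +√q 0ℚ +√pq 0ℚ) +ᴷ α *ᴷ 1ᴷ)) (ι-neg (+ u)))
    (K-≡
      (trans (solve 5 (law c₁) refl P Q u′ k (ι e)) (minimal-polynomial P u′ k (ι e) 4e))
      (solve 5 (law c₂) refl P Q u′ k (ι e))
      (solve 5 (law c₃) refl P Q u′ k (ι e))
      (solve 5 (law c₄) refl P Q u′ k (ι e)))
    where
    law = λ (π : Kᵖ → Polynomial 5) P Q u k e →
      let α = ⟨ con ½ :* u , con ½ :* k , con 0ℚ , con 0ℚ ⟩ in
      π (addᵖ ⟨ e , con 0ℚ , con 0ℚ , con 0ℚ ⟩ (mulᵖ P Q α (addᵖ ⟨ :- u , con 0ℚ , con 0ℚ , con 0ℚ ⟩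
          (mulᵖ P Q α ⟨ con 1ℚ , con 0ℚ , con 0ℚ , con 0ℚ ⟩))))
      := π ⟨ e :+ (con ½ :* u :* (:- u :+ con ½ :* u) :+ P :* (con ½ :* k :* (con ½ :* k))) , con 0ℚ , con 0ℚ , con 0ℚ ⟩

  module _ .{{_ : NonZero u}} (κ²p<u² : k ℚ.* k ℚ.* P ℚ.+ 1ℚ ℚ.≤ u′ ℚ.* u′) where

    private
      E : ℚ
      E = four ℚ.* u′
      0<E : 0ℚ ℚ.< E
      0<E = *-pos {four} {u′} (0<ι 4) (0<ι u)

      value : ℚ → ℚ → ℚ → ℚ
      value x y z = ½ ℚ.* u′ ℚ.+ ½ ℚ.* k ℚ.* x ℚ.+ 0ℚ ℚ.* y ℚ.+ 0ℚ ℚ.* z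

      1≤⁻ : ∀ n → 1ℚ ℚ.≤ E ℚ.* (½ ℚ.* (u′ ℚ.- k ℚ.* sqrtSeq p n))
      1≤⁻ n = conjugate-bound P u′ k (sqrtSeq p n) (0≤ι κ) (0≤sqrtSeq p n) (sqrtSeq-lower p n) κ²p<u²

      value⁻ : ∀ n y z → inv E ℚ.≤ value (ℚ.- sqrtSeq p n) y z
      value⁻ n y z = inv≤ E (value (ℚ.- sqrtSeq p n) y z) 0<E (subst (λ v → 1ℚ ℚ.≤ E ℚ.* v)
        (solve 5 (λ u k x y z → con ½ :* (u :- k :* x) :=
          con ½ :* u :+ con ½ :* k :* (:- x) :+ con 0ℚ :* y :+ con 0ℚ :* z) refl u′ k (sqrtSeq p n) y z)
        (1≤⁻ n))

      value⁺ : ∀ n y z → inv E ℚ.≤ value (sqrtSeq p n) y z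
      value⁺ n y z = inv≤ E (value (sqrtSeq p n) y z) 0<E
        (subst (1ℚ ℚ.≤_)
          (solve 6 (λ E u k x y z → E :* (con ½ :* (u :- k :* x)) :+ E :* (k :* x)
            := E :* (con ½ :* u :+ con ½ :* k :* x :+ con 0ℚ :* y :+ con 0ℚ :* z)) refl E u′ k (sqrtSeq p n) y z)
          (ℚ.≤-trans (1≤⁻ n)
            (≤-+-nonNegʳ (E ℚ.* (½ ℚ.* (u′ ℚ.- k ℚ.* sqrtSeq p n))) {E ℚ.* (k ℚ.* sqrtSeq p n)}
              (0≤-* {E} {k ℚ.* sqrtSeq p n} (ℚ.<⇒≤ 0<E) (0≤-* {k} {sqrtSeq p n} (0≤ι κ) (0≤sqrtSeq p n))))))

    α-positive : ∀ s s′ → Positive (embed s s′ α)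
    α-positive Sign.+ s′ = mkPositive (inv E) (inv-pos E 0<E) 0 λ n _ →
      value⁺ n (seq (signed s′ (√ q)) n) (sqrtSeq p n ℚ.* seq (signed s′ (√ q)) n)
    α-positive Sign.- s′ = mkPositive (inv E) (inv-pos E 0<E) 0 λ n _ →
      value⁻ n (seq (signed s′ (√ q)) n) (ℚ.- sqrtSeq p n ℚ.* seq (signed s′ (√ q)) n)

-- The multiple mα is not a sum of squares

scaled-re : ∀ M P Q u k →
  M ℚ.* (½ ℚ.* u) ℚ.+ P ℚ.* (0ℚ ℚ.* (½ ℚ.* k)) ℚ.+ Q ℚ.* (0ℚ ℚ.* 0ℚ) ℚ.+ P ℚ.* Q ℚ.* (0ℚ ℚ.* 0ℚ)
  ≡ ½ ℚ.* (M ℚ.* u)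
scaled-re = solve 5 (λ M P Q u k →
    M :* (con ½ :* u) :+ P :* (con 0ℚ :* (con ½ :* k)) :+ Q :* (con 0ℚ :* con 0ℚ)
      :+ P :* Q :* (con 0ℚ :* con 0ℚ)
  := con ½ :* (M :* u)) refl

scaled-√p : ∀ M Q u k →
  M ℚ.* (½ ℚ.* k) ℚ.+ 0ℚ ℚ.* (½ ℚ.* u) ℚ.+ Q ℚ.* (0ℚ ℚ.* 0ℚ ℚ.+ 0ℚ ℚ.* 0ℚ) ≡ ½ ℚ.* (M ℚ.* k)
scaled-√p = solve 4 (λ M Q u k →
    M :* (con ½ :* k) :+ con 0ℚ :* (con ½ :* u) :+ Q :* (con 0ℚ :* con 0ℚ :+ con 0ℚ :* con 0ℚ)
  := con ½ :* (M :* k)) refl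

-- The case B = 0, outside the reach of `excluded`. The form becomes 2M(u - lk), linear in l, and l
-- = u + 1 makes it negative because k ≥ 1.
no-summary : ∀ M k P u re co → 0ℚ ℚ.< M → 1ℚ ℚ.≤ k → 0ℚ ℚ.≤ u → re ≡ ½ ℚ.* (M ℚ.* u) → co ≡ ½ ℚ.* (M ℚ.* k) →
  ¬ (∀ l → 0ℚ ℚ.≤ four ℚ.* re ℚ.- four ℚ.* l ℚ.* co ℚ.- P ℚ.* 0ℚ ℚ.+ l ℚ.* l ℚ.* 0ℚ)
no-summary M k P u _ _ 0<M 1≤k 0≤u refl refl h = 0≤∧0<⇒≢- (h (u ℚ.+ 1ℚ))
  (*-pos {two ℚ.* M} {1ℚ ℚ.+ (u ℚ.+ 1ℚ) ℚ.* (k ℚ.- 1ℚ)} (*-pos {two} {M} (0<ι 2) 0<M)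
    (ℚ.<-≤-trans (ℚ.positive⁻¹ 1ℚ) (≤-+-nonNegʳ 1ℚ {(u ℚ.+ 1ℚ) ℚ.* (k ℚ.- 1ℚ)}
      (0≤-* {u ℚ.+ 1ℚ} {k ℚ.- 1ℚ} (0≤-+ {u} {1ℚ} 0≤u (ℚ.<⇒≤ (ℚ.positive⁻¹ 1ℚ))) (≤⇒0≤ 1≤k)))))
  (solve 4 (λ M k P u →
      con four :* (con ½ :* (M :* u)) :- con four :* (u :+ con 1ℚ) :* (con ½ :* (M :* k)) :- P :* con 0ℚ
        :+ (u :+ con 1ℚ) :* (u :+ con 1ℚ) :* con 0ℚ
    := :- (con two :* M :* (con 1ℚ :+ (u :+ con 1ℚ) :* (k :- con 1ℚ)))) refl M k P u)

-- The form is minimal at l = K / B.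
summary⇒quadratic : ∀ M P u B re co K → 0ℚ ℚ.< B → re ≡ ½ ℚ.* (M ℚ.* u) → co ≡ ½ ℚ.* K →
  (∀ l → 0ℚ ℚ.≤ four ℚ.* re ℚ.- four ℚ.* l ℚ.* co ℚ.- P ℚ.* B ℚ.+ l ℚ.* l ℚ.* B) →
  B ℚ.* B ℚ.* P ℚ.+ K ℚ.* K ℚ.≤ two ℚ.* M ℚ.* u ℚ.* B
summary⇒quadratic M P u B _ _ K 0<B refl refl h = 0≤⇒≤
  {B ℚ.* B ℚ.* P ℚ.+ K ℚ.* K} {two ℚ.* M ℚ.* u ℚ.* B}
  (quadratic (K ℚ.* inv B) K (*-inv-cancel K B 0<B))
  (0≤-* {B} {four ℚ.* (½ ℚ.* (M ℚ.* u)) ℚ.- four ℚ.* (K ℚ.* inv B) ℚ.* (½ ℚ.* K) ℚ.- P ℚ.* B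
              ℚ.+ (K ℚ.* inv B) ℚ.* (K ℚ.* inv B) ℚ.* B} (ℚ.<⇒≤ 0<B) (h (K ℚ.* inv B)))
  where
  quadratic : ∀ l K → l ℚ.* B ≡ K →
    B ℚ.* (four ℚ.* (½ ℚ.* (M ℚ.* u)) ℚ.- four ℚ.* l ℚ.* (½ ℚ.* K) ℚ.- P ℚ.* B ℚ.+ l ℚ.* l ℚ.* B)
    ≡ two ℚ.* M ℚ.* u ℚ.* B ℚ.- (B ℚ.* B ℚ.* P ℚ.+ K ℚ.* K)
  quadratic l _ refl = solve 5 (λ M P u B l →
      B :* (con four :* (con ½ :* (M :* u)) :- con four :* l :* (con ½ :* (l :* B)) :- P :* B :+ l :* l :* B)
    := con two :* M :* u :* B :- (B :* B :* P :+ (l :* B) :* (l :* B))) refl M P u B l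

module _ (p q r : ℕ) (2≤p : 2 ℕ.≤ p) (p<q : p ℕ.< q) (sfp : SquareFree p) (sfq : SquareFree q)
         (p%4≡1 : p ℕ.% 4 ≡ 1) (rgg≡pq : r ℕ.* (gcd p q ℕ.* gcd p q) ≡ p ℕ.* q) (q<r : q ℕ.< r)
         (m t κ : ℕ) .{{_ : NonZero m}} .{{_ : NonZero t}} .{{_ : NonZero κ}} where

  private
    instance
      p≢0 : NonZero p
      p≢0 = ℕ.>-nonZero (ℕ.≤-trans (ℕ.s≤s ℕ.z≤n) 2≤p)
      q≢0 : NonZero q
      q≢0 = ℕ.>-nonZero (ℕ.≤-<-trans ℕ.z≤n p<q)

  module Counterexample (j : ℕ) (w²<κ²p : (κ ℕ.+ 2 ℕ.* j) ℕ.* (κ ℕ.+ 2 ℕ.* j) ℕ.< κ ℕ.* κ ℕ.* p)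
    (κ²p<u² : κ ℕ.* κ ℕ.* p ℕ.< (κ ℕ.+ 2 ℕ.* j ℕ.+ 2) ℕ.* (κ ℕ.+ 2 ℕ.* j ℕ.+ 2)) where

    private
      w u : ℕ
      w = κ ℕ.+ 2 ℕ.* j
      u = w ℕ.+ 2
      p′ : ℕ
      p′ = p ℕ./ 4
      instance
        u≢0 : NonZero u
        u≢0 = ℕ.>-nonZero (ℕ.<-≤-trans (ℕ.s≤s ℕ.z≤n) (ℕ.m≤n+m 2 w))
      P M k k′ w′ : ℚ
      P = ι (+ p)
      M = ι (+ m)
      k = ι (+ κ)
      k′ = ι (+ (m ℕ.* κ))
      w′ = ι (+ w)

      κ²p≡ : ι (+ (κ ℕ.* κ ℕ.* p)) ≡ k ℚ.* k ℚ.* P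
      κ²p≡ = trans (ι-*ℕ (κ ℕ.* κ) p) (cong (ℚ._* P) (ι-*ℕ κ κ))

      ι-suc≤ : ∀ {a b} → a ℕ.< b → ι (+ a) ℚ.+ 1ℚ ℚ.≤ ι (+ b)
      ι-suc≤ {a} {b} a<b = subst (ℚ._≤ ι (+ b)) (trans (ι-+ℕ 1 a) (ℚ.+-comm 1ℚ (ι (+ a))))
        (ι-mono-≤ {+ suc a} {+ b} (ℤ.+≤+ a<b))

      W : w′ ℚ.* w′ ℚ.< k ℚ.* k ℚ.* P
      W = subst₂ ℚ._<_ (ι-*ℕ w w) κ²p≡
        (ℚ.<-≤-trans {ι (+ (w ℕ.* w))} (subst (ℚ._< ι (+ (w ℕ.* w)) ℚ.+ 1ℚ) (ℚ.+-identityʳ (ι (+ (w ℕ.* w))))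
          (ℚ.+-monoʳ-< (ι (+ (w ℕ.* w))) (ℚ.positive⁻¹ 1ℚ))) (ι-suc≤ w²<κ²p))

      U : k ℚ.* k ℚ.* P ℚ.+ 1ℚ ℚ.≤ ι (+ u) ℚ.* ι (+ u)
      U = subst₂ (λ x y → x ℚ.+ 1ℚ ℚ.≤ y) κ²p≡ (ι-*ℕ u u) (ι-suc≤ κ²p<u²)

      open Element p q κ u

      -- From u = κ + 2(j + 1) and p = 1 + 4p′.
      e : ℤ
      e = + (κ ℕ.* suc j ℕ.+ suc j ℕ.* suc j) ℤ.- + (κ ℕ.* κ ℕ.* p′)

      u≡ : ι (+ u) ≡ k ℚ.+ two ℚ.* ι (+ suc j)
      u≡ = trans (cong (λ n → ι (+ n)) (trans (ℕ.+-assoc κ (2 ℕ.* j) 2)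
          (cong (κ ℕ.+_) (trans (ℕ.+-comm (2 ℕ.* j) 2) (sym (ℕ.*-suc 2 j))))))
        (trans (ι-+ℕ κ (2 ℕ.* suc j)) (cong (k ℚ.+_) (ι-*ℕ 2 (suc j))))

      P≡ : P ≡ 1ℚ ℚ.+ ι (+ p′) ℚ.* four
      P≡ = trans (cong (λ n → ι (+ n)) (trans (m≡m%n+[m/n]*n p 4) (cong (ℕ._+ p′ ℕ.* 4) p%4≡1)))
        (trans (ι-+ℕ 1 (p′ ℕ.* 4)) (cong (1ℚ ℚ.+_) (ι-*ℕ p′ 4)))

      e≡ : ι e ≡ k ℚ.* ι (+ suc j) ℚ.+ ι (+ suc j) ℚ.* ι (+ suc j) ℚ.- k ℚ.* k ℚ.* ι (+ p′)
      e≡ = trans (ι-+ (+ (κ ℕ.* suc j ℕ.+ suc j ℕ.* suc j)) (ℤ.- + (κ ℕ.* κ ℕ.* p′)))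
        (cong₂ ℚ._+_
          (trans (ι-+ℕ (κ ℕ.* suc j) (suc j ℕ.* suc j)) (cong₂ ℚ._+_ (ι-*ℕ κ (suc j)) (ι-*ℕ (suc j) (suc j))))
          (trans (ι-neg (+ (κ ℕ.* κ ℕ.* p′)))
            (cong ℚ.-_ (trans (ι-*ℕ (κ ℕ.* κ) p′) (cong (ℚ._* ι (+ p′)) (ι-*ℕ κ κ))))))

      4e : four ℚ.* ι e ≡ ι (+ u) ℚ.* ι (+ u) ℚ.- k ℚ.* k ℚ.* P
      4e = discriminant k (ι (+ suc j)) (ι (+ p′)) e≡ u≡ P≡
        where
        discriminant : ∀ k i p′ {e u P} → e ≡ k ℚ.* i ℚ.+ i ℚ.* i ℚ.- k ℚ.* k ℚ.* p′ → u ≡ k ℚ.+ two ℚ.* i →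
          P ≡ 1ℚ ℚ.+ p′ ℚ.* four → four ℚ.* e ≡ u ℚ.* u ℚ.- k ℚ.* k ℚ.* P
        discriminant k i p′ refl refl refl = solve 3 (λ k i p′ →
          con four :* (k :* i :+ i :* i :- k :* k :* p′)
          := (k :+ con two :* i) :* (k :+ con two :* i) :- k :* k :* (con 1ℚ :+ p′ :* con four)) refl k i p′

    mα : K p q
    mα = fromℤᴷ (+ m) *ᴷ α

    mα∈ : (m · 𝒪⁺ p q) mα
    mα∈ = α , (α-integral e 4e , α-positive U) , refl

    re-mα : K.re mα ≡ ½ ℚ.* (M ℚ.* ι (+ u))
    re-mα = scaled-re M P (ι (+ q)) (ι (+ u)) k

    √p-mα : K.coeff-√p mα ≡ ½ ℚ.* k′
    √p-mα = trans (scaled-√p M (ι (+ q)) (ι (+ u)) k) (cong (½ ℚ.*_) (sym (ι-*ℕ m κ)))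

    trace-small : fromℕ m ≤ fromℕ r / (fromℕ 16 * (fromℕ κ * √ r + fromℕ 1)) →
      sixteen ℚ.* K.re mα ℚ.< ι (+ r)
    trace-small h = subst (ℚ._< ι (+ r))
      (trans (trans (cong (eight ℚ.* M ℚ.*_) (sym (ι-+ℕ w 2)))
          (solve 2 (λ M u → con eight :* M :* u := con sixteen :* (con ½ :* (M :* u))) refl M (ι (+ u))))
        (cong (sixteen ℚ.*_) (sym re-mα)))
      (trace-bound m κ p r w (ℕ.<⇒≤ (ℕ.<-trans p<q q<r)) W h)

    no-summary-mα : √ p ∈ I₄ m t κ → ∀ B → ¬ Summary {p} {q} mα B
    no-summary-mα √p∈ zero h = no-summary M k P (ι (+ u)) (K.re mα) (K.coeff-√p mα)
      (0<ι m) (ι-mono-≤ {+ 1} {+ κ} (ℤ.+≤+ (ℕ.>-nonZero⁻¹ κ))) (0≤ι u) re-mα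
      (trans √p-mα (cong (½ ℚ.*_) (ι-*ℕ m κ))) h
    no-summary-mα √p∈ B@(suc _) h = excluded p m κ w t W √p∈ B
      (subst (λ y → ι (+ B) ℚ.* ι (+ B) ℚ.* P ℚ.+ k′ ℚ.* k′ ℚ.≤ two ℚ.* M ℚ.* y ℚ.* ι (+ B)) (ι-+ℕ w 2)
        (summary⇒quadratic M P (ι (+ u)) (ι (+ B)) (K.re mα) (K.coeff-√p mα) k′ (0<ι B) re-mα √p-mα h))

    mα-not-sum : fromℕ m ≤ fromℕ r / (fromℕ 16 * (fromℕ κ * √ r + fromℕ 1)) →
      √ p ∈ I₄ m t κ → ¬ SumsOfSquares p q mα
    mα-not-sum h √p∈ (ys , ys∈ , mα≡) =
      let ys∈′ = All.map integral⇒almostIntegral ys∈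
          d≡0  = All.zipWith
            (λ {y} (y∈ , d≤) → √pq-part-bound sfp sfq r rgg≡pq y∈
              (ℚ.≤-<-trans {sixteen ℚ.* √pq-part y} {sixteen ℚ.* K.re mα} {ι (+ r)}
                (ℚ.*-monoˡ-≤-nonNeg sixteen {√pq-part y} {K.re mα}
                  (subst (λ s → √pq-part y ℚ.≤ K.re s) (sym mα≡) d≤))
                (trace-small h)))
            (ys∈′ , √pq-part≤re ys)
          B , s = summary sfp ys∈′ d≡0
      in no-summary-mα √p∈ B (subst (λ s → Summary s B) (sym mα≡) s)

  not-all-sums : fromℕ m ≤ fromℕ r / (fromℕ 16 * (fromℕ κ * √ r + fromℕ 1)) →
    √ p ∈ I₄ m t κ → m · 𝒪⁺ p q ⊈ SumsOfSquares p q
  not-all-sums h √p∈ m𝒪⁺⊆ =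
    let j , w²<κ²p , κ²p<u² = approximation p κ 2≤p sfp
        open Counterexample j w²<κ²p κ²p<u²
    in mα-not-sum h √p∈ (m𝒪⁺⊆ {mα} mα∈)

proposition7p1 : ∀ (p q r : ℕ) →
    2 ℕ.≤ p → p ℕ.< q →
    SquareFree p → SquareFree q →
    p ℕ.% 4 ≡ 1 → q ℕ.% 4 ≡ 1 →
    r ℕ.* (gcd p q ℕ.* gcd p q) ≡ p ℕ.* q →
    q ℕ.< r →
    (gcd p q ℕ.% 4 ≡ 1) ⊎ (gcd p q ℕ.% 4 ≡ 3) →
    ∀ (m t κ : ℕ) .{{_ : NonZero m}} .{{_ : NonZero t}} .{{_ : NonZero κ}} →
    ( fromℕ m ≤ fromℕ r / (fromℕ 16 * (fromℕ κ * √ r + fromℕ 1)) →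
    m ℕ.≤ p → m ℕ.≤ q →
    √ p ∈ I₄ m t κ → √ q ∈ I₄ m t κ →
    m · 𝒪⁺ p q ⊈ SumsOfSquares p q )
    ×
    ( fromℕ 4 *
    ( fromℕ (t ℕ.* (t ℕ.∸ 1)) * (fromℕ (2 ℕ.* t ℕ.∸ 1) + fromℕ 2 * √ (t ℕ.* (t ℕ.∸ 1)))
    / (fromℕ κ * fromℕ κ) )
    ≤ fromℕ m →
    Satisfiable (I₄ m t κ) )
proposition7p1 p q r 2≤p p<q sfp sfq p%4≡1 _ rgg≡pq q<r _ m t κ =
  (λ h _ _ √p∈ _ → not-all-sums p q r 2≤p p<q sfp sfq p%4≡1 rgg≡pq q<r m t κ h √p∈) ,
  I₄-satisfiable m t κ
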